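{- Let $G$ be a finite simple graph whose vertex set is partitioned as $V(G) = I \sqcup F \sqcup U$. For a subgraph $H \subseteq G$ define its potential \[\rho_G(H) = |I \cap V(H)| + 4|F \cap V(H)| + 5|U \cap V(H)| - 4|E(H)|.\] If $\rho_G(H) > 0$ for every nonempty subgraph $H \subseteq G$, then $G$ has an I,F-partition $\mathcal{I} \sqcup \mathcal{F}$ with $I \subseteq \mathcal{I}$ and $F \subseteq \mathcal{F}$.
   Context: An I,F-partition of a graph $G$ is a partition $V(G) = \mathcal{I} \sqcup \mathcal{F}$ where $\mathcal{I}$ is a 2-independent set (a set of vertices with pairwise distance in $G$ greater than $2$) and the induced subgraph $G[\mathcal{F}]$ is a forest. -}

module Defs where

open import Data.Nat using (ℕ; zero; suc; _+_; _*_; _<_)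
open import Data.Nat.Base using (_<ᵇ_)
open import Data.Fin using (Fin; zero; suc; toℕ; inject₁; fromℕ)
open import Data.Bool using (Bool; true; false; _∧_; if_then_else_)
open import Data.Product using (Σ; ∃; _×_; _,_)
open import Relation.Binary.PropositionalEquality using (_≡_; _≢_)
open import Relation.Nullary using (¬_)
open import Function.Definitions using (Injective)

record SimpleGraph (n : ℕ) : Set where
  field
    adj    : Fin n → Fin n → Bool
    sym    : ∀ u v → adj u v ≡ adj v u
    irrefl : ∀ v → adj v v ≡ false
open SimpleGraph public

count : ∀ {n} → (Fin n → Bool) → ℕ
count {zero}  p = 0
count {suc n} p = (if p zero then 1 else 0) + count (λ i → p (suc i))

sumFin : ∀ {n} → (Fin n → ℕ) → ℕ
sumFin {zero}  f = 0
sumFin {suc n} f = f zero + sumFin (λ i → f (suc i))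

data Label : Set where
  I F U : Label

isI isF isU : Label → Bool
isI I = true
isI _ = false
isF F = true
isF _ = false
isU U = true
isU _ = false

record Subgraph {n : ℕ} (G : SimpleGraph n) : Set where
  field
    vert     : Fin n → Bool
    edge     : Fin n → Fin n → Bool
    edge-sym : ∀ u v → edge u v ≡ edge v u
    edge-adj : ∀ u v → edge u v ≡ true → adj G u v ≡ true
    edge-end : ∀ u v → edge u v ≡ true → vert u ≡ true
open Subgraph public

-- |E(H)|: each edge {u,v} counted once, via the pair with toℕ u < toℕ v.
edgeCount : ∀ {n} {G : SimpleGraph n} → Subgraph G → ℕ
edgeCount H = sumFin (λ u → count (λ v → (toℕ u <ᵇ toℕ v) ∧ edge H u v))

Nonempty : ∀ {n} {G : SimpleGraph n} → Subgraph G → Set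
Nonempty {n} H = ∃ λ (v : Fin n) → vert H v ≡ true

-- The positive part and the subtracted part of the potential
--   ρ_G(H) = |I ∩ V(H)| + 4|F ∩ V(H)| + 5|U ∩ V(H)| - 4|E(H)|.
-- ρ_G(H) > 0  iff  potNeg H < potPos H  (an equivalent form avoiding ℤ).
potPos : ∀ {n} {G : SimpleGraph n} → (Fin n → Label) → Subgraph G → ℕ
potPos ℓ H =
    count (λ v → vert H v ∧ isI (ℓ v))
  + 4 * count (λ v → vert H v ∧ isF (ℓ v))
  + 5 * count (λ v → vert H v ∧ isU (ℓ v))

potNeg : ∀ {n} {G : SimpleGraph n} → Subgraph G → ℕ
potNeg H = 4 * edgeCount H

PositivePotential : ∀ {n} {G : SimpleGraph n} → (Fin n → Label) → Subgraph G → Set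
PositivePotential ℓ H = potNeg H < potPos ℓ H

-- 2-independent set: distinct members are at distance > 2, i.e. are
-- non-adjacent and have no common neighbour.
TwoIndependent : ∀ {n} → SimpleGraph n → (Fin n → Bool) → Set
TwoIndependent {n} G S =
  ∀ u v → S u ≡ true → S v ≡ true → u ≢ v →
    (adj G u v ≡ false) ×
    (¬ (∃ λ (w : Fin n) → (adj G u w ≡ true) × (adj G w v ≡ true)))

-- A cycle of length k+3 in G: an injective cyclic sequence of vertices
-- c 0, c 1, …, c (k+2) with consecutive ones (and last/first) adjacent.
record Cycle {n : ℕ} (G : SimpleGraph n) : Set where
  field
    len     : ℕ
    vtx     : Fin (suc (suc (suc len))) → Fin n
    inj     : Injective _≡_ _≡_ vtx
    step    : ∀ (i : Fin (suc (suc len))) → adj G (vtx (inject₁ i)) (vtx (suc i)) ≡ true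
    close   : adj G (vtx (fromℕ (suc (suc len)))) (vtx zero) ≡ true
open Cycle public

InducedForest : ∀ {n} → SimpleGraph n → (Fin n → Bool) → Set
InducedForest G S = ¬ (Σ (Cycle G) λ C → ∀ i → S (vtx C i) ≡ true)

-- An I,F-partition given by its characteristic function: 𝓘 = {v | part v = true},
-- 𝓕 = {v | part v = false}.
IFPartition : ∀ {n} → SimpleGraph n → (Fin n → Bool) → Set
IFPartition G part =
  TwoIndependent G (λ v → part v) ×
  InducedForest G (λ v → if part v then false else true)

{-# OPTIONS --safe #-}

-- Replace every vertex of I by a mark on its neighbours ("sealed": in the forest, without a neighbour in
-- the 2-independent set), and call a set acyclic when each nonempty part induces fewer edges than vertices;
-- all conditions then become counting inequalities. Induct on the number of vertices.
--
-- If some proper set of at least two vertices has potential at most ρ(G) + 1, take one of minimum potential,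
-- solve it, and contract it to a single sealed vertex, sealing the outside neighbours of its chosen vertices;
-- minimality keeps the contracted graph sparse. Otherwise every such set has potential at least 3, and this
-- slack pays for relabelling a few vertices in the reductions: vertices of degree at most 1, F-vertices of
-- degree 2 next to a U-vertex of degree 2, F-vertices ending a path through two U-vertices of degree 2,
-- U-vertices all of whose neighbours are U-vertices of degree 2, and U-vertices of degree 3 ending such a path
-- and having a second neighbour of degree 2 in U. In a graph without these, moving the charge 1 of each
-- U-vertex of degree 2 to its neighbours shows that the total potential is at most 0, a contradiction.
module Submission where

open import Defs renaming (sym to adj-sym; irrefl to adj-irrefl)
open import Data.Nat using (ℕ; zero; suc; _+_; _*_; _∸_; _≤_; _<_; _≤ᵇ_; _<ᵇ_; z≤n; s≤s) renaming (_≟_ to _≟ⁿ_)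
open import Data.Nat.Properties hiding (_≟_)
open import Data.Nat.Solver using (module +-*-Solver)
open import Data.Fin using (Fin; zero; suc; toℕ; inject₁; fromℕ)
open import Data.Fin.Properties using (_≟_; any?; toℕ-injective; toℕ-inject₁)
open import Data.Fin.Relation.Unary.Top using (view; ‵fromℕ; ‵inject₁)
open import Data.Fin.Subset.Properties using (anySubset?)
open import Data.Bool using (Bool; true; false; T; _∧_; _∨_; not; if_then_else_)
import Data.Bool.Properties as Bool
open import Data.Product using (Σ; ∃; _×_; _,_; proj₁; proj₂)
open import Data.Sum using (_⊎_; inj₁; inj₂)
open import Data.Empty using (⊥; ⊥-elim)
open import Data.Unit using (⊤; tt)
open import Data.List using (List; []; _∷_)
open import Data.Vec as Vec using (Vec; []; _∷_; lookup)
open import Data.Vec.Properties using (lookup∘tabulate)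
open import Function using (_∘_)
open import Function.Bundles using (Equivalence)
open import Relation.Binary using (tri<; tri≈; tri>)
open import Relation.Nullary using (¬_; Dec; yes; no; does)
open import Relation.Nullary.Decidable using (_×-dec_; dec-true; dec-false)
open import Relation.Binary.PropositionalEquality using (_≡_; _≢_; refl; sym; trans; cong; cong₂; subst; subst₂; module ≡-Reasoning)

-- The threshold ρ(G) + 1 balances two demands. If every proper set of at least two vertices exceeds
-- it, each such set has potential at least ρ(G) + 2 ≥ 3, so a reduction may spend 2 and stay
-- sparse. The price is paid when a set H with ρ(H) = ρ(G) + 1 is contracted. If ρ(H) ≤ ρ(G),
-- minimality gives ρ(B) ≥ 4m for every set B outside H with m edges to H, so each edge to a chosen
-- vertex pays for the 3 that sealing costs and 1 remains. If ρ(H) = ρ(G) + 1, this fails by 1 when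
-- B is the whole outside. The remedy is to relabel, before solving H, one vertex of H with an
-- outside neighbour so that it lies in the forest: its edge costs no sealing and supplies the
-- missing amount. The relabelling is affordable because every subset of H with at least two
-- vertices then has potential at least ρ(H) ≥ 2. The contracted vertex has weight 2: one unit
-- covers the deficit of 1, the other keeps the potential positive.

private variable
  m n : ℕ

-- Vertex sets as Boolean-valued functions

VSet : ℕ → Set
VSet n = Fin n → Bool

infix 4 _∈_ _∉_ _⊆_
infixl 6 _∪_ _⊖_

_∈_ _∉_ : Fin n → VSet n → Set
v ∈ K = K v ≡ true
v ∉ K = K v ≡ false

_⊆_ : VSet n → VSet n → Set
K ⊆ L = ∀ v → v ∈ K → v ∈ L

Inhabited : VSet n → Set
Inhabited K = ∃ λ v → v ∈ K

⁅_⁆ : Fin n → VSet n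
⁅ x ⁆ v = does (x ≟ v)

_∪_ _∖_ _∩_ : VSet n → VSet n → VSet n
(K ∪ L) v = K v ∨ L v
(K ∖ L) v = K v ∧ not (L v)
(K ∩ L) v = K v ∧ L v

_⊖_ : VSet n → Fin n → VSet n
K ⊖ x = K ∖ ⁅ x ⁆

∅ : VSet n
∅ _ = false

true≢false : ∀ {b} → b ≡ true → b ≡ false → ⊥
true≢false refl ()

member? : (K : VSet n) (v : Fin n) → v ∈ K ⊎ v ∉ K
member? K v with K v
... | true  = inj₁ refl
... | false = inj₂ refl

∉-intro : (K : VSet n) {v : Fin n} → (v ∈ K → ⊥) → v ∉ K
∉-intro K {v} h with member? K v
... | inj₁ p = ⊥-elim (h p)
... | inj₂ p = p

∧-trueˡ : ∀ a {b} → a ∧ b ≡ true → a ≡ true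
∧-trueˡ true _ = refl

∧-trueʳ : ∀ a {b} → a ∧ b ≡ true → b ≡ true
∧-trueʳ true p = p

∧-true : ∀ {a b} → a ≡ true → b ≡ true → a ∧ b ≡ true
∧-true refl refl = refl

not-true : ∀ {a} → a ≡ false → not a ≡ true
not-true refl = refl

not-true⁻ : ∀ {a} → not a ≡ true → a ≡ false
not-true⁻ {false} _ = refl

does⁻ : ∀ {R : Set} (d : Dec R) → does d ≡ true → R
does⁻ (yes r) _ = r

∈⁅⁆ : (x : Fin n) → x ∈ ⁅ x ⁆
∈⁅⁆ x = dec-true (x ≟ x) refl

∈⁅⁆⁻ : ∀ (x : Fin n) {v} → v ∈ ⁅ x ⁆ → v ≡ x
∈⁅⁆⁻ x {v} p = sym (does⁻ (x ≟ v) p)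

∉⁅⁆ : ∀ (x : Fin n) {v} → v ≢ x → v ∉ ⁅ x ⁆
∉⁅⁆ x {v} p = dec-false (x ≟ v) (p ∘ sym)

∈∪ˡ : ∀ (K L : VSet n) {v} → v ∈ K → v ∈ K ∪ L
∈∪ˡ K L p rewrite p = refl

∈∪ʳ : ∀ (K L : VSet n) {v} → v ∈ L → v ∈ K ∪ L
∈∪ʳ K L {v} p rewrite p = Bool.∨-zeroʳ (K v)

∈∪⁻ : ∀ (K L : VSet n) {v} → v ∈ K ∪ L → v ∈ K ⊎ v ∈ L
∈∪⁻ K L {v} p with K v
... | true  = inj₁ refl
... | false = inj₂ p

∉∪ : ∀ (K L : VSet n) {v} → v ∉ K → v ∉ L → v ∉ K ∪ L
∉∪ K L p q rewrite p | q = refl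

∈∖ : ∀ (K L : VSet n) {v} → v ∈ K → v ∉ L → v ∈ K ∖ L
∈∖ K L p q = ∧-true p (not-true q)

∈∖ˡ : ∀ (K L : VSet n) {v} → v ∈ K ∖ L → v ∈ K
∈∖ˡ K L {v} = ∧-trueˡ (K v)

∈∖ʳ : ∀ (K L : VSet n) {v} → v ∈ K ∖ L → v ∉ L
∈∖ʳ K L {v} p = not-true⁻ (∧-trueʳ (K v) p)

∈⊖ : ∀ (K : VSet n) x {v} → v ∈ K → v ≢ x → v ∈ K ⊖ x
∈⊖ K x p q = ∈∖ K ⁅ x ⁆ p (∉⁅⁆ x q)

∈⊖ˡ : ∀ (K : VSet n) x {v} → v ∈ K ⊖ x → v ∈ K
∈⊖ˡ K x = ∈∖ˡ K ⁅ x ⁆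

∈⊖ʳ : ∀ (K : VSet n) x {v} → v ∈ K ⊖ x → v ≢ x
∈⊖ʳ K x p refl = true≢false (∈⁅⁆ x) (∈∖ʳ K ⁅ x ⁆ p)

x∉⊖ : ∀ (K : VSet n) x → x ∉ K ⊖ x
x∉⊖ K x = ∉-intro (K ⊖ x) (λ p → ∈⊖ʳ K x p refl)

≐-intro : (K L : VSet n) → K ⊆ L → L ⊆ K → ∀ v → K v ≡ L v
≐-intro K L p q v with member? K v | member? L v
... | inj₁ a | _      = trans a (sym (p v a))
... | inj₂ a | inj₁ b = ⊥-elim (true≢false (q v b) a)
... | inj₂ a | inj₂ b = trans a (sym b)

inhabited? : (K : VSet n) → Inhabited K ⊎ (∀ v → v ∉ K)
inhabited? K with any? (λ v → K v Bool.≟ true)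
... | yes p = inj₁ p
... | no ¬p = inj₂ λ v → ∉-intro K (λ q → ¬p (v , q))

⊆-or-escapes : (K L : VSet n) → K ⊆ L ⊎ ∃ λ v → v ∈ K × v ∉ L
⊆-or-escapes K L with inhabited? (K ∖ L)
... | inj₁ (v , p) = inj₂ (v , ∈∖ˡ K L p , ∈∖ʳ K L p)
... | inj₂ p = inj₁ inside
  where
  inside : K ⊆ L
  inside v q with member? L v
  ... | inj₁ r = r
  ... | inj₂ r = ⊥-elim (true≢false (∈∖ K L q r) (p v))

-- Replaces the assumption that nothing is reducible: if every vertex yields a solution or a local
-- property, then a solution exists or the property holds everywhere.
either-all : ∀ {S : Set} {P : Fin n → Set} → (∀ v → S ⊎ P v) → S ⊎ (∀ v → P v)
either-all {zero} h = inj₂ λ ()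
either-all {suc n} h with h zero | either-all (h ∘ suc)
... | inj₁ s | _      = inj₁ s
... | inj₂ _ | inj₁ s = inj₁ s
... | inj₂ p | inj₂ q = inj₂ λ { zero → p ; (suc v) → q v }

-- Sums over vertex sets

𝟙 : Bool → ℕ
𝟙 b = if b then 1 else 0

sumFin-cong : {f g : Fin n → ℕ} → (∀ v → f v ≡ g v) → sumFin f ≡ sumFin g
sumFin-cong {zero}  h = refl
sumFin-cong {suc n} h = cong₂ _+_ (h zero) (sumFin-cong (h ∘ suc))

sumFin-mono : {f g : Fin n → ℕ} → (∀ v → f v ≤ g v) → sumFin f ≤ sumFin g
sumFin-mono {zero}  h = z≤n
sumFin-mono {suc n} h = +-mono-≤ (h zero) (sumFin-mono (h ∘ suc))

sumFin-0 : sumFin {n} (λ _ → 0) ≡ 0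
sumFin-0 {zero}  = refl
sumFin-0 {suc n} = sumFin-0 {n}

+-interchange : ∀ a b c d → (a + b) + (c + d) ≡ (a + c) + (b + d)
+-interchange a b c d = begin
  (a + b) + (c + d) ≡⟨ +-assoc a b (c + d) ⟩
  a + (b + (c + d)) ≡⟨ cong (a +_) (sym (+-assoc b c d)) ⟩
  a + ((b + c) + d) ≡⟨ cong (λ x → a + (x + d)) (+-comm b c) ⟩
  a + ((c + b) + d) ≡⟨ cong (a +_) (+-assoc c b d) ⟩
  a + (c + (b + d)) ≡⟨ sym (+-assoc a c (b + d)) ⟩
  (a + c) + (b + d) ∎
  where open ≡-Reasoning

sumFin-+ : (f g : Fin n → ℕ) → sumFin (λ v → f v + g v) ≡ sumFin f + sumFin g
sumFin-+ {zero}  f g = refl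
sumFin-+ {suc n} f g = trans (cong (f zero + g zero +_) (sumFin-+ (f ∘ suc) (g ∘ suc)))
                             (+-interchange (f zero) (g zero) _ _)

sumFin-swap : (f : Fin m → Fin n → ℕ) →
  sumFin (λ u → sumFin (f u)) ≡ sumFin (λ v → sumFin (λ u → f u v))
sumFin-swap {zero}  {n} f = sym (sumFin-0 {n})
sumFin-swap {suc m} f = trans (cong (sumFin (f zero) +_) (sumFin-swap (f ∘ suc)))
                              (sym (sumFin-+ (f zero) _))

∑ : VSet n → (Fin n → ℕ) → ℕ
∑ K f = sumFin (λ v → if K v then f v else 0)

card : VSet n → ℕ
card K = ∑ K (λ _ → 1)

∑-mono : (K : VSet n) {f g : Fin n → ℕ} → (∀ v → v ∈ K → f v ≤ g v) → ∑ K f ≤ ∑ K g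
∑-mono K {f} {g} h = sumFin-mono pointwise
  where
  pointwise : ∀ v → (if K v then f v else 0) ≤ (if K v then g v else 0)
  pointwise v with K v in eq
  ... | true  = h v eq
  ... | false = z≤n

∑-cong : (K : VSet n) {f g : Fin n → ℕ} → (∀ v → v ∈ K → f v ≡ g v) → ∑ K f ≡ ∑ K g
∑-cong K h = ≤-antisym (∑-mono K λ v p → ≤-reflexive (h v p))
                       (∑-mono K λ v p → ≤-reflexive (sym (h v p)))

∑-⊆ : (K L : VSet n) (f : Fin n → ℕ) → K ⊆ L → ∑ K f ≤ ∑ L f
∑-⊆ K L f h = sumFin-mono pointwise
  where
  pointwise : ∀ v → (if K v then f v else 0) ≤ (if L v then f v else 0)
  pointwise v with K v in eq
  ... | false = z≤n
  ... | true rewrite h v eq = ≤-refl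

∑-ext : (K L : VSet n) (f : Fin n → ℕ) → (∀ v → K v ≡ L v) → ∑ K f ≡ ∑ L f
∑-ext K L f h = sumFin-cong λ v → cong (if_then f v else 0) (h v)

∑-+ : (K : VSet n) (f g : Fin n → ℕ) → ∑ K (λ v → f v + g v) ≡ ∑ K f + ∑ K g
∑-+ K f g = trans (sumFin-cong pointwise) (sumFin-+ (λ v → if K v then f v else 0) (λ v → if K v then g v else 0))
  where
  pointwise : ∀ v → (if K v then f v + g v else 0) ≡ (if K v then f v else 0) + (if K v then g v else 0)
  pointwise v with K v
  ... | true  = refl
  ... | false = refl

∑-0 : (K : VSet n) → ∑ K (λ _ → 0) ≡ 0
∑-0 {n} K = trans (sumFin-cong pointwise) (sumFin-0 {n})
  where
  pointwise : ∀ v → (if K v then 0 else 0) ≡ 0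
  pointwise v with K v
  ... | true  = refl
  ... | false = refl

∑-* : ∀ c (K : VSet n) (f : Fin n → ℕ) → ∑ K (λ v → c * f v) ≡ c * ∑ K f
∑-* zero    K f = ∑-0 K
∑-* (suc c) K f = trans (∑-+ K f (λ v → c * f v)) (cong (∑ K f +_) (∑-* c K f))

∑-swap : (K : VSet m) (L : VSet n) (f : Fin m → Fin n → ℕ) →
  ∑ K (λ u → ∑ L (f u)) ≡ ∑ L (λ v → ∑ K (λ u → f u v))
∑-swap K L f = begin
  ∑ K (λ u → ∑ L (f u))
    ≡⟨ sumFin-cong (λ u → pull (K u) (λ v → if L v then f u v else 0)) ⟩
  sumFin (λ u → sumFin (λ v → if K u then (if L v then f u v else 0) else 0))
    ≡⟨ sumFin-swap (λ u v → if K u then (if L v then f u v else 0) else 0) ⟩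
  sumFin (λ v → sumFin (λ u → if K u then (if L v then f u v else 0) else 0))
    ≡⟨ sumFin-cong (λ v → sumFin-cong (λ u → commute (K u) (L v) (f u v))) ⟩
  sumFin (λ v → sumFin (λ u → if L v then (if K u then f u v else 0) else 0))
    ≡⟨ sym (sumFin-cong (λ v → pull (L v) (λ u → if K u then f u v else 0))) ⟩
  ∑ L (λ v → ∑ K (λ u → f u v)) ∎
  where
  open ≡-Reasoning
  pull : ∀ {k} b (g : Fin k → ℕ) → (if b then sumFin g else 0) ≡ sumFin (λ v → if b then g v else 0)
  pull true  g = refl
  pull {k} false g = sym (sumFin-0 {k})
  commute : ∀ a b x → (if a then (if b then x else 0) else 0) ≡ (if b then (if a then x else 0) else 0)
  commute true  true  x = refl
  commute true  false x = refl
  commute false true  x = refl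
  commute false false x = refl

∑-∪ : (K L : VSet n) (f : Fin n → ℕ) → (∀ v → v ∈ K → v ∉ L) → ∑ (K ∪ L) f ≡ ∑ K f + ∑ L f
∑-∪ K L f disj = trans (sumFin-cong pointwise) (sumFin-+ (λ v → if K v then f v else 0) (λ v → if L v then f v else 0))
  where
  pointwise : ∀ v → (if K v ∨ L v then f v else 0) ≡ (if K v then f v else 0) + (if L v then f v else 0)
  pointwise v with K v in eq
  ... | false = refl
  ... | true rewrite disj v eq = sym (+-identityʳ (f v))

∑-⁅⁆ : (x : Fin n) (f : Fin n → ℕ) → ∑ ⁅ x ⁆ f ≡ f x
∑-⁅⁆ {suc n} zero    f = trans (cong (f zero +_) (sumFin-0 {n})) (+-identityʳ (f zero))
∑-⁅⁆ {suc n} (suc x) f = ∑-⁅⁆ x (f ∘ suc)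

∑-⊖ : (K : VSet n) {x : Fin n} (f : Fin n → ℕ) → x ∈ K → ∑ K f ≡ f x + ∑ (K ⊖ x) f
∑-⊖ K {x} f p = begin
  ∑ K f                     ≡⟨ ∑-ext K (⁅ x ⁆ ∪ (K ⊖ x)) f (≐-intro K (⁅ x ⁆ ∪ (K ⊖ x)) there back) ⟩
  ∑ (⁅ x ⁆ ∪ (K ⊖ x)) f     ≡⟨ ∑-∪ ⁅ x ⁆ (K ⊖ x) f disj ⟩
  ∑ ⁅ x ⁆ f + ∑ (K ⊖ x) f   ≡⟨ cong (_+ ∑ (K ⊖ x) f) (∑-⁅⁆ x f) ⟩
  f x + ∑ (K ⊖ x) f         ∎
  where
  open ≡-Reasoning
  there : K ⊆ ⁅ x ⁆ ∪ (K ⊖ x)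
  there v q with v ≟ x
  ... | yes refl = ∈∪ˡ ⁅ x ⁆ (K ⊖ x) (∈⁅⁆ x)
  ... | no r = ∈∪ʳ ⁅ x ⁆ (K ⊖ x) (∈⊖ K x q r)
  back : ⁅ x ⁆ ∪ (K ⊖ x) ⊆ K
  back v q with ∈∪⁻ ⁅ x ⁆ (K ⊖ x) {v} q
  ... | inj₁ r rewrite ∈⁅⁆⁻ x {v} r = p
  ... | inj₂ r = ∈⊖ˡ K x r
  disj : ∀ v → v ∈ ⁅ x ⁆ → v ∉ K ⊖ x
  disj v r rewrite ∈⁅⁆⁻ x {v} r = x∉⊖ K x

term≤∑ : (K : VSet n) {x : Fin n} (f : Fin n → ℕ) → x ∈ K → f x ≤ ∑ K f
term≤∑ K f p rewrite ∑-⊖ K f p = m≤m+n _ _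

terms≤∑ : (K : VSet n) {x y : Fin n} (f : Fin n → ℕ) → x ∈ K → y ∈ K → x ≢ y → f x + f y ≤ ∑ K f
terms≤∑ K {x} {y} f p q r rewrite ∑-⊖ K f p =
  +-monoʳ-≤ (f x) (term≤∑ (K ⊖ x) f (∈⊖ K x q (r ∘ sym)))

∑≡0 : (K : VSet n) (f : Fin n → ℕ) → (∀ v → v ∈ K → f v ≡ 0) → ∑ K f ≡ 0
∑≡0 K f h = trans (∑-cong K h) (∑-0 K)

∑≤term : (K : VSet n) (x : Fin n) (f : Fin n → ℕ) → (∀ v → v ∈ K → v ≢ x → f v ≡ 0) → ∑ K f ≤ f x
∑≤term K x f h with member? K x
... | inj₁ p rewrite ∑-⊖ K f p
                   | ∑≡0 (K ⊖ x) f (λ v q → h v (∈⊖ˡ K x q) (∈⊖ʳ K x q)) = ≤-reflexive (+-identityʳ (f x))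
... | inj₂ p rewrite ∑≡0 K f (λ v q → h v q λ { refl → true≢false q p }) = z≤n

∑-positive : (K : VSet n) (f : Fin n → ℕ) → 1 ≤ ∑ K f → ∃ λ v → v ∈ K × 1 ≤ f v
∑-positive K f h with any? (λ v → (K v Bool.≟ true) ×-dec (1 ≤? f v))
... | yes p = p
... | no ¬p = ⊥-elim (1+n≰n (subst (1 ≤_) (∑≡0 K f λ v q → n<1⇒n≡0 (≰⇒> λ r → ¬p (v , q , r))) h))

∑-zero⁻ : (K : VSet n) (f : Fin n → ℕ) → ∑ K f ≡ 0 → ∀ v → v ∈ K → f v ≡ 0
∑-zero⁻ K f h v p = n≤0⇒n≡0 (subst (f v ≤_) h (term≤∑ K f p))

card-< : (K L : VSet n) → K ⊆ L → ∀ {x} → x ∈ L → x ∉ K → card K < card L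
card-< K L sub {x} p q rewrite ∑-⊖ L (λ _ → 1) p =
  s≤s (∑-⊆ K (L ⊖ x) (λ _ → 1) λ v r → ∈⊖ L x (sub v r) λ { refl → true≢false r q })

∃⇒1≤card : (K : VSet n) → Inhabited K → 1 ≤ card K
∃⇒1≤card K (v , p) = term≤∑ K (λ _ → 1) p

-- Linear arithmetic over ℕ

infixl 6 _⊞_
infixl 7 _⊠_
infix 5 _≲_

data Expr (k : ℕ) : Set where
  atom  : Fin k → Expr k
  lit  : ℕ → Expr k
  _⊞_ : Expr k → Expr k → Expr k
  _⊠_ : ℕ → Expr k → Expr k

record Ineq (k : ℕ) : Set where
  constructor _≲_
  field lhs rhs : Expr k

⟦_⟧ : ∀ {k} → Expr k → Vec ℕ k → ℕ
⟦ atom i ⟧  ρ = lookup ρ i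
⟦ lit c ⟧  ρ = c
⟦ a ⊞ b ⟧ ρ = ⟦ a ⟧ ρ + ⟦ b ⟧ ρ
⟦ c ⊠ a ⟧ ρ = c * ⟦ a ⟧ ρ

Holds : ∀ {k} → Vec ℕ k → Ineq k → Set
Holds ρ (a ≲ b) = ⟦ a ⟧ ρ ≤ ⟦ b ⟧ ρ

Affine : ℕ → Set
Affine k = ℕ × Vec ℕ k

dot : ∀ {k} → Vec ℕ k → Vec ℕ k → ℕ
dot []       []       = 0
dot (c ∷ cs) (x ∷ xs) = c * x + dot cs xs

evalAffine : ∀ {k} → Affine k → Vec ℕ k → ℕ
evalAffine (c , cs) ρ = c + dot cs ρ

zeros : ∀ k → Vec ℕ k
zeros zero    = []
zeros (suc k) = 0 ∷ zeros k

unit : ∀ {k} → Fin k → Vec ℕ k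
unit {suc k} zero    = 1 ∷ zeros k
unit {suc k} (suc i) = 0 ∷ unit i

plus : ∀ {k} → Vec ℕ k → Vec ℕ k → Vec ℕ k
plus []       []       = []
plus (a ∷ as) (b ∷ bs) = a + b ∷ plus as bs

scale : ∀ {k} → ℕ → Vec ℕ k → Vec ℕ k
scale c []       = []
scale c (a ∷ as) = c * a ∷ scale c as

normalise : ∀ {k} → Expr k → Affine k
normalise (atom i)        = 0 , unit i
normalise {k} (lit c)    = c , zeros k
normalise (a ⊞ b) with normalise a | normalise b
... | c , cs | d , ds    = c + d , plus cs ds
normalise (m ⊠ a) with normalise a
... | c , cs             = m * c , scale m cs

dot-zeros : ∀ {k} (ρ : Vec ℕ k) → dot (zeros k) ρ ≡ 0
dot-zeros []      = refl
dot-zeros (x ∷ ρ) = dot-zeros ρ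

dot-unit : ∀ {k} (i : Fin k) (ρ : Vec ℕ k) → dot (unit i) ρ ≡ lookup ρ i
dot-unit zero    (x ∷ ρ) = trans (cong₂ _+_ (*-identityˡ x) (dot-zeros ρ)) (+-identityʳ x)
dot-unit (suc i) (x ∷ ρ) = dot-unit i ρ

dot-plus : ∀ {k} (as bs ρ : Vec ℕ k) → dot (plus as bs) ρ ≡ dot as ρ + dot bs ρ
dot-plus []       []       []      = refl
dot-plus (a ∷ as) (b ∷ bs) (x ∷ ρ) =
  trans (cong₂ _+_ (*-distribʳ-+ x a b) (dot-plus as bs ρ)) (+-interchange (a * x) (b * x) _ _)

dot-scale : ∀ {k} c (as ρ : Vec ℕ k) → dot (scale c as) ρ ≡ c * dot as ρ
dot-scale c []       []      = sym (*-zeroʳ c)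
dot-scale c (a ∷ as) (x ∷ ρ) =
  trans (cong₂ _+_ (*-assoc c a x) (dot-scale c as ρ)) (sym (*-distribˡ-+ c (a * x) (dot as ρ)))

normalise-sound : ∀ {k} (a : Expr k) ρ → evalAffine (normalise a) ρ ≡ ⟦ a ⟧ ρ
normalise-sound (atom i) ρ = dot-unit i ρ
normalise-sound (lit c) ρ = trans (cong (c +_) (dot-zeros ρ)) (+-identityʳ c)
normalise-sound (a ⊞ b) ρ with normalise a | normalise b | normalise-sound a ρ | normalise-sound b ρ
... | c , cs | d , ds | p | q =
  trans (trans (cong (c + d +_) (dot-plus cs ds ρ)) (+-interchange c d _ _)) (cong₂ _+_ p q)
normalise-sound (m ⊠ a) ρ with normalise a | normalise-sound a ρ
... | c , cs | p =
  trans (trans (cong (m * c +_) (dot-scale m cs ρ)) (sym (*-distribˡ-+ m c (dot cs ρ)))) (cong (m *_) p)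

_≤ⱽ_ : ∀ {k} → Vec ℕ k → Vec ℕ k → Bool
[]       ≤ⱽ []       = true
(a ∷ as) ≤ⱽ (b ∷ bs) = (a ≤ᵇ b) ∧ (as ≤ⱽ bs)

_≤ᴬ_ : ∀ {k} → Affine k → Affine k → Bool
(c , cs) ≤ᴬ (d , ds) = (c ≤ᵇ d) ∧ (cs ≤ⱽ ds)

T-∧⁻ : ∀ {a b} → T (a ∧ b) → T a × T b
T-∧⁻ {a} {b} = Equivalence.to (Bool.T-∧ {a} {b})

-- Comparing coefficients suffices because the atoms stand for natural numbers.
≤ⱽ-sound : ∀ {k} (as bs ρ : Vec ℕ k) → T (as ≤ⱽ bs) → dot as ρ ≤ dot bs ρ
≤ⱽ-sound []       []       []      _ = z≤n
≤ⱽ-sound (a ∷ as) (b ∷ bs) (x ∷ ρ) t =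
  +-mono-≤ (*-monoˡ-≤ x (≤ᵇ⇒≤ a b (proj₁ (T-∧⁻ {a ≤ᵇ b} t)))) (≤ⱽ-sound as bs ρ (proj₂ (T-∧⁻ {a ≤ᵇ b} t)))

≤ᴬ-sound : ∀ {k} (a b : Expr k) ρ → T (normalise a ≤ᴬ normalise b) → ⟦ a ⟧ ρ ≤ ⟦ b ⟧ ρ
≤ᴬ-sound a b ρ t = subst₂ _≤_ (normalise-sound a ρ) (normalise-sound b ρ) (affine (normalise a) (normalise b) t)
  where
  affine : ∀ p q → T (p ≤ᴬ q) → evalAffine p ρ ≤ evalAffine q ρ
  affine (c , cs) (d , ds) t =
    +-mono-≤ (≤ᵇ⇒≤ c d (proj₁ (T-∧⁻ {c ≤ᵇ d} t))) (≤ⱽ-sound cs ds ρ (proj₂ (T-∧⁻ {c ≤ᵇ d} t)))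

combine : ∀ {k} → List (ℕ × Ineq k) → Ineq k
combine []                   = lit 0 ≲ lit 0
combine ((m , a ≲ b) ∷ hs) with combine hs
... | l ≲ r                 = (m ⊠ a ⊞ l) ≲ (m ⊠ b ⊞ r)

AllHold : ∀ {k} → Vec ℕ k → List (ℕ × Ineq k) → Set
AllHold ρ []             = ⊤
AllHold ρ ((m , h) ∷ hs) = Holds ρ h × AllHold ρ hs

combine-sound : ∀ {k} (ρ : Vec ℕ k) hs → AllHold ρ hs → Holds ρ (combine hs)
combine-sound ρ [] _ = z≤n
combine-sound ρ ((m , a ≲ b) ∷ hs) (p , ps) with combine hs | combine-sound ρ hs ps
... | l ≲ r | q = +-mono-≤ (*-monoʳ-≤ m p) q

-- The weighted hypotheses add up to `l ≤ r`. The check is `a + r ≤ b + l` by coefficients; together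
-- they give `a + r ≤ b + r`, and cancelling `r` avoids subtraction.
Certifies : ∀ {k} → List (ℕ × Ineq k) → Ineq k → Bool
Certifies hs (a ≲ b) with combine hs
... | l ≲ r = normalise (a ⊞ r) ≤ᴬ normalise (b ⊞ l)

-- The natural numbers paired with the hypotheses are Farkas multipliers.
abstract
  linear : ∀ {k} (ρ : Vec ℕ k) (hs : List (ℕ × Ineq k)) (g : Ineq k) →
    {T (Certifies hs g)} → AllHold ρ hs → Holds ρ g
  linear ρ hs (a ≲ b) {t} ps with combine hs | combine-sound ρ hs ps
  ... | l ≲ r | q = +-cancelʳ-≤ (⟦ r ⟧ ρ) (⟦ a ⟧ ρ) (⟦ b ⟧ ρ)
    (≤-trans (≤ᴬ-sound (a ⊞ r) (b ⊞ l) ρ t) (+-monoʳ-≤ (⟦ b ⟧ ρ) q))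

x₀ : ∀ {k} → Expr (1 + k)
x₀ = atom zero

x₁ : ∀ {k} → Expr (2 + k)
x₁ = atom (suc zero)

x₂ : ∀ {k} → Expr (3 + k)
x₂ = atom (suc (suc zero))

x₃ : ∀ {k} → Expr (4 + k)
x₃ = atom (suc (suc (suc zero)))

x₄ : ∀ {k} → Expr (5 + k)
x₄ = atom (suc (suc (suc (suc zero))))

x₅ : ∀ {k} → Expr (6 + k)
x₅ = atom (suc (suc (suc (suc (suc zero)))))

x₆ : ∀ {k} → Expr (7 + k)
x₆ = atom (suc (suc (suc (suc (suc (suc zero))))))

x₇ : ∀ {k} → Expr (8 + k)
x₇ = atom (suc (suc (suc (suc (suc (suc (suc zero)))))))

-- Degrees and edges of induced subgraphs

deg : SimpleGraph n → VSet n → Fin n → ℕ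
deg G K v = ∑ K (λ u → 𝟙 (adj G v u))

-- Counts ordered pairs, hence twice the number of edges induced by K.
ends : SimpleGraph n → VSet n → ℕ
ends G K = ∑ K (deg G K)

infixl 6 _⊕_
_⊕_ : VSet n → Fin n → VSet n
K ⊕ x = K ∪ ⁅ x ⁆

adj-≢ : (G : SimpleGraph n) {u v : Fin n} → adj G u v ≡ true → u ≢ v
adj-≢ G {u} p refl = true≢false p (adj-irrefl G u)

adj-swap : (G : SimpleGraph n) {u v : Fin n} → adj G u v ≡ true → adj G v u ≡ true
adj-swap G {u} {v} p = trans (adj-sym G v u) p

𝟙-adj : (G : SimpleGraph n) {u v : Fin n} → adj G u v ≡ true → 𝟙 (adj G u v) ≡ 1
𝟙-adj G p rewrite p = refl

1≤𝟙 : ∀ {b} → 1 ≤ 𝟙 b → b ≡ true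
1≤𝟙 {true} _ = refl

𝟙≡0 : ∀ {b} → (b ≡ true → ⊥) → 𝟙 b ≡ 0
𝟙≡0 {true}  h = ⊥-elim (h refl)
𝟙≡0 {false} h = refl

𝟙≡0⁻ : ∀ {b} → 𝟙 b ≡ 0 → b ≡ false
𝟙≡0⁻ {false} _ = refl

𝟙≤1 : ∀ b → 𝟙 b ≤ 1
𝟙≤1 true  = ≤-refl
𝟙≤1 false = z≤n

positive : ℕ → Bool
positive zero    = false
positive (suc _) = true

positive⁺ : ∀ {m} → 1 ≤ m → positive m ≡ true
positive⁺ (s≤s _) = refl

positive⁻ : ∀ {m} → positive m ≡ true → 1 ≤ m
positive⁻ {suc m} _ = s≤s z≤n

𝟙positive≤ : ∀ m → 𝟙 (positive m) ≤ m
𝟙positive≤ zero    = z≤n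
𝟙positive≤ (suc m) = s≤s z≤n

≤𝟙positive : ∀ {m} → m ≤ 1 → m ≤ 𝟙 (positive m)
≤𝟙positive {zero}  _ = z≤n
≤𝟙positive {suc m} p = p

ends-agree : (G G′ : SimpleGraph n) (K : VSet n) →
  (∀ u v → u ∈ K → v ∈ K → adj G u v ≡ adj G′ u v) → ends G K ≡ ends G′ K
ends-agree G G′ K h = ∑-cong K λ u p → ∑-cong K λ v q → cong 𝟙 (h u v p q)

ends-mono : (G G′ : SimpleGraph n) (K : VSet n) →
  (∀ u v → u ∈ K → v ∈ K → adj G u v ≡ true → adj G′ u v ≡ true) → ends G K ≤ ends G′ K
ends-mono G G′ K h = ∑-mono K λ u p → ∑-mono K λ v q → pointwise (h u v p q)
  where
  pointwise : ∀ {a b} → (a ≡ true → b ≡ true) → 𝟙 a ≤ 𝟙 b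
  pointwise {false} f = z≤n
  pointwise {true}  f rewrite f refl = ≤-refl

ends-ext : (G : SimpleGraph n) (K L : VSet n) → (∀ v → K v ≡ L v) → ends G K ≡ ends G L
ends-ext G K L h = trans (∑-ext K L (deg G K) h) (∑-cong L λ v _ → ∑-ext K L _ h)

deg-⊖ : (G : SimpleGraph n) (K : VSet n) {x : Fin n} → x ∈ K → deg G K x ≡ deg G (K ⊖ x) x
deg-⊖ G K {x} p = trans (∑-⊖ K _ p) (cong (λ b → 𝟙 b + deg G (K ⊖ x) x) (adj-irrefl G x))

ends-⊖ : (G : SimpleGraph n) (K : VSet n) {x : Fin n} → x ∈ K →
  ends G K ≡ ends G (K ⊖ x) + 2 * deg G (K ⊖ x) x
ends-⊖ G K {x} p = begin
  ends G K
    ≡⟨ ∑-⊖ K (deg G K) p ⟩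
  deg G K x + ∑ K′ (deg G K)
    ≡⟨ cong₂ _+_ (deg-⊖ G K p) (∑-cong K′ λ u _ → ∑-⊖ K (λ v → 𝟙 (adj G u v)) p) ⟩
  deg G K′ x + ∑ K′ (λ u → 𝟙 (adj G u x) + deg G K′ u)
    ≡⟨ cong (deg G K′ x +_) (∑-+ K′ (λ u → 𝟙 (adj G u x)) (deg G K′)) ⟩
  deg G K′ x + (∑ K′ (λ u → 𝟙 (adj G u x)) + ends G K′)
    ≡⟨ cong (λ s → deg G K′ x + (s + ends G K′)) (∑-cong K′ λ u _ → cong 𝟙 (adj-sym G u x)) ⟩
  deg G K′ x + (deg G K′ x + ends G K′)
    ≡⟨ solve 2 (λ d e → d :+ (d :+ e) := e :+ con 2 :* d) refl (deg G K′ x) (ends G K′) ⟩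
  ends G K′ + 2 * deg G K′ x ∎
  where
  open ≡-Reasoning
  open +-*-Solver
  K′ = K ⊖ x

⊕-⊖ : (K : VSet n) {x : Fin n} → x ∉ K → ∀ v → ((K ⊕ x) ⊖ x) v ≡ K v
⊕-⊖ K {x} p = ≐-intro ((K ⊕ x) ⊖ x) K there back
  where
  there : (K ⊕ x) ⊖ x ⊆ K
  there v q with ∈∪⁻ K ⁅ x ⁆ {v} (∈⊖ˡ (K ⊕ x) x q)
  ... | inj₁ r = r
  ... | inj₂ r = ⊥-elim (∈⊖ʳ (K ⊕ x) x q (∈⁅⁆⁻ x r))
  back : K ⊆ (K ⊕ x) ⊖ x
  back v q = ∈⊖ (K ⊕ x) x (∈∪ˡ K ⁅ x ⁆ q) λ { refl → true≢false q p }

x∈⊕ : (K : VSet n) (x : Fin n) → x ∈ K ⊕ x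
x∈⊕ K x = ∈∪ʳ K ⁅ x ⁆ (∈⁅⁆ x)

⊕-⊆ : (K L : VSet n) {x : Fin n} → K ⊆ L → x ∈ L → K ⊕ x ⊆ L
⊕-⊆ K L {x} h p v q with ∈∪⁻ K ⁅ x ⁆ {v} q
... | inj₁ r = h v r
... | inj₂ r rewrite ∈⁅⁆⁻ x {v} r = p

∉⊕ : (K : VSet n) {x v : Fin n} → v ∉ K → v ≢ x → v ∉ K ⊕ x
∉⊕ K {x} p q = ∉∪ K ⁅ x ⁆ p (∉⁅⁆ x q)

∑-⊕ : (K : VSet n) {x : Fin n} (f : Fin n → ℕ) → x ∉ K → ∑ (K ⊕ x) f ≡ ∑ K f + f x
∑-⊕ K {x} f p = trans (∑-∪ K ⁅ x ⁆ f disj) (cong (∑ K f +_) (∑-⁅⁆ x f))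
  where
  disj : ∀ v → v ∈ K → v ∉ ⁅ x ⁆
  disj v q = ∉⁅⁆ x λ { refl → true≢false q p }

ends-⊕ : (G : SimpleGraph n) (K : VSet n) {x : Fin n} → x ∉ K →
  ends G (K ⊕ x) ≡ ends G K + 2 * deg G K x
ends-⊕ G K {x} p = trans (ends-⊖ G (K ⊕ x) (x∈⊕ K x))
  (cong₂ _+_ (ends-ext G _ K (⊕-⊖ K p)) (cong (2 *_) (∑-ext _ K _ (⊕-⊖ K p))))

-- Double counting of the adjacent pairs between the two sets.
cross-sym : (G : SimpleGraph n) (K L : VSet n) → ∑ L (deg G K) ≡ ∑ K (deg G L)
cross-sym G K L = trans (∑-swap L K _) (∑-cong K λ v _ → ∑-cong L λ u _ → cong 𝟙 (adj-sym G u v))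

ends-∪ : (G : SimpleGraph n) (K L : VSet n) → (∀ v → v ∈ K → v ∉ L) →
  ends G (K ∪ L) ≡ ends G K + ends G L + 2 * ∑ K (deg G L)
ends-∪ G K L disj = begin
  ends G (K ∪ L)
    ≡⟨ ∑-∪ K L _ disj ⟩
  ∑ K (deg G (K ∪ L)) + ∑ L (deg G (K ∪ L))
    ≡⟨ cong₂ _+_ (split K) (split L) ⟩
  (ends G K + ∑ K (deg G L)) + (∑ L (deg G K) + ends G L)
    ≡⟨ cong (λ s → (ends G K + ∑ K (deg G L)) + (s + ends G L)) (cross-sym G K L) ⟩
  (ends G K + ∑ K (deg G L)) + (∑ K (deg G L) + ends G L)
    ≡⟨ solve 3 (λ a b c → (a :+ c) :+ (c :+ b) := a :+ b :+ con 2 :* c) refl (ends G K) (ends G L) (∑ K (deg G L)) ⟩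
  ends G K + ends G L + 2 * ∑ K (deg G L) ∎
  where
  open ≡-Reasoning
  open +-*-Solver
  split : ∀ M → ∑ M (deg G (K ∪ L)) ≡ ∑ M (deg G K) + ∑ M (deg G L)
  split M = trans (∑-cong M λ v _ → ∑-∪ K L (λ u → 𝟙 (adj G v u)) disj) (∑-+ M (deg G K) (deg G L))

1≤deg : (G : SimpleGraph n) (K : VSet n) {v x : Fin n} → x ∈ K → adj G v x ≡ true → 1 ≤ deg G K v
1≤deg G K {v} {x} p a = subst (_≤ deg G K v) (𝟙-adj G a) (term≤∑ K (λ u → 𝟙 (adj G v u)) p)

2≤deg : (G : SimpleGraph n) (K : VSet n) {v x y : Fin n} → x ∈ K → y ∈ K → x ≢ y →
  adj G v x ≡ true → adj G v y ≡ true → 2 ≤ deg G K v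
2≤deg G K {v} p q r a b =
  subst₂ (λ s t → s + t ≤ deg G K v) (𝟙-adj G a) (𝟙-adj G b) (terms≤∑ K (λ u → 𝟙 (adj G v u)) p q r)

deg≤1 : (G : SimpleGraph n) (K : VSet n) (v x : Fin n) →
  (∀ u → u ∈ K → adj G v u ≡ true → u ≡ x) → deg G K v ≤ 1
deg≤1 G K v x h = ≤-trans (∑≤term K x (λ u → 𝟙 (adj G v u)) λ u p q → 𝟙≡0 λ a → q (h u p a)) (𝟙≤1 (adj G v x))

ends-subsingleton : (G : SimpleGraph n) (K : VSet n) (x : Fin n) → (∀ v → v ∈ K → v ≡ x) → ends G K ≡ 0
ends-subsingleton G K x only = ∑≡0 K (deg G K) λ u r → ∑≡0 K _ λ v s →
  𝟙≡0 λ a → adj-≢ G a (trans (only u r) (sym (only v s)))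

-- Forests, described by edge counts instead of cycles (ends counts every edge twice)

Treelike : SimpleGraph n → VSet n → Set
Treelike G K = 2 + ends G K ≤ 2 * card K

Acyclic : SimpleGraph n → VSet n → Set
Acyclic G S = ∀ K → K ⊆ S → Inhabited K → Treelike G K

-- A leaf takes away one vertex and at most one edge. The premise is conditional because the empty
-- set is not `Treelike`.
treelike-leaf : (G : SimpleGraph n) (K : VSet n) {x : Fin n} → x ∈ K → deg G K x ≤ 1 →
  (Inhabited (K ⊖ x) → Treelike G (K ⊖ x)) → Treelike G K
treelike-leaf G K {x} p d h with inhabited? (K ⊖ x)
... | inj₁ q = subst₂ (λ e c → 2 + e ≤ 2 * c) (sym (ends-⊖ G K p)) (sym (∑-⊖ K _ p))
  (linear (ends G (K ⊖ x) ∷ deg G (K ⊖ x) x ∷ card (K ⊖ x) ∷ [])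
    ((1 , lit 2 ⊞ x₀ ≲ 2 ⊠ x₂) ∷ (2 , x₁ ≲ lit 1) ∷ []) (lit 2 ⊞ (x₀ ⊞ 2 ⊠ x₁) ≲ 2 ⊠ (lit 1 ⊞ x₂))
    (h q , subst (_≤ 1) (deg-⊖ G K p) d , tt))
... | inj₂ q = subst (λ e → 2 + e ≤ 2 * card K) (sym (ends-subsingleton G K x only)) (*-monoʳ-≤ 2 (∃⇒1≤card K (x , p)))
  where
  only : ∀ v → v ∈ K → v ≡ x
  only v r with v ≟ x
  ... | yes e = e
  ... | no ne = ⊥-elim (true≢false (∈⊖ K x r ne) (q v))

-- The additional 2 in the premise is an edge joining the two neighbours of `x`, counted from both
-- ends; putting `x` back subdivides that edge.
treelike-subdivide : (G : SimpleGraph n) (K : VSet n) {x : Fin n} → x ∈ K → deg G K x ≤ 2 →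
  2 + (2 + ends G (K ⊖ x)) ≤ 2 * card (K ⊖ x) → Treelike G K
treelike-subdivide G K {x} p d h = subst₂ (λ e c → 2 + e ≤ 2 * c) (sym (ends-⊖ G K p)) (sym (∑-⊖ K _ p))
  (linear (ends G (K ⊖ x) ∷ deg G (K ⊖ x) x ∷ card (K ⊖ x) ∷ [])
    ((1 , lit 2 ⊞ (lit 2 ⊞ x₀) ≲ 2 ⊠ x₂) ∷ (2 , x₁ ≲ lit 2) ∷ []) (lit 2 ⊞ (x₀ ⊞ 2 ⊠ x₁) ≲ 2 ⊠ (lit 1 ⊞ x₂))
    (h , subst (_≤ 2) (deg-⊖ G K p) d , tt))

-- Leaves are stripped until a set is known to be treelike. In the reductions, sets that meet the
-- deleted vertices have a leaf or subdivide an edge, and the others are covered by the smaller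
-- solution.
acyclic-by-leaves : (G : SimpleGraph n) (S : VSet n) →
  (∀ K → K ⊆ S → Inhabited K → Treelike G K ⊎ ∃ λ x → x ∈ K × deg G K x ≤ 1) → Acyclic G S
acyclic-by-leaves G S h K sub = go (card K) K ≤-refl sub
  where
  go : ∀ k K → card K ≤ k → K ⊆ S → Inhabited K → Treelike G K
  go zero K b sub i = ⊥-elim (1+n≰n (≤-trans (∃⇒1≤card K i) b))
  go (suc k) K b sub i with h K sub i
  ... | inj₁ t = t
  ... | inj₂ (x , p , d) = treelike-leaf G K p d
    (go k (K ⊖ x) (≤-pred (≤-trans (card-< (K ⊖ x) K (λ v → ∈⊖ˡ K x) p (x∉⊖ K x)) b))
       (λ v q → sub v (∈⊖ˡ K x q)))

-- Adding an edge

module AddEdge (G : SimpleGraph n) (p q : Fin n) (p≢q : p ≢ q) where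

  linked : Fin n → Fin n → Bool
  linked u v = (⁅ p ⁆ u ∧ ⁅ q ⁆ v) ∨ (⁅ q ⁆ u ∧ ⁅ p ⁆ v)

  linked⁻ : ∀ {u v} → linked u v ≡ true → (u ≡ p × v ≡ q) ⊎ (u ≡ q × v ≡ p)
  linked⁻ {u} {v} h with ∈∪⁻ (λ _ → ⁅ p ⁆ u ∧ ⁅ q ⁆ v) (λ _ → ⁅ q ⁆ u ∧ ⁅ p ⁆ v) {p} h
  ... | inj₁ r = inj₁ (∈⁅⁆⁻ p (∧-trueˡ (⁅ p ⁆ u) r) , ∈⁅⁆⁻ q (∧-trueʳ (⁅ p ⁆ u) r))
  ... | inj₂ r = inj₂ (∈⁅⁆⁻ q (∧-trueˡ (⁅ q ⁆ u) r) , ∈⁅⁆⁻ p (∧-trueʳ (⁅ q ⁆ u) r))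

  addEdge : SimpleGraph n
  addEdge = record
    { adj = λ u v → adj G u v ∨ linked u v
    ; sym = λ u v → cong₂ _∨_ (adj-sym G u v)
        (trans (Bool.∨-comm (⁅ p ⁆ u ∧ ⁅ q ⁆ v) (⁅ q ⁆ u ∧ ⁅ p ⁆ v))
               (cong₂ _∨_ (Bool.∧-comm (⁅ q ⁆ u) (⁅ p ⁆ v)) (Bool.∧-comm (⁅ p ⁆ u) (⁅ q ⁆ v))))
    ; irrefl = λ v → trans (cong (_∨ linked v v) (adj-irrefl G v))
        (∉-intro (linked v) λ h → absurd (linked⁻ {v} {v} h))
    }
    where
    absurd : ∀ {v} → (v ≡ p × v ≡ q) ⊎ (v ≡ q × v ≡ p) → ⊥
    absurd (inj₁ (a , b)) = p≢q (trans (sym a) b)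
    absurd (inj₂ (a , b)) = p≢q (trans (sym b) a)

  addEdge-old : ∀ {u v} → adj G u v ≡ true → adj addEdge u v ≡ true
  addEdge-old {u} {v} a rewrite a = refl

  addEdge-new : adj addEdge p q ≡ true
  addEdge-new rewrite ∈⁅⁆ p | ∈⁅⁆ q = Bool.∨-zeroʳ (adj G p q)

  addEdge-agree : ∀ {u v} → ¬ (u ≡ p × v ≡ q) → ¬ (u ≡ q × v ≡ p) → adj G u v ≡ adj addEdge u v
  addEdge-agree {u} {v} h k = sym (trans (cong (adj G u v ∨_) (∉-intro (linked u) absurd)) (Bool.∨-identityʳ _))
    where
    absurd : linked u v ≡ true → ⊥
    absurd l with linked⁻ {u} {v} l
    ... | inj₁ r = h r
    ... | inj₂ r = k r

  ends-addEdge-missing : ∀ K → p ∉ K ⊎ q ∉ K → ends addEdge K ≡ ends G K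
  ends-addEdge-missing K m = sym (ends-agree G addEdge K λ u v a b →
    addEdge-agree (λ { (refl , refl) → clash m a b }) (λ { (refl , refl) → clash m b a }))
    where
    clash : p ∉ K ⊎ q ∉ K → p ∈ K → q ∈ K → ⊥
    clash (inj₁ x) a b = true≢false a x
    clash (inj₂ x) a b = true≢false b x

  ends-addEdge : adj G p q ≡ false → ∀ K → p ∈ K → q ∈ K → ends addEdge K ≡ 2 + ends G K
  ends-addEdge nonadj K a b = begin
    ends addEdge K                               ≡⟨ ends-⊖ addEdge K a ⟩
    ends addEdge (K ⊖ p) + 2 * deg addEdge (K ⊖ p) p
      ≡⟨ cong₂ (λ e d → e + 2 * d) (ends-addEdge-missing (K ⊖ p) (inj₁ (x∉⊖ K p))) degree ⟩
    ends G (K ⊖ p) + 2 * (1 + deg G (K ⊖ p) p)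
      ≡⟨ solve 2 (λ e d → e :+ con 2 :* (con 1 :+ d) := con 2 :+ (e :+ con 2 :* d)) refl (ends G (K ⊖ p)) (deg G (K ⊖ p) p) ⟩
    2 + (ends G (K ⊖ p) + 2 * deg G (K ⊖ p) p)   ≡⟨ cong (2 +_) (sym (ends-⊖ G K a)) ⟩
    2 + ends G K ∎
    where
    open ≡-Reasoning
    open +-*-Solver
    q∈ : q ∈ K ⊖ p
    q∈ = ∈⊖ K p b (p≢q ∘ sym)
    degree : deg addEdge (K ⊖ p) p ≡ 1 + deg G (K ⊖ p) p
    degree = begin
      deg addEdge (K ⊖ p) p
        ≡⟨ ∑-⊖ (K ⊖ p) _ q∈ ⟩
      𝟙 (adj addEdge p q) + ∑ (K ⊖ p ⊖ q) (λ u → 𝟙 (adj addEdge p u))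
        ≡⟨ cong₂ _+_ (cong 𝟙 addEdge-new) (∑-cong (K ⊖ p ⊖ q) λ u r → cong 𝟙 (sym (addEdge-agree
             (λ { (_ , refl) → ∈⊖ʳ (K ⊖ p) q r refl }) (λ { (e , _) → p≢q e })))) ⟩
      1 + ∑ (K ⊖ p ⊖ q) (λ u → 𝟙 (adj G p u))
        -- The inserted term is 0 by nonadjacency; it restores the full sum over `K ⊖ p`.
        ≡⟨ cong (λ x → 1 + (𝟙 x + ∑ (K ⊖ p ⊖ q) (λ u → 𝟙 (adj G p u)))) (sym nonadj) ⟩
      1 + (𝟙 (adj G p q) + ∑ (K ⊖ p ⊖ q) (λ u → 𝟙 (adj G p u)))
        ≡⟨ cong (1 +_) (sym (∑-⊖ (K ⊖ p) _ q∈)) ⟩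
      1 + deg G (K ⊖ p) p ∎

-- Configurations

-- A sealed vertex must lie in the forest and have no neighbour in the 2-independent set: it stands
-- for a vertex of F (sealed₁) or U (sealed₂) together with a neighbour in I, of joint potential 1 or 2.
data Kind : Set where
  free tree sealed₂ sealed₁ : Kind

weight : Kind → ℕ
weight free    = 5
weight tree    = 4
weight sealed₂ = 2
weight sealed₁ = 1

data Sealed : Kind → Set where
  is-sealed₂ : Sealed sealed₂
  is-sealed₁ : Sealed sealed₁

1≤weight : ∀ k → 1 ≤ weight k
1≤weight free    = s≤s z≤n
1≤weight tree    = s≤s z≤n
1≤weight sealed₂ = s≤s z≤n
1≤weight sealed₁ = s≤s z≤n

weight≤5 : ∀ k → weight k ≤ 5
weight≤5 free    = ≤-refl
weight≤5 tree    = n≤1+n 4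
weight≤5 sealed₂ = s≤s (s≤s z≤n)
weight≤5 sealed₁ = s≤s z≤n

free? : ∀ k → Dec (k ≡ free)
free? free    = yes refl
free? tree    = no λ ()
free? sealed₂ = no λ ()
free? sealed₁ = no λ ()

record Config (n : ℕ) : Set where
  field
    verts : VSet n
    graph : SimpleGraph n
    kind  : Fin n → Kind
open Config

mass : Config n → VSet n → ℕ
mass C K = ∑ K (λ v → weight (kind C v))

Potential≥ : Config n → ℕ → VSet n → Set
Potential≥ C k K = k + 2 * ends (graph C) K ≤ mass C K

Sparse : Config n → Set
Sparse C = ∀ K → K ⊆ verts C → Inhabited K → Potential≥ C 1 K

restrict : Config n → VSet n → (Fin n → Kind) → Config n
restrict C A κ = record { verts = A ; graph = graph C ; kind = κ }

record Solution (C : Config n) : Set where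
  field
    chosen       : VSet n
    chosen-verts : chosen ⊆ verts C
    chosen-free  : ∀ v → v ∈ chosen → kind C v ≡ free
    independent  : ∀ u v → u ∈ chosen → v ∈ chosen → adj (graph C) u v ≡ true → ⊥
    unique       : ∀ w u v → w ∈ verts C → u ∈ chosen → v ∈ chosen →
                   adj (graph C) w u ≡ true → adj (graph C) w v ≡ true → u ≡ v
    sealed       : ∀ w u → w ∈ verts C → Sealed (kind C w) → u ∈ chosen → adj (graph C) w u ≡ true → ⊥
    acyclic      : Acyclic (graph C) (verts C ∖ chosen)
open Solution

-- Singletons have no edges and positive weight, so sparsity only needs checking on the sets that
-- `gap` speaks about.
sparse-from-pairs : (C : Config n) →
  (∀ K → K ⊆ verts C → 2 ≤ card K → Potential≥ C 1 K) → Sparse C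
sparse-from-pairs C h K sub (x , p) with inhabited? (K ⊖ x)
... | inj₁ (y , q) = h K sub (terms≤∑ K (λ _ → 1) p (∈⊖ˡ K x q) (∈⊖ʳ K x q ∘ sym))
... | inj₂ q = subst (λ e → 1 + 2 * e ≤ mass C K) (sym (ends-subsingleton (graph C) K x only))
  (≤-trans (1≤weight (kind C x)) (term≤∑ K (λ v → weight (kind C v)) p))
  where
  only : ∀ v → v ∈ K → v ≡ x
  only v r with v ≟ x
  ... | yes e = e
  ... | no ne = ⊥-elim (true≢false (∈⊖ K x r ne) (q v))

-- The relabellings that only tighten the constraints: a solution for the new kinds still respects
-- the old ones.
record Demotes (k k′ : Kind) : Set where
  field
    reflects-free   : k′ ≡ free → k ≡ free
    preserves-sealed : Sealed k → Sealed k′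
open Demotes

demotes-refl : ∀ {k} → Demotes k k
demotes-refl = record { reflects-free = λ e → e ; preserves-sealed = λ s → s }

relabel : VSet n → (Kind → Kind) → (Fin n → Kind) → Fin n → Kind
relabel P g κ v = if P v then g (κ v) else κ v

relabel-∈ : ∀ (P : VSet n) g κ {v} → v ∈ P → relabel P g κ v ≡ g (κ v)
relabel-∈ P g κ p rewrite p = refl

relabel-∉ : ∀ (P : VSet n) g κ {v} → v ∉ P → relabel P g κ v ≡ κ v
relabel-∉ P g κ p rewrite p = refl

relabel-demotes : ∀ (P : VSet n) {g} κ → (∀ k → Demotes k (g k)) → ∀ v → Demotes (κ v) (relabel P g κ v)
relabel-demotes P κ d v with P v
... | true  = d (κ v)
... | false = demotes-refl

relabel-cost : ∀ (P : VSet n) {g} κ c → (∀ k → weight k ≤ weight (g k) + c) → ∀ K →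
  ∑ K (λ v → weight (κ v)) ≤ ∑ K (λ v → weight (relabel P g κ v)) + c * ∑ K (λ v → 𝟙 (P v))
relabel-cost P {g} κ c h K = ≤-trans (∑-mono K pointwise) (≤-reflexive
  (trans (∑-+ K _ _) (cong (∑ K (λ v → weight (relabel P g κ v)) +_) (∑-* c K (λ v → 𝟙 (P v))))))
  where
  pointwise : ∀ v → v ∈ K → weight (κ v) ≤ weight (relabel P g κ v) + c * 𝟙 (P v)
  pointwise v _ with P v
  ... | true  rewrite *-identityʳ c = h (κ v)
  ... | false = m≤m+n _ _

∑𝟙⁅⁆≤1 : ∀ (K : VSet n) x → ∑ K (λ v → 𝟙 (⁅ x ⁆ v)) ≤ 1
∑𝟙⁅⁆≤1 K x = ≤-trans (∑≤term K x _ λ v _ ne → cong 𝟙 (∉⁅⁆ x ne)) (𝟙≤1 (⁅ x ⁆ x))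

∑𝟙⁅⁆≡0 : ∀ (K : VSet n) {x} → x ∉ K → ∑ K (λ v → 𝟙 (⁅ x ⁆ v)) ≡ 0
∑𝟙⁅⁆≡0 K {x} p = ∑≡0 K _ λ v q → cong 𝟙 (∉⁅⁆ x λ { refl → true≢false q p })

demote : Kind → Kind
demote free = tree
demote k    = k

demote-demotes : ∀ k → Demotes k (demote k)
demote-demotes free    = record { reflects-free = λ () ; preserves-sealed = λ () }
demote-demotes tree    = demotes-refl
demote-demotes sealed₂ = demotes-refl
demote-demotes sealed₁ = demotes-refl

demote-cost : ∀ k → weight k ≤ weight (demote k) + 1
demote-cost free    = ≤-refl
demote-cost tree    = m≤m+n _ _
demote-cost sealed₂ = m≤m+n _ _
demote-cost sealed₁ = m≤m+n _ _

demote≢free : ∀ k → demote k ≢ free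
demote≢free free    ()
demote≢free tree    ()
demote≢free sealed₂ ()
demote≢free sealed₁ ()

seal : Kind → Kind
seal free = sealed₂
seal tree = sealed₁
seal k    = k

seal-sealed : ∀ k → Sealed (seal k)
seal-sealed free    = is-sealed₂
seal-sealed tree    = is-sealed₁
seal-sealed sealed₂ = is-sealed₂
seal-sealed sealed₁ = is-sealed₁

sealed≢free : ∀ {k} → Sealed k → k ≢ free
sealed≢free is-sealed₂ ()
sealed≢free is-sealed₁ ()

sealed-light : ∀ {k} → Sealed k → 3 ≤ weight k → ⊥
sealed-light is-sealed₂ (s≤s (s≤s ()))
sealed-light is-sealed₁ (s≤s ())

seal-demotes : ∀ k → Demotes k (seal k)
seal-demotes k = record
  { reflects-free = λ e → ⊥-elim (sealed≢free (seal-sealed k) e) ; preserves-sealed = λ _ → seal-sealed k }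

seal-cost : ∀ k → weight k ≤ weight (seal k) + 3
seal-cost free    = ≤-refl
seal-cost tree    = ≤-refl
seal-cost sealed₂ = m≤m+n _ _
seal-cost sealed₁ = m≤m+n _ _

-- Both sealed kinds impose the same constraints, so an F-vertex may be sealed with the heavier one.
-- This costs 2, which the slack allows, whereas `seal` would cost 3.
sealTree : Kind → Kind
sealTree tree = sealed₂
sealTree k    = k

sealTree-demotes : ∀ k → Demotes k (sealTree k)
sealTree-demotes free    = demotes-refl
sealTree-demotes tree    = record { reflects-free = λ () ; preserves-sealed = λ () }
sealTree-demotes sealed₂ = demotes-refl
sealTree-demotes sealed₁ = demotes-refl

sealTree-cost : ∀ k → weight k ≤ weight (sealTree k) + 2
sealTree-cost free    = m≤m+n _ _
sealTree-cost tree    = ≤-refl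
sealTree-cost sealed₂ = m≤m+n _ _
sealTree-cost sealed₁ = m≤m+n _ _

-- Extending a solution of a smaller configuration

HasLeaf : SimpleGraph n → VSet n → Set
HasLeaf G K = ∃ λ x → x ∈ K × deg G K x ≤ 1

-- `C′` may have fewer vertices, additional edges and stricter kinds. Only the deleted vertices can
-- break the conditions on the old chosen set, hence `new-unique` and `new-sealed`.
module Extend (C C′ : Config n) (S : Solution C′)
  (verts-⊆ : verts C′ ⊆ verts C)
  (adj-⊆ : ∀ u v → u ∈ verts C′ → v ∈ verts C′ → adj (graph C) u v ≡ true → adj (graph C′) u v ≡ true)
  (demotes : ∀ v → Demotes (kind C v) (kind C′ v))
  (new-unique : ∀ w u v → w ∈ verts C → w ∉ verts C′ → u ∈ chosen S → v ∈ chosen S →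
    adj (graph C) w u ≡ true → adj (graph C) w v ≡ true → u ≡ v)
  (new-sealed : ∀ w u → w ∈ verts C → w ∉ verts C′ → Sealed (kind C w) → u ∈ chosen S →
    adj (graph C) w u ≡ true → ⊥)
  where

  private
    A = verts C
    G = graph C
    I′ = chosen S

  -- A set without deleted vertices has in `C′` at least as many edges and is treelike there, so
  -- only sets containing a deleted vertex need an argument.
  acyclic-extension : (J : VSet n) → I′ ⊆ J →
    (∀ K → K ⊆ A ∖ J → ∀ x → x ∈ K → x ∉ verts C′ → Treelike G K ⊎ HasLeaf G K) → Acyclic G (A ∖ J)
  acyclic-extension J I′⊆J leaf = acyclic-by-leaves G (A ∖ J) locate
    where
    locate : ∀ K → K ⊆ A ∖ J → Inhabited K → Treelike G K ⊎ HasLeaf G K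
    locate K sub i with ⊆-or-escapes K (verts C′)
    ... | inj₂ (x , p , q) = leaf K sub x p q
    ... | inj₁ inside = inj₁ (≤-trans
      (+-monoʳ-≤ 2 (ends-mono G (graph C′) K λ u v p q → adj-⊆ u v (inside u p) (inside v q)))
      (acyclic S K (λ v p → ∈∖ (verts C′) I′ (inside v p)
        (∉-intro I′ λ c → true≢false (I′⊆J v c) (∈∖ʳ A J (sub v p)))) i))

  independent-old : ∀ u v → u ∈ I′ → v ∈ I′ → adj G u v ≡ true → ⊥
  independent-old u v p q a =
    independent S u v p q (adj-⊆ u v (chosen-verts S u p) (chosen-verts S v q) a)

  unique-old : ∀ w u v → w ∈ A → u ∈ I′ → v ∈ I′ → adj G w u ≡ true → adj G w v ≡ true → u ≡ v
  unique-old w u v r p q a b with member? (verts C′) w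
  ... | inj₂ out = new-unique w u v r out p q a b
  ... | inj₁ inn = unique S w u v inn p q
    (adj-⊆ w u inn (chosen-verts S u p) a) (adj-⊆ w v inn (chosen-verts S v q) b)

  sealed-old : ∀ w u → w ∈ A → Sealed (kind C w) → u ∈ I′ → adj G w u ≡ true → ⊥
  sealed-old w u r s p a with member? (verts C′) w
  ... | inj₂ out = new-sealed w u r out s p a
  ... | inj₁ inn = sealed S w u inn (preserves-sealed (demotes w) s) p (adj-⊆ w u inn (chosen-verts S u p) a)

  free-old : ∀ v → v ∈ I′ → kind C v ≡ free
  free-old v p = reflects-free (demotes v) (chosen-free S v p)

  extend-forest :
    (∀ K → K ⊆ A ∖ I′ → ∀ x → x ∈ K → x ∉ verts C′ → Treelike G K ⊎ HasLeaf G K) → Solution C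
  extend-forest leaf = record
    { chosen       = I′
    ; chosen-verts = λ v p → verts-⊆ v (chosen-verts S v p)
    ; chosen-free  = free-old
    ; independent  = independent-old
    ; unique       = unique-old
    ; sealed       = sealed-old
    ; acyclic      = acyclic-extension I′ (λ _ p → p) leaf
    }

  -- `apart` and `clean` keep `j` at distance greater than 2 from the chosen vertices; `unsealed`
  -- protects its neighbours.
  extend-chosen : (j : Fin n) → j ∈ A → kind C j ≡ free →
    (∀ u → u ∈ I′ → adj G j u ≡ true → ⊥) →
    (∀ w u → w ∈ A → adj G w j ≡ true → u ∈ I′ → adj G w u ≡ true → ⊥) →
    (∀ w → w ∈ A → adj G w j ≡ true → Sealed (kind C w) → ⊥) →
    (∀ K → K ⊆ A ∖ (I′ ⊕ j) → ∀ x → x ∈ K → x ∉ verts C′ → Treelike G K ⊎ HasLeaf G K) → Solution C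
  extend-chosen j j∈A j-free apart clean unsealed leaf = record
    { chosen       = I′ ⊕ j
    ; chosen-verts = ⊕-⊆ I′ A (λ v p → verts-⊆ v (chosen-verts S v p)) j∈A
    ; chosen-free  = λ v p → frees v (cases v p)
    ; independent  = λ u v p q → independents u v (cases u p) (cases v q)
    ; unique       = λ w u v r p q → uniques w u v r (cases u p) (cases v q)
    ; sealed       = λ w u r s p → sealeds w u r s (cases u p)
    ; acyclic      = acyclic-extension (I′ ⊕ j) (λ _ p → ∈∪ˡ I′ ⁅ j ⁆ p) leaf
    }
    where
    cases : ∀ v → v ∈ I′ ⊕ j → v ∈ I′ ⊎ v ≡ j
    cases v p with ∈∪⁻ I′ ⁅ j ⁆ {v} p
    ... | inj₁ q = inj₁ q
    ... | inj₂ q = inj₂ (∈⁅⁆⁻ j q)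
    frees : ∀ v → v ∈ I′ ⊎ v ≡ j → kind C v ≡ free
    frees v (inj₁ p)    = free-old v p
    frees v (inj₂ refl) = j-free
    independents : ∀ u v → u ∈ I′ ⊎ u ≡ j → v ∈ I′ ⊎ v ≡ j → adj G u v ≡ true → ⊥
    independents u v (inj₁ p)    (inj₁ q)    a = independent-old u v p q a
    independents u v (inj₁ p)    (inj₂ refl) a = apart u p (adj-swap G a)
    independents u v (inj₂ refl) (inj₁ q)    a = apart v q a
    independents u v (inj₂ refl) (inj₂ refl) a = adj-≢ G a refl
    uniques : ∀ w u v → w ∈ A → u ∈ I′ ⊎ u ≡ j → v ∈ I′ ⊎ v ≡ j →
      adj G w u ≡ true → adj G w v ≡ true → u ≡ v
    uniques w u v r (inj₁ p)    (inj₁ q)    a b = unique-old w u v r p q a b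
    uniques w u v r (inj₁ p)    (inj₂ refl) a b = ⊥-elim (clean w u r b p a)
    uniques w u v r (inj₂ refl) (inj₁ q)    a b = ⊥-elim (clean w v r a q b)
    uniques w u v r (inj₂ refl) (inj₂ refl) a b = refl
    sealeds : ∀ w u → w ∈ A → Sealed (kind C w) → u ∈ I′ ⊎ u ≡ j → adj G w u ≡ true → ⊥
    sealeds w u r s (inj₁ p)    a = sealed-old w u r s p a
    sealeds w u r s (inj₂ refl) a = unsealed w r a s

-- Neighbourhoods of vertices of degree two and three

record Neighbours₂ (C : Config n) (a x y : Fin n) : Set where
  field
    adj₁ : adj (graph C) a x ≡ true
    adj₂ : adj (graph C) a y ≡ true
    x≢y  : x ≢ y
    x∈   : x ∈ verts C
    y∈   : y ∈ verts C
    only : ∀ u → u ∈ verts C → adj (graph C) a u ≡ true → u ≡ x ⊎ u ≡ y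

neighbours₂ : (C : Config n) {a x : Fin n} → deg (graph C) (verts C) a ≡ 2 → x ∈ verts C →
  adj (graph C) a x ≡ true → ∃ λ y → Neighbours₂ C a x y
neighbours₂ {n} C {a} {x} d x∈ ax = found (∑-positive (A ⊖ x) f (≤-reflexive (sym rest₁)))
  where
  A = verts C
  f : Fin n → ℕ
  f u = 𝟙 (adj (graph C) a u)
  rest₁ : ∑ (A ⊖ x) f ≡ 1
  rest₁ = suc-injective (trans (sym (trans (∑-⊖ A f x∈) (cong (λ b → 𝟙 b + ∑ (A ⊖ x) f) ax))) d)
  found : (∃ λ y → y ∈ A ⊖ x × 1 ≤ f y) → ∃ λ y → Neighbours₂ C a x y
  found (y , y∈ , ay) = y , record
    { adj₁ = ax ; adj₂ = 1≤𝟙 ay ; x≢y = ∈⊖ʳ A x y∈ ∘ sym ; x∈ = x∈ ; y∈ = ∈⊖ˡ A x y∈ ; only = only }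
    where
    rest₀ : ∑ (A ⊖ x ⊖ y) f ≡ 0
    rest₀ = suc-injective (trans (sym (trans (∑-⊖ (A ⊖ x) f y∈) (cong (λ b → 𝟙 b + ∑ (A ⊖ x ⊖ y) f) (1≤𝟙 ay)))) rest₁)
    only : ∀ u → u ∈ A → adj (graph C) a u ≡ true → u ≡ x ⊎ u ≡ y
    only u u∈ au with u ≟ x | u ≟ y
    ... | yes e | _     = inj₁ e
    ... | no _  | yes e = inj₂ e
    ... | no ¬x | no ¬y = ⊥-elim (true≢false au (𝟙≡0⁻
      (∑-zero⁻ (A ⊖ x ⊖ y) f rest₀ u (∈⊖ (A ⊖ x) y (∈⊖ A x u∈ ¬x) ¬y))))

third-neighbour : (C : Config n) {v x y : Fin n} → deg (graph C) (verts C) v ≡ 3 →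
  x ∈ verts C → y ∈ verts C → x ≢ y → adj (graph C) v x ≡ true → adj (graph C) v y ≡ true →
  ∃ λ z → z ∈ verts C × adj (graph C) v z ≡ true × z ≢ x × z ≢ y ×
    (∀ u → u ∈ verts C → adj (graph C) v u ≡ true → u ≡ x ⊎ (u ≡ y ⊎ u ≡ z))
third-neighbour {n} C {v} {x} {y} d x∈ y∈ x≢y vx vy = found (neighbours₂ C′ d′ y∈′ vy)
  where
  A = verts C
  -- Hiding `x` leaves `v` with degree 2, so `neighbours₂` applies.
  C′ : Config n
  C′ = record C { verts = A ⊖ x }
  y∈′ : y ∈ A ⊖ x
  y∈′ = ∈⊖ A x y∈ (x≢y ∘ sym)
  d′ : deg (graph C) (A ⊖ x) v ≡ 2
  d′ = suc-injective (trans (sym (trans (∑-⊖ A _ x∈) (cong (λ b → 𝟙 b + deg (graph C) (A ⊖ x) v) vx))) d)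
  found : (∃ λ z → Neighbours₂ C′ v y z) → _
  found (z , N) = z , ∈⊖ˡ A x (y∈ᶻ N) , Neighbours₂.adj₂ N , ∈⊖ʳ A x (y∈ᶻ N) , (λ e → Neighbours₂.x≢y N (sym e)) , only
    where
    y∈ᶻ = Neighbours₂.y∈
    only : ∀ u → u ∈ A → adj (graph C) v u ≡ true → u ≡ x ⊎ (u ≡ y ⊎ u ≡ z)
    only u u∈ vu with u ≟ x
    ... | yes e = inj₁ e
    ... | no ne = inj₂ (Neighbours₂.only N u (∈⊖ A x u∈ ne) vu)

-- Potentials of enlarged sets

mass-⊕ : (C : Config n) (K : VSet n) {x : Fin n} → x ∉ K → mass C (K ⊕ x) ≡ mass C K + weight (kind C x)
mass-⊕ C K = ∑-⊕ K (λ v → weight (kind C v))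

-- Two edges from `x` into `K` cost 8. Read backwards, a lower bound for `K ⊕ x` becomes a better
-- one for `K`: the gain is 4 if `x` is `tree` and 3 if it is `free`.
path-potential : (C : Config n) (K : VSet n) {x p q : Fin n} (k : ℕ) → x ∉ K → p ∈ K → q ∈ K → p ≢ q →
  adj (graph C) x p ≡ true → adj (graph C) x q ≡ true → Potential≥ C k (K ⊕ x) →
  k + 8 + 2 * ends (graph C) K ≤ mass C K + weight (kind C x)
path-potential C K {x} k x∉ p∈ q∈ p≢q xp xq h = linear
  (ends G K ∷ deg G K x ∷ mass C K ∷ k ∷ weight (kind C x) ∷ [])
  ((1 , x₃ ⊞ 2 ⊠ (x₀ ⊞ 2 ⊠ x₁) ≲ x₂ ⊞ x₄) ∷ (4 , lit 2 ≲ x₁) ∷ []) (x₃ ⊞ lit 8 ⊞ 2 ⊠ x₀ ≲ x₂ ⊞ x₄)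
  ( subst₂ (λ e m → k + 2 * e ≤ m) (ends-⊕ G K x∉) (mass-⊕ C K x∉) h
  , 2≤deg G K p∈ q∈ p≢q xp xq , tt)
  where G = graph C

-- As `path-potential`, with the three edges of a triangle on a vertex of `K`, which cost 12.
triangle-potential : (C : Config n) (K : VSet n) {x y w : Fin n} (k : ℕ) → x ∉ K → y ∉ K → y ≢ x → w ∈ K →
  adj (graph C) x w ≡ true → adj (graph C) y x ≡ true → adj (graph C) y w ≡ true →
  Potential≥ C k (K ⊕ x ⊕ y) →
  k + 12 + 2 * ends (graph C) K ≤ mass C K + weight (kind C x) + weight (kind C y)
triangle-potential C K {x} {y} {w} k x∉ y∉ y≢x w∈ xw yx yw h = linear
  (ends G K ∷ deg G K x ∷ mass C K ∷ k ∷ weight (kind C x) ∷ weight (kind C y) ∷ [])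
  ((1 , x₃ ⊞ lit 8 ⊞ 2 ⊠ (x₀ ⊞ 2 ⊠ x₁) ≲ x₂ ⊞ x₄ ⊞ x₅) ∷ (4 , lit 1 ≲ x₁) ∷ [])
  (x₃ ⊞ lit 12 ⊞ 2 ⊠ x₀ ≲ x₂ ⊞ x₄ ⊞ x₅)
  ( subst₂ (λ e m → k + 8 + 2 * e ≤ m + weight (kind C y)) (ends-⊕ G K x∉) (mass-⊕ C K x∉)
      (path-potential C (K ⊕ x) k (∉⊕ K y∉ y≢x) (x∈⊕ K x) (∈∪ˡ K ⁅ x ⁆ w∈) x≢w yx yw h)
  , 1≤deg G K w∈ xw , tt)
  where
  G = graph C
  x≢w : x ≢ w
  x≢w refl = true≢false w∈ x∉

deleted : (K : VSet n) (x : Fin n) {v : Fin n} → v ∈ K → v ∉ K ⊖ x → v ≡ x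
deleted K x {v} p q with v ≟ x
... | yes e = e
... | no ne = ⊥-elim (true≢false (∈⊖ K x p ne) q)

deleted₂ : (K : VSet n) (x y : Fin n) {v : Fin n} → v ∈ K → v ∉ K ⊖ x ⊖ y → v ≡ x ⊎ v ≡ y
deleted₂ K x y {v} p q with v ≟ x
... | yes e = inj₁ e
... | no ne = inj₂ (deleted (K ⊖ x) y (∈⊖ K x p ne) q)

deleted₃ : (K : VSet n) (x y z : Fin n) {v : Fin n} → v ∈ K → v ∉ K ⊖ x ⊖ y ⊖ z → v ≡ x ⊎ (v ≡ y ⊎ v ≡ z)
deleted₃ K x y z {v} p q with v ≟ x
... | yes e = inj₁ e
... | no ne = inj₂ (deleted₂ (K ⊖ x) y z (∈⊖ K x p ne) q)

deleted₄ : (K : VSet n) (w x y z : Fin n) {v : Fin n} → v ∈ K → v ∉ K ⊖ w ⊖ x ⊖ y ⊖ z →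
  v ≡ w ⊎ (v ≡ x ⊎ (v ≡ y ⊎ v ≡ z))
deleted₄ K w x y z {v} p q with v ≟ w
... | yes e = inj₁ e
... | no ne = inj₂ (deleted₃ (K ⊖ w) x y z (∈⊖ K w p ne) q)

∉⊖ : (K : VSet n) (x : Fin n) {v : Fin n} → v ∉ K → v ∉ K ⊖ x
∉⊖ K x p = ∉-intro (K ⊖ x) λ q → true≢false (∈⊖ˡ K x q) p

-- Among vertices of degree at least 2, these are the ones with positive charge `weight − 2 · deg`,
-- namely 5 - 4 = 1.
record Slim (C : Config n) (a : Fin n) : Set where
  constructor slim
  field
    slim-vert : a ∈ verts C
    slim-free : kind C a ≡ free
    slim-deg  : deg (graph C) (verts C) a ≡ 2
open Slim

slim? : (C : Config n) (a : Fin n) → Dec (Slim C a)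
slim? C a with verts C a Bool.≟ true | free? (kind C a) | deg (graph C) (verts C) a ≟ⁿ 2
... | yes p | yes q | yes r = yes (slim p q r)
... | no ¬p | _     | _     = no λ s → ¬p (slim-vert s)
... | yes _ | no ¬q | _     = no λ s → ¬q (slim-free s)
... | yes _ | yes _ | no ¬r = no λ s → ¬r (slim-deg s)

-- Reducible configurations

module Reduce {n : ℕ} (C : Config n) (sparse : Sparse C)
  (solve-smaller : ∀ (C′ : Config n) → card (verts C′) < card (verts C) → Sparse C′ → Solution C′)
  (gap : ∀ K → K ⊆ verts C → (∃ λ v → v ∈ verts C × v ∉ K) → 2 ≤ card K → Potential≥ C 3 K)
  where

  private
    A = verts C
    G = graph C
    κ = kind C

  -- The omitted vertex makes every `K` proper, so `gap` gives 3; a relabelling that costs at most 2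
  -- leaves 1.
  relabel-sparse : ∀ (A′ : VSet n) P g c → A′ ⊆ A → (∃ λ v → v ∈ A × v ∉ A′) →
    (∀ k → weight k ≤ weight (g k) + c) → (∀ K → K ⊆ A′ → c * ∑ K (λ v → 𝟙 (P v)) ≤ 2) →
    Sparse (restrict C A′ (relabel P g κ))
  relabel-sparse A′ P g c sub (x , x∈ , x∉) cost cheap = sparse-from-pairs
    (restrict C A′ (relabel P g κ)) λ K K⊆ big →
    linear (ends G K ∷ mass C K ∷ ∑ K (λ v → weight (relabel P g κ v)) ∷ c * ∑ K (λ v → 𝟙 (P v)) ∷ [])
      ((1 , lit 3 ⊞ 2 ⊠ x₀ ≲ x₁) ∷ (1 , x₁ ≲ x₂ ⊞ x₃) ∷ (1 , x₃ ≲ lit 2) ∷ []) (lit 1 ⊞ 2 ⊠ x₀ ≲ x₂)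
      ( gap K (λ v p → sub v (K⊆ v p)) (x , x∈ , ∉-intro K (λ p → true≢false (K⊆ x p) x∉)) big
      , relabel-cost P κ c cost K , cheap K K⊆ , tt)

  single-cheap : ∀ c x → c ≤ 2 → ∀ (K : VSet n) → c * ∑ K (λ v → 𝟙 (⁅ x ⁆ v)) ≤ 2
  single-cheap c x c≤2 K = *-mono-≤ c≤2 (∑𝟙⁅⁆≤1 K x)

  not-chosen : ∀ {A′ G′} P g (S : Solution (record { verts = A′ ; graph = G′ ; kind = relabel P g κ })) →
    (∀ k → g k ≢ free) → ∀ {u} → u ∈ P → u ∈ chosen S → ⊥
  not-chosen P g S h {u} p q = h (κ u) (trans (sym (relabel-∈ P g κ p)) (chosen-free S u q))

  leaf-at : ∀ {K : VSet n} {x} y → x ∈ K → (∀ u → u ∈ K → adj G x u ≡ true → u ≡ y) → HasLeaf G K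
  leaf-at {K} {x} y p h = x , p , deg≤1 G K x y h

  escaped : ∀ {C′ : Config n} (S : Solution C′) {u} → u ∈ chosen S → u ∉ verts C′ → ⊥
  escaped S {u} p q = true≢false (chosen-verts S u p) q

  avoids : ∀ {K : VSet n} J → K ⊆ A ∖ J → ∀ {x} → x ∈ J → x ∈ K → ⊥
  avoids J sub {x} p q = true≢false p (∈∖ʳ A J (sub x q))

  missed : ∀ {K : VSet n} J → K ⊆ A ∖ J → ∀ {x} → x ∈ J → x ∉ K
  missed {K} J sub p = ∉-intro K (avoids J sub p)

  absent : ∀ {A′ : VSet n} K → K ⊆ A′ → ∀ {x} → x ∉ A′ → x ∉ K
  absent K K⊆ {x} x∉ = ∉-intro K λ p → true≢false (K⊆ x p) x∉

  only-second : ∀ {K : VSet n} {x y} → x ∉ K → ∀ u → u ∈ K → u ≡ x ⊎ u ≡ y → u ≡ y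
  only-second x∉ u u∈ (inj₁ refl) = ⊥-elim (true≢false u∈ x∉)
  only-second x∉ u u∈ (inj₂ eq)   = eq

  only-first : ∀ {K : VSet n} {x y} → y ∉ K → ∀ u → u ∈ K → u ≡ x ⊎ u ≡ y → u ≡ x
  only-first y∉ u u∈ (inj₁ eq)   = eq
  only-first y∉ u u∈ (inj₂ refl) = ⊥-elim (true≢false u∈ y∉)

  -- Demoting the at most one neighbour costs 1 and keeps it out of the chosen set. Then `v` is a
  -- leaf of the forest without chosen neighbours, which suits every kind, sealed ones included.
  module LowDegree (v : Fin n) (v∈ : v ∈ A) (low : deg G A v ≤ 1) where

    C′ : Config n
    C′ = restrict C (A ⊖ v) (relabel (adj G v) demote κ)

    deg≤ : ∀ K → K ⊆ A → deg G K v ≤ 1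
    deg≤ K sub = ≤-trans (∑-⊆ K A _ sub) low

    abstract
      S : Solution C′
      S = solve-smaller C′ (card-< (A ⊖ v) A (λ _ → ∈⊖ˡ A v) v∈ (x∉⊖ A v))
        (relabel-sparse (A ⊖ v) (adj G v) demote 1 (λ _ → ∈⊖ˡ A v) (v , v∈ , x∉⊖ A v) demote-cost
          λ K K⊆ → ≤-trans (≤-reflexive (*-identityˡ _)) (≤-trans (deg≤ K (λ u p → ∈⊖ˡ A v (K⊆ u p))) (s≤s z≤n)))

    none : ∀ w u → w ∈ A → w ∉ A ⊖ v → u ∈ chosen S → adj G w u ≡ true → ⊥
    none w u w∈ w∉ u∈ a rewrite deleted A v w∈ w∉ = not-chosen (adj G v) demote S demote≢free a u∈

    solution : Solution C
    solution = Extend.extend-forest C C′ S (λ _ → ∈⊖ˡ A v) (λ _ _ _ _ a → a)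
      (relabel-demotes (adj G v) κ demote-demotes)
      (λ w u _ w∈ w∉ u∈ _ a _ → ⊥-elim (none w u w∈ w∉ u∈ a))
      (λ w u w∈ w∉ _ u∈ a → none w u w∈ w∉ u∈ a)
      (λ K sub x x∈ x∉ → inj₂ (leaf K sub x x∈ x∉))
      where
      leaf : ∀ K → K ⊆ A ∖ chosen S → ∀ x → x ∈ K → x ∉ A ⊖ v → HasLeaf G K
      leaf K sub x x∈ x∉ with deleted A v (∈∖ˡ A (chosen S) (sub x x∈)) x∉
      ... | refl = x , x∈ , deg≤ K (λ u p → ∈∖ˡ A (chosen S) (sub u p))

  -- Delete f and a, seal w, and choose a.
  module TreeTriangle (f a w : Fin n) (f∈ : f ∈ A) (f-tree : κ f ≡ tree) (a-slim : Slim C a)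
    (Nf : Neighbours₂ C f a w) (Na : Neighbours₂ C a f w) where

    private
      module Nf = Neighbours₂ Nf
      module Na = Neighbours₂ Na
      a∈ = slim-vert a-slim

    A′ : VSet n
    A′ = A ⊖ f ⊖ a

    C′ : Config n
    C′ = restrict C A′ (relabel ⁅ w ⁆ seal κ)

    A′⊆A : A′ ⊆ A
    A′⊆A v p = ∈⊖ˡ A f (∈⊖ˡ (A ⊖ f) a p)

    f∉ : f ∉ A′
    f∉ = ∉-intro A′ λ p → ∈⊖ʳ A f (∈⊖ˡ (A ⊖ f) a p) refl

    a∉ : a ∉ A′
    a∉ = x∉⊖ (A ⊖ f) a

    -- 1 + 12 - 4 - 5 = 4: the triangle on `w` leaves enough to pay 3 for sealing `w`.
    heavy : ∀ K → K ⊆ A′ → w ∈ K → Potential≥ C 4 K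
    heavy K K⊆ w∈ = linear (ends G K ∷ mass C K ∷ weight (κ f) ∷ weight (κ a) ∷ [])
      ((1 , lit 13 ⊞ 2 ⊠ x₀ ≲ x₁ ⊞ x₂ ⊞ x₃) ∷ (1 , x₂ ≲ lit 4) ∷ (1 , x₃ ≲ lit 5) ∷ []) (lit 4 ⊞ 2 ⊠ x₀ ≲ x₁)
      ( triangle-potential C K 1 (absent K K⊆ f∉) (absent K K⊆ a∉) (adj-≢ G Na.adj₁) w∈ Nf.adj₂ Na.adj₁ Na.adj₂
          (sparse (K ⊕ f ⊕ a) (⊕-⊆ (K ⊕ f) A (⊕-⊆ K A (λ v p → A′⊆A v (K⊆ v p)) f∈) a∈) (a , x∈⊕ (K ⊕ f) a))
      , ≤-reflexive (cong weight f-tree) , ≤-reflexive (cong weight (slim-free a-slim)) , tt)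

    C′-sparse : Sparse C′
    C′-sparse K K⊆ i with member? K w
    ... | inj₁ w∈ = linear (ends G K ∷ mass C K ∷ mass C′ K ∷ ∑ K (λ v → 𝟙 (⁅ w ⁆ v)) ∷ [])
      ((1 , lit 4 ⊞ 2 ⊠ x₀ ≲ x₁) ∷ (1 , x₁ ≲ x₂ ⊞ 3 ⊠ x₃) ∷ (3 , x₃ ≲ lit 1) ∷ []) (lit 1 ⊞ 2 ⊠ x₀ ≲ x₂)
      (heavy K K⊆ w∈ , relabel-cost ⁅ w ⁆ κ 3 seal-cost K , ∑𝟙⁅⁆≤1 K w , tt)
    ... | inj₂ w∉ = linear (ends G K ∷ mass C K ∷ mass C′ K ∷ ∑ K (λ v → 𝟙 (⁅ w ⁆ v)) ∷ [])
      ((1 , lit 1 ⊞ 2 ⊠ x₀ ≲ x₁) ∷ (1 , x₁ ≲ x₂ ⊞ 3 ⊠ x₃) ∷ (3 , x₃ ≲ lit 0) ∷ []) (lit 1 ⊞ 2 ⊠ x₀ ≲ x₂)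
      ( sparse K (λ v p → A′⊆A v (K⊆ v p)) i , relabel-cost ⁅ w ⁆ κ 3 seal-cost K
      , ≤-reflexive (∑𝟙⁅⁆≡0 K w∉) , tt)

    abstract
      S : Solution C′
      S = solve-smaller C′ (card-< A′ A A′⊆A f∈ f∉) C′-sparse

    w∈′ : w ∈ A′
    w∈′ = ∈⊖ (A ⊖ f) a (∈⊖ A f Nf.y∈ (Na.x≢y ∘ sym)) (Nf.x≢y ∘ sym)

    -- Applied to the singleton of `w`, `heavy` bounds its weight by 4 from below, too much for a
    -- sealed kind.
    w-unsealed : Sealed (κ w) → ⊥
    w-unsealed s = sealed-light s (≤-trans (≤-trans (s≤s (s≤s (s≤s z≤n)))
      (heavy ⁅ w ⁆ (λ v p → subst (_∈ A′) (sym (∈⁅⁆⁻ w p)) w∈′) (∈⁅⁆ w)))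
      (≤-reflexive (∑-⁅⁆ w (λ v → weight (κ v)))))

    w-out : w ∈ chosen S → ⊥
    w-out = not-chosen ⁅ w ⁆ seal S (λ k → sealed≢free (seal-sealed k)) (∈⁅⁆ w)

    f-none : ∀ u → u ∈ chosen S → adj G f u ≡ true → ⊥
    f-none u p e with Nf.only u (A′⊆A u (chosen-verts S u p)) e
    ... | inj₁ refl = escaped S p a∉
    ... | inj₂ refl = w-out p

    a-none : ∀ u → u ∈ chosen S → adj G a u ≡ true → ⊥
    a-none u p e with Na.only u (A′⊆A u (chosen-verts S u p)) e
    ... | inj₁ refl = escaped S p f∉
    ... | inj₂ refl = w-out p

    none : ∀ x u → x ∈ A → x ∉ A′ → u ∈ chosen S → adj G x u ≡ true → ⊥
    none x u x∈ x∉ with deleted₂ A f a x∈ x∉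
    ... | inj₁ refl = f-none u
    ... | inj₂ refl = a-none u

    solution : Solution C
    solution = Extend.extend-chosen C C′ S A′⊆A (λ _ _ _ _ e → e) (relabel-demotes ⁅ w ⁆ κ seal-demotes)
      (λ x u _ x∈ x∉ u∈ _ e _ → ⊥-elim (none x u x∈ x∉ u∈ e))
      (λ x u x∈ x∉ _ u∈ e → none x u x∈ x∉ u∈ e)
      a a∈ (slim-free a-slim) a-none clean unsealed (λ K sub x x∈ x∉ → inj₂ (leaf K sub x x∈ x∉))
      where
      clean : ∀ x u → x ∈ A → adj G x a ≡ true → u ∈ chosen S → adj G x u ≡ true → ⊥
      clean x u x∈ e u∈ e′ with Na.only x x∈ (adj-swap G e)
      ... | inj₁ refl = f-none u u∈ e′
      ... | inj₂ refl = sealed S w u w∈′ (subst Sealed (sym (relabel-∈ ⁅ w ⁆ seal κ (∈⁅⁆ w))) (seal-sealed (κ w))) u∈ e′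
      unsealed : ∀ x → x ∈ A → adj G x a ≡ true → Sealed (κ x) → ⊥
      unsealed x x∈ e s with Na.only x x∈ (adj-swap G e)
      ... | inj₂ refl = w-unsealed s
      ... | inj₁ refl with subst Sealed f-tree s
      ...   | ()
      leaf : ∀ K → K ⊆ A ∖ (chosen S ⊕ a) → ∀ x → x ∈ K → x ∉ A′ → HasLeaf G K
      leaf K sub x x∈ x∉ with deleted₂ A f a (∈∖ˡ A (chosen S ⊕ a) (sub x x∈)) x∉
      ... | inj₂ refl = ⊥-elim (avoids (chosen S ⊕ a) sub (x∈⊕ (chosen S) a) x∈)
      ... | inj₁ refl = leaf-at w x∈ λ u u∈ e →
        only-second (missed (chosen S ⊕ a) sub (x∈⊕ (chosen S) a)) u u∈ (Nf.only u (∈∖ˡ A (chosen S ⊕ a) (sub u u∈)) e)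

  -- Delete f and join its neighbours by an edge.
  module TreePath (f a w : Fin n) (f∈ : f ∈ A) (f-tree : κ f ≡ tree) (f-deg : deg G A f ≡ 2)
    (Nf : Neighbours₂ C f a w) (nonadj : adj G a w ≡ false) where

    private
      module Nf = Neighbours₂ Nf
    open AddEdge G a w Nf.x≢y

    A′ : VSet n
    A′ = A ⊖ f

    C′ : Config n
    C′ = record { verts = A′ ; graph = addEdge ; kind = κ }

    -- If both ends of the new edge lie in `K`, adding `f` shows that `K` has potential at least 1 +
    -- 8 - 4 = 5, and the new edge costs 4.
    C′-sparse : Sparse C′
    C′-sparse K K⊆ i = by-cases (member? K a) (member? K w)
      where
      K⊆A : K ⊆ A
      K⊆A v p = ∈⊖ˡ A f (K⊆ v p)
      missing : a ∉ K ⊎ w ∉ K → Potential≥ C′ 1 K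
      missing m = subst (λ e → 1 + 2 * e ≤ mass C K) (sym (ends-addEdge-missing K m)) (sparse K K⊆A i)
      by-cases : a ∈ K ⊎ a ∉ K → w ∈ K ⊎ w ∉ K → Potential≥ C′ 1 K
      by-cases (inj₂ a∉) _         = missing (inj₁ a∉)
      by-cases (inj₁ _)  (inj₂ w∉) = missing (inj₂ w∉)
      by-cases (inj₁ a∈) (inj₁ w∈) = subst (λ e → 1 + 2 * e ≤ mass C K) (sym (ends-addEdge nonadj K a∈ w∈))
        (linear (ends G K ∷ mass C K ∷ weight (κ f) ∷ [])
          ((1 , lit 9 ⊞ 2 ⊠ x₀ ≲ x₁ ⊞ x₂) ∷ (1 , x₂ ≲ lit 4) ∷ []) (lit 1 ⊞ 2 ⊠ (lit 2 ⊞ x₀) ≲ x₁)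
          ( path-potential C K 1 (∉-intro K λ p → ∈⊖ʳ A f (K⊆ f p) refl) a∈ w∈ Nf.x≢y Nf.adj₁ Nf.adj₂
              (sparse (K ⊕ f) (⊕-⊆ K A K⊆A f∈) (f , x∈⊕ K f))
          , ≤-reflexive (cong weight f-tree) , tt))

    abstract
      S : Solution C′
      S = solve-smaller C′ (card-< A′ A (λ _ → ∈⊖ˡ A f) f∈ (x∉⊖ A f)) C′-sparse

    solution : Solution C
    solution = Extend.extend-forest C C′ S (λ _ → ∈⊖ˡ A f) (λ _ _ _ _ e → addEdge-old e)
      (λ _ → demotes-refl) new-unique new-sealed leaf
      where
      -- The new edge forbids choosing both `a` and `w`, so `f` sees at most one chosen vertex.
      new-unique : ∀ x u v → x ∈ A → x ∉ A′ → u ∈ chosen S → v ∈ chosen S →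
        adj G x u ≡ true → adj G x v ≡ true → u ≡ v
      new-unique x u v x∈ x∉ u∈ v∈ e e′ rewrite deleted A f x∈ x∉
        with Nf.only u (∈⊖ˡ A f (chosen-verts S u u∈)) e | Nf.only v (∈⊖ˡ A f (chosen-verts S v v∈)) e′
      ... | inj₁ refl | inj₁ refl = refl
      ... | inj₂ refl | inj₂ refl = refl
      ... | inj₁ refl | inj₂ refl = ⊥-elim (independent S u v u∈ v∈ addEdge-new)
      ... | inj₂ refl | inj₁ refl = ⊥-elim (independent S v u v∈ u∈ addEdge-new)
      new-sealed : ∀ x u → x ∈ A → x ∉ A′ → Sealed (κ x) → u ∈ chosen S → adj G x u ≡ true → ⊥
      new-sealed x u x∈ x∉ s _ _ rewrite deleted A f x∈ x∉ with subst Sealed f-tree s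
      ... | ()
      leaf : ∀ K → K ⊆ A ∖ chosen S → ∀ x → x ∈ K → x ∉ A′ → Treelike G K ⊎ HasLeaf G K
      leaf K sub x x∈ x∉ with deleted A f (∈∖ˡ A (chosen S) (sub x x∈)) x∉
      ... | refl = by-cases (member? K a) (member? K w)
        where
        K⊆A : K ⊆ A
        K⊆A v p = ∈∖ˡ A (chosen S) (sub v p)
        by-cases : a ∈ K ⊎ a ∉ K → w ∈ K ⊎ w ∉ K → Treelike G K ⊎ HasLeaf G K
        by-cases (inj₁ a∈) (inj₁ w∈) = inj₁ (treelike-subdivide G K x∈
          (≤-trans (∑-⊆ K A _ K⊆A) (≤-reflexive f-deg))
          (subst (λ e → 2 + e ≤ 2 * card (K ⊖ f)) (ends-addEdge nonadj (K ⊖ f) a∈′ w∈′)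
            (acyclic S (K ⊖ f) inside (a , a∈′))))
          where
          a∈′ : a ∈ K ⊖ f
          a∈′ = ∈⊖ K f a∈ (adj-≢ G Nf.adj₁ ∘ sym)
          w∈′ : w ∈ K ⊖ f
          w∈′ = ∈⊖ K f w∈ (adj-≢ G Nf.adj₂ ∘ sym)
          inside : K ⊖ f ⊆ A′ ∖ chosen S
          inside v p = ∈∖ A′ (chosen S) (∈⊖ A f (K⊆A v (∈⊖ˡ K f p)) (∈⊖ʳ K f p)) (∈∖ʳ A (chosen S) (sub v (∈⊖ˡ K f p)))
        by-cases (inj₂ a∉) _ = inj₂ (leaf-at w x∈ λ u u∈ e → only-second a∉ u u∈ (Nf.only u (K⊆A u u∈) e))
        by-cases (inj₁ _) (inj₂ w∉) = inj₂ (leaf-at a x∈ λ u u∈ e → only-first w∉ u u∈ (Nf.only u (K⊆A u u∈) e))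

  -- On the path f – a – b – z, delete a and b and seal f; then a can be chosen unless z is.
  module TreeThread (f a b z : Fin n) (f∈ : f ∈ A) (f-tree : κ f ≡ tree) (a-slim : Slim C a) (b-slim : Slim C b)
    (Na : Neighbours₂ C a f b) (Nb : Neighbours₂ C b a z) where

    private
      module Na = Neighbours₂ Na
      module Nb = Neighbours₂ Nb
      a∈ = slim-vert a-slim

    A′ : VSet n
    A′ = A ⊖ a ⊖ b

    C′ : Config n
    C′ = restrict C A′ (relabel ⁅ f ⁆ sealTree κ)

    A′⊆A : A′ ⊆ A
    A′⊆A v p = ∈⊖ˡ A a (∈⊖ˡ (A ⊖ a) b p)

    a∉ : a ∉ A′
    a∉ = ∉-intro A′ λ p → ∈⊖ʳ A a (∈⊖ˡ (A ⊖ a) b p) refl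

    b∉ : b ∉ A′
    b∉ = x∉⊖ (A ⊖ a) b

    abstract
      S : Solution C′
      S = solve-smaller C′ (card-< A′ A A′⊆A a∈ a∉)
        (relabel-sparse A′ ⁅ f ⁆ sealTree 2 A′⊆A (a , a∈ , a∉) sealTree-cost λ K _ → single-cheap 2 f ≤-refl K)

    f-sealed : Sealed (relabel ⁅ f ⁆ sealTree κ f)
    f-sealed = subst Sealed (sym (trans (relabel-∈ ⁅ f ⁆ sealTree κ (∈⁅⁆ f)) (cong sealTree f-tree))) is-sealed₂

    f-out : f ∈ chosen S → ⊥
    f-out p = sealed≢free f-sealed (chosen-free S f p)

    a-none : ∀ u → u ∈ chosen S → adj G a u ≡ true → ⊥
    a-none u p e with Na.only u (A′⊆A u (chosen-verts S u p)) e
    ... | inj₁ refl = f-out p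
    ... | inj₂ refl = escaped S p b∉

    b-only : ∀ u → u ∈ chosen S → adj G b u ≡ true → u ≡ z
    b-only u p e with Nb.only u (A′⊆A u (chosen-verts S u p)) e
    ... | inj₁ refl = ⊥-elim (escaped S p a∉)
    ... | inj₂ e′   = e′

    new-unique : ∀ x u v → x ∈ A → x ∉ A′ → u ∈ chosen S → v ∈ chosen S →
      adj G x u ≡ true → adj G x v ≡ true → u ≡ v
    new-unique x u v x∈ x∉ p q e e′ with deleted₂ A a b x∈ x∉
    ... | inj₁ refl = ⊥-elim (a-none u p e)
    ... | inj₂ refl = trans (b-only u p e) (sym (b-only v q e′))

    new-sealed : ∀ x u → x ∈ A → x ∉ A′ → Sealed (κ x) → u ∈ chosen S → adj G x u ≡ true → ⊥
    new-sealed x u x∈ x∉ s _ _ with deleted₂ A a b x∈ x∉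
    ... | inj₁ refl = sealed≢free s (slim-free a-slim)
    ... | inj₂ refl = sealed≢free s (slim-free b-slim)

    open Extend C C′ S A′⊆A (λ _ _ _ _ e → e) (relabel-demotes ⁅ f ⁆ κ sealTree-demotes) new-unique new-sealed

    solution : Solution C
    solution = by-colour (member? (chosen S) z)
      where
      by-colour : z ∈ chosen S ⊎ z ∉ chosen S → Solution C
      by-colour (inj₁ z∈) = extend-forest λ K sub x x∈ x∉ →
        inj₂ (leaf K sub (member? K b) x x∈ (deleted₂ A a b (∈∖ˡ A (chosen S) (sub x x∈)) x∉))
        where
        leaf : ∀ K → K ⊆ A ∖ chosen S → b ∈ K ⊎ b ∉ K → ∀ x → x ∈ K → x ≡ a ⊎ x ≡ b → HasLeaf G K
        leaf K sub (inj₁ b∈) x x∈ _ = leaf-at a b∈ λ u u∈ e →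
            only-first (missed (chosen S) sub z∈) u u∈ (Nb.only u (∈∖ˡ A (chosen S) (sub u u∈)) e)
        leaf K sub (inj₂ b∉K) x x∈ (inj₂ refl) = ⊥-elim (true≢false x∈ b∉K)
        leaf K sub (inj₂ b∉K) x x∈ (inj₁ refl) = leaf-at f x∈ λ u u∈ e →
            only-first b∉K u u∈ (Na.only u (∈∖ˡ A (chosen S) (sub u u∈)) e)
      -- The neighbours of `a` are `f`, which is sealed and so sees no chosen vertex, and `b`, which
      -- could only see `z`.
      by-colour (inj₂ z∉) = extend-chosen a a∈ (slim-free a-slim) a-none clean unsealed
        λ K sub x x∈ x∉ → inj₂ (leaf K sub x x∈ (deleted₂ A a b (∈∖ˡ A (chosen S ⊕ a) (sub x x∈)) x∉))
        where
        f≢a : f ≢ a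
        f≢a e = adj-≢ G Na.adj₁ (sym e)
        f≢b : f ≢ b
        f≢b = Na.x≢y
        clean : ∀ x u → x ∈ A → adj G x a ≡ true → u ∈ chosen S → adj G x u ≡ true → ⊥
        clean x u x∈ e u∈ e′ with Na.only x x∈ (adj-swap G e)
        ... | inj₁ refl = sealed S f u (∈⊖ (A ⊖ a) b (∈⊖ A a f∈ f≢a) f≢b) f-sealed u∈ e′
        ... | inj₂ refl = true≢false (subst (_∈ chosen S) (b-only u u∈ e′) u∈) z∉
        unsealed : ∀ x → x ∈ A → adj G x a ≡ true → Sealed (κ x) → ⊥
        unsealed x x∈ e s with Na.only x x∈ (adj-swap G e)
        ... | inj₂ refl = sealed≢free s (slim-free b-slim)
        ... | inj₁ refl with subst Sealed f-tree s
        ...   | ()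
        leaf : ∀ K → K ⊆ A ∖ (chosen S ⊕ a) → ∀ x → x ∈ K → x ≡ a ⊎ x ≡ b → HasLeaf G K
        leaf K sub x x∈ (inj₁ refl) = ⊥-elim (avoids (chosen S ⊕ a) sub (x∈⊕ (chosen S) a) x∈)
        leaf K sub x x∈ (inj₂ refl) = leaf-at z x∈ λ u u∈ e →
            only-second (missed (chosen S ⊕ a) sub (x∈⊕ (chosen S) a)) u u∈ (Nb.only u (∈∖ˡ A (chosen S ⊕ a) (sub u u∈)) e)

  -- Delete v and its neighbours, keep the second neighbours in the forest, and choose v.
  module SlimNeighbourhood (v : Fin n) (v∈ : v ∈ A) (v-free : κ v ≡ free)
    (all-slim : ∀ u → u ∈ A → adj G v u ≡ true → Slim C u) where

    N P A′ : VSet n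
    N = A ∩ adj G v
    P z = positive (deg G N z)
    A′ = (A ∖ N) ⊖ v

    C′ : Config n
    C′ = restrict C A′ (relabel P demote κ)

    N-adj : ∀ {u} → u ∈ N → adj G v u ≡ true
    N-adj {u} = ∧-trueʳ (A u)

    N-vert : ∀ {u} → u ∈ N → u ∈ A
    N-vert {u} = ∧-trueˡ (A u)

    N-slim : ∀ {u} → u ∈ N → Slim C u
    N-slim {u} p = all-slim u (N-vert p) (N-adj p)

    A′⊆A : A′ ⊆ A
    A′⊆A u p = ∈∖ˡ A N (∈⊖ˡ (A ∖ N) v p)

    v∉ : v ∉ A′
    v∉ = x∉⊖ (A ∖ N) v

    N-out : ∀ {u} → u ∈ N → u ∉ A′
    N-out {u} p = ∉-intro A′ λ q → true≢false p (∈∖ʳ A N (∈⊖ˡ (A ∖ N) v q))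

    gone : ∀ {x} → x ∈ A → x ∉ A′ → x ∈ N ⊎ x ≡ v
    gone {x} p q with member? N x
    ... | inj₁ r = inj₁ r
    ... | inj₂ r = inj₂ (deleted (A ∖ N) v (∈∖ A N p r) q)

    other : ∀ {u} → u ∈ N → ∃ λ z → Neighbours₂ C u v z
    other p = neighbours₂ C (slim-deg (N-slim p)) v∈ (adj-swap G (N-adj p))

    deg-one : ∀ K → K ⊆ A → v ∉ K → ∀ {u} → u ∈ N → deg G K u ≤ 1
    deg-one K K⊆ v∉K {u} p = deg≤1 G K u (proj₁ (other p)) λ x x∈ e →
      only-second v∉K x x∈ (Neighbours₂.only (proj₂ (other p)) x (K⊆ x x∈) e)

    module Count (K : VSet n) (K⊆ : K ⊆ A′) where

      Q : VSet n
      Q = N ∩ λ u → positive (deg G K u)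

      Q⊆N : Q ⊆ N
      Q⊆N u p = ∧-trueˡ (N u) p

      K⊆A : K ⊆ A
      K⊆A u p = A′⊆A u (K⊆ u p)

      v∉K : v ∉ K
      v∉K = ∉-intro K λ p → true≢false (K⊆ v p) v∉

      disjoint : ∀ u → u ∈ K → u ∉ Q
      disjoint u p = ∉-intro Q λ q → true≢false (K⊆ u p) (N-out (Q⊆N u q))

      -- A slim neighbour of `v` has at most one further neighbour, so each member of `Q` accounts
      -- for at most one demoted vertex of `K`.
      K-weight : ∑ K (λ z → 𝟙 (P z)) ≤ card Q
      K-weight = ≤-trans (∑-mono K λ z _ → 𝟙positive≤ (deg G N z)) (≤-trans (≤-reflexive (cross-sym G N K)) (sumFin-mono bound))
        where
        bound : ∀ u → (if N u then deg G K u else 0) ≤ (if Q u then 1 else 0)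
        bound u with N u in eq
        ... | false = z≤n
        ... | true  = ≤𝟙positive (deg-one K K⊆A v∉K {u} eq)

      crossing : card Q ≤ ∑ K (deg G Q)
      crossing = ≤-trans (∑-mono Q λ u p → positive⁻ (∧-trueʳ (N u) p))
                         (≤-reflexive (cross-sym G K Q))

      centre : card Q ≤ deg G (K ∪ Q) v
      centre = ≤-trans (∑-mono Q λ u p → ≤-reflexive (sym (𝟙-adj G (N-adj (Q⊆N u p)))))
                       (∑-⊆ Q (K ∪ Q) (λ u → 𝟙 (adj G v u)) λ u p → ∈∪ʳ K Q p)

      Q-mass : mass C Q ≡ 5 * card Q
      Q-mass = trans (∑-cong Q λ u p → cong weight (slim-free (N-slim (Q⊆N u p)))) (∑-* 5 Q (λ _ → 1))

      v∉K∪Q : v ∉ K ∪ Q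
      v∉K∪Q = ∉∪ K Q v∉K (∉-intro Q λ p → adj-≢ G (N-adj (Q⊆N v p)) refl)

      K∪Q⊆A : K ∪ Q ⊆ A
      K∪Q⊆A u p with ∈∪⁻ K Q {u} p
      ... | inj₁ q = K⊆A u q
      ... | inj₂ q = N-vert (Q⊆N u q)

      whole : 1 + 2 * (ends G K + ends G Q + 2 * ∑ K (deg G Q) + 2 * deg G (K ∪ Q) v) ≤ mass C K + 5 * card Q + 5
      whole = subst₂ (λ e m → 1 + 2 * e ≤ m)
        (trans (ends-⊕ G (K ∪ Q) v∉K∪Q) (cong (_+ 2 * deg G (K ∪ Q) v) (ends-∪ G K Q disjoint)))
        (trans (mass-⊕ C (K ∪ Q) v∉K∪Q) (cong₂ _+_
          (trans (∑-∪ K Q (λ u → weight (κ u)) disjoint) (cong (mass C K +_) Q-mass)) (cong weight v-free)))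
        (sparse (K ∪ Q ⊕ v) (⊕-⊆ (K ∪ Q) A K∪Q⊆A v∈) (v , x∈⊕ (K ∪ Q) v))

      drop : mass C K ≤ mass C′ K + 1 * ∑ K (λ z → 𝟙 (P z))
      drop = relabel-cost P κ 1 demote-cost K

      -- Demotion costs at most `card Q`, which `gap` covers up to 2. With q = `card Q` ≥ 3, add `Q`
      -- and `v` to `K`: weight 5q + 5 and at least 2q edges, so ρ(K) ≥ 1 + 8q - 5q - 5. Subtracting
      -- the cost q leaves 2q - 4 ≥ 2.
      potential : 2 ≤ card K → Potential≥ C′ 1 K
      potential big = by-size (card Q ≤? 2)
        where
        by-size : Dec (card Q ≤ 2) → Potential≥ C′ 1 K
        by-size (yes few) = linear (ends G K ∷ mass C K ∷ mass C′ K ∷ ∑ K (λ z → 𝟙 (P z)) ∷ card Q ∷ [])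
          ((1 , lit 3 ⊞ 2 ⊠ x₀ ≲ x₁) ∷ (1 , x₁ ≲ x₂ ⊞ 1 ⊠ x₃) ∷ (1 , x₃ ≲ x₄) ∷ (1 , x₄ ≲ lit 2) ∷ [])
          (lit 1 ⊞ 2 ⊠ x₀ ≲ x₂)
          (gap K K⊆A (v , v∈ , v∉K) big , drop , K-weight , few , tt)
        by-size (no many) = linear
          (ends G K ∷ mass C K ∷ mass C′ K ∷ ∑ K (λ z → 𝟙 (P z)) ∷ card Q ∷ ends G Q ∷ ∑ K (deg G Q) ∷ deg G (K ∪ Q) v ∷ [])
          ((1 , lit 1 ⊞ 2 ⊠ (x₀ ⊞ x₅ ⊞ 2 ⊠ x₆ ⊞ 2 ⊠ x₇) ≲ x₁ ⊞ 5 ⊠ x₄ ⊞ lit 5) ∷ (4 , x₄ ≲ x₆) ∷ (4 , x₄ ≲ x₇)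
            ∷ (1 , x₁ ≲ x₂ ⊞ 1 ⊠ x₃) ∷ (1 , x₃ ≲ x₄) ∷ (2 , lit 3 ≲ x₄) ∷ [])
          (lit 1 ⊞ 2 ⊠ x₀ ≲ x₂)
          (whole , crossing , centre , drop , K-weight , ≰⇒> many , tt)

    abstract
      S : Solution C′
      S = solve-smaller C′ (card-< A′ A A′⊆A v∈ v∉) (sparse-from-pairs C′ λ K K⊆ → Count.potential K K⊆)

    v-none : ∀ u → u ∈ chosen S → adj G v u ≡ true → ⊥
    v-none u p e = escaped S p (N-out {u} (∧-true (A′⊆A u (chosen-verts S u p)) e))

    N-none : ∀ x u → x ∈ N → u ∈ chosen S → adj G x u ≡ true → ⊥
    N-none x u x∈ u∈ e = not-chosen P demote S demote≢free
      (positive⁺ (1≤deg G N x∈ (adj-swap G e))) u∈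

    none : ∀ x u → x ∈ A → x ∉ A′ → u ∈ chosen S → adj G x u ≡ true → ⊥
    none x u x∈ x∉ with gone x∈ x∉
    ... | inj₁ p    = N-none x u p
    ... | inj₂ refl = v-none u

    solution : Solution C
    solution = Extend.extend-chosen C C′ S A′⊆A (λ _ _ _ _ e → e) (relabel-demotes P κ demote-demotes)
      (λ x u _ x∈ x∉ u∈ _ e _ → ⊥-elim (none x u x∈ x∉ u∈ e))
      (λ x u x∈ x∉ _ u∈ e → none x u x∈ x∉ u∈ e)
      v v∈ v-free v-none
      (λ x u x∈ e u∈ → N-none x u (∧-true x∈ (adj-swap G e)) u∈)
      (λ x x∈ e s → sealed≢free s (slim-free (all-slim x x∈ (adj-swap G e))))
      (λ K sub x x∈ x∉ → inj₂ (leaf K sub x x∈ (gone (∈∖ˡ A (chosen S ⊕ v) (sub x x∈)) x∉)))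
      where
      leaf : ∀ K → K ⊆ A ∖ (chosen S ⊕ v) → ∀ x → x ∈ K → x ∈ N ⊎ x ≡ v → HasLeaf G K
      leaf K sub x x∈ (inj₂ refl) = ⊥-elim (avoids (chosen S ⊕ v) sub (x∈⊕ (chosen S) v) x∈)
      leaf K sub x x∈ (inj₁ p) = x , x∈ , deg-one K (λ u q → ∈∖ˡ A (chosen S ⊕ v) (sub u q))
        (missed (chosen S ⊕ v) sub (x∈⊕ (chosen S) v)) p

  -- The triangle v a b hangs at t: delete it, keep t in the forest, and choose a.
  module ForkTriangle (v a b t : Fin n) (v∈ : v ∈ A) (v-free : κ v ≡ free) (a-slim : Slim C a) (b-slim : Slim C b)
    (Na : Neighbours₂ C a v b) (Nb : Neighbours₂ C b a v)
    (v-only : ∀ u → u ∈ A → adj G v u ≡ true → u ≡ a ⊎ (u ≡ b ⊎ u ≡ t)) where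

    private
      module Na = Neighbours₂ Na
      module Nb = Neighbours₂ Nb

    A′ : VSet n
    A′ = A ⊖ v ⊖ a ⊖ b

    C′ : Config n
    C′ = restrict C A′ (relabel ⁅ t ⁆ demote κ)

    A′⊆A : A′ ⊆ A
    A′⊆A u p = ∈⊖ˡ A v (∈⊖ˡ (A ⊖ v) a (∈⊖ˡ (A ⊖ v ⊖ a) b p))

    v∉ : v ∉ A′
    v∉ = ∉⊖ (A ⊖ v ⊖ a) b (∉⊖ (A ⊖ v) a (x∉⊖ A v))

    a∉ : a ∉ A′
    a∉ = ∉⊖ (A ⊖ v ⊖ a) b (x∉⊖ (A ⊖ v) a)

    b∉ : b ∉ A′
    b∉ = x∉⊖ (A ⊖ v ⊖ a) b

    abstract
      S : Solution C′
      S = solve-smaller C′ (card-< A′ A A′⊆A v∈ v∉)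
        (relabel-sparse A′ ⁅ t ⁆ demote 1 A′⊆A (v , v∈ , v∉) demote-cost λ K _ → single-cheap 1 t (s≤s z≤n) K)

    v-none : ∀ u → u ∈ chosen S → adj G v u ≡ true → ⊥
    v-none u p e with v-only u (A′⊆A u (chosen-verts S u p)) e
    ... | inj₁ refl        = escaped S p a∉
    ... | inj₂ (inj₁ refl) = escaped S p b∉
    ... | inj₂ (inj₂ refl) = not-chosen ⁅ t ⁆ demote S demote≢free (∈⁅⁆ t) p

    a-none : ∀ u → u ∈ chosen S → adj G a u ≡ true → ⊥
    a-none u p e with Na.only u (A′⊆A u (chosen-verts S u p)) e
    ... | inj₁ refl = escaped S p v∉
    ... | inj₂ refl = escaped S p b∉

    b-none : ∀ u → u ∈ chosen S → adj G b u ≡ true → ⊥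
    b-none u p e with Nb.only u (A′⊆A u (chosen-verts S u p)) e
    ... | inj₁ refl = escaped S p a∉
    ... | inj₂ refl = escaped S p v∉

    none : ∀ x u → x ∈ A → x ∉ A′ → u ∈ chosen S → adj G x u ≡ true → ⊥
    none x u x∈ x∉ with deleted₃ A v a b x∈ x∉
    ... | inj₁ refl        = v-none u
    ... | inj₂ (inj₁ refl) = a-none u
    ... | inj₂ (inj₂ refl) = b-none u

    solution : Solution C
    solution = Extend.extend-chosen C C′ S A′⊆A (λ _ _ _ _ e → e) (relabel-demotes ⁅ t ⁆ κ demote-demotes)
      (λ x u _ x∈ x∉ u∈ _ e _ → ⊥-elim (none x u x∈ x∉ u∈ e))
      (λ x u x∈ x∉ _ u∈ e → none x u x∈ x∉ u∈ e)
      a (slim-vert a-slim) (slim-free a-slim) a-none clean unsealed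
      (λ K sub x x∈ x∉ → inj₂ (leaf K sub (member? K b) x x∈ (deleted₃ A v a b (∈∖ˡ A (chosen S ⊕ a) (sub x x∈)) x∉)))
      where
      clean : ∀ x u → x ∈ A → adj G x a ≡ true → u ∈ chosen S → adj G x u ≡ true → ⊥
      clean x u x∈ e with Na.only x x∈ (adj-swap G e)
      ... | inj₁ refl = v-none u
      ... | inj₂ refl = b-none u
      unsealed : ∀ x → x ∈ A → adj G x a ≡ true → Sealed (κ x) → ⊥
      unsealed x x∈ e s with Na.only x x∈ (adj-swap G e)
      ... | inj₁ refl = sealed≢free s v-free
      ... | inj₂ refl = sealed≢free s (slim-free b-slim)
      leaf : ∀ K → K ⊆ A ∖ (chosen S ⊕ a) → b ∈ K ⊎ b ∉ K → ∀ x → x ∈ K → x ≡ v ⊎ (x ≡ a ⊎ x ≡ b) → HasLeaf G K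
      -- With `a` chosen, `b` hangs on `v`; if `b` is absent, `v` hangs on `t`.
      leaf K sub (inj₁ b∈) x x∈ _ = leaf-at v b∈ λ u u∈ e →
        only-second (missed (chosen S ⊕ a) sub (x∈⊕ (chosen S) a)) u u∈ (Nb.only u (∈∖ˡ A (chosen S ⊕ a) (sub u u∈)) e)
      leaf K sub (inj₂ b∉K) x x∈ (inj₂ (inj₁ refl)) = ⊥-elim (avoids (chosen S ⊕ a) sub (x∈⊕ (chosen S) a) x∈)
      leaf K sub (inj₂ b∉K) x x∈ (inj₂ (inj₂ refl)) = ⊥-elim (true≢false x∈ b∉K)
      leaf K sub (inj₂ b∉K) x x∈ (inj₁ refl) = leaf-at t x∈ λ u u∈ e → pick u u∈ (v-only u (∈∖ˡ A (chosen S ⊕ a) (sub u u∈)) e)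
        where
        pick : ∀ u → u ∈ K → u ≡ a ⊎ (u ≡ b ⊎ u ≡ t) → u ≡ t
        pick u u∈ (inj₁ refl)        = ⊥-elim (avoids (chosen S ⊕ a) sub (x∈⊕ (chosen S) a) u∈)
        pick u u∈ (inj₂ (inj₁ refl)) = ⊥-elim (true≢false u∈ b∉K)
        pick u u∈ (inj₂ (inj₂ e))    = e

  -- The paths v – a – b – z and v – e – c start at v, which is also adjacent to c:
  -- delete v, a, b, e, seal c, and choose v.
  module ForkShort (v a b e c z : Fin n) (v∈ : v ∈ A) (v-free : κ v ≡ free)
    (a-slim : Slim C a) (b-slim : Slim C b) (e-slim : Slim C e) (a≢e : a ≢ e)
    (Na : Neighbours₂ C a v b) (Nb : Neighbours₂ C b a z) (Ne : Neighbours₂ C e v c)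
    (vc : adj G v c ≡ true) (c≢a : c ≢ a) (c≢b : c ≢ b)
    (v-only : ∀ u → u ∈ A → adj G v u ≡ true → u ≡ a ⊎ (u ≡ e ⊎ u ≡ c)) where

    private
      module Na = Neighbours₂ Na
      module Nb = Neighbours₂ Nb
      module Ne = Neighbours₂ Ne
      a∈ = slim-vert a-slim
      e∈ = slim-vert e-slim

    A′ : VSet n
    A′ = A ⊖ v ⊖ a ⊖ b ⊖ e

    C′ : Config n
    C′ = restrict C A′ (relabel ⁅ c ⁆ seal κ)

    A′⊆A : A′ ⊆ A
    A′⊆A u p = ∈⊖ˡ A v (∈⊖ˡ (A ⊖ v) a (∈⊖ˡ (A ⊖ v ⊖ a) b (∈⊖ˡ (A ⊖ v ⊖ a ⊖ b) e p)))

    v∉ : v ∉ A′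
    v∉ = ∉⊖ (A ⊖ v ⊖ a ⊖ b) e (∉⊖ (A ⊖ v ⊖ a) b (∉⊖ (A ⊖ v) a (x∉⊖ A v)))

    a∉ : a ∉ A′
    a∉ = ∉⊖ (A ⊖ v ⊖ a ⊖ b) e (∉⊖ (A ⊖ v ⊖ a) b (x∉⊖ (A ⊖ v) a))

    b∉ : b ∉ A′
    b∉ = ∉⊖ (A ⊖ v ⊖ a ⊖ b) e (x∉⊖ (A ⊖ v ⊖ a) b)

    e∉ : e ∉ A′
    e∉ = x∉⊖ (A ⊖ v ⊖ a ⊖ b) e

    c∈′ : c ∈ A′
    c∈′ = ∈⊖ (A ⊖ v ⊖ a ⊖ b) e (∈⊖ (A ⊖ v ⊖ a) b (∈⊖ (A ⊖ v) a (∈⊖ A v Ne.y∈ (Ne.x≢y ∘ sym)) c≢a) c≢b)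
      (adj-≢ G Ne.adj₂ ∘ sym)

    -- The deleted `a` keeps `K ⊕ v ⊕ e` proper, so the triangle starts from 3 and gives 3 + 12 - 10
    -- = 5. Starting from 1 would give 3, too little for a seal of cost 3.
    heavy : ∀ K → K ⊆ A′ → c ∈ K → Potential≥ C 5 K
    heavy K K⊆ c∈ = linear (ends G K ∷ mass C K ∷ weight (κ v) ∷ weight (κ e) ∷ [])
      ((1 , lit 15 ⊞ 2 ⊠ x₀ ≲ x₁ ⊞ x₂ ⊞ x₃) ∷ (1 , x₂ ≲ lit 5) ∷ (1 , x₃ ≲ lit 5) ∷ []) (lit 5 ⊞ 2 ⊠ x₀ ≲ x₁)
      ( triangle-potential C K 3 (absent K K⊆ v∉) (absent K K⊆ e∉) (adj-≢ G Ne.adj₁) c∈ vc Ne.adj₁ Ne.adj₂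
          (gap (K ⊕ v ⊕ e) (⊕-⊆ (K ⊕ v) A (⊕-⊆ K A (λ u p → A′⊆A u (K⊆ u p)) v∈) e∈)
            (a , a∈ , ∉⊕ (K ⊕ v) (∉⊕ K (absent K K⊆ a∉) (adj-≢ G Na.adj₁)) a≢e)
            (terms≤∑ (K ⊕ v ⊕ e) (λ _ → 1) (∈∪ˡ (K ⊕ v) ⁅ e ⁆ (x∈⊕ K v)) (x∈⊕ (K ⊕ v) e) (adj-≢ G Ne.adj₁ ∘ sym)))
      , ≤-reflexive (cong weight v-free) , ≤-reflexive (cong weight (slim-free e-slim)) , tt)

    C′-sparse : Sparse C′
    C′-sparse K K⊆ i = by-cases (member? K c)
      where
      by-cases : c ∈ K ⊎ c ∉ K → Potential≥ C′ 1 K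
      by-cases (inj₁ c∈) = linear (ends G K ∷ mass C K ∷ mass C′ K ∷ ∑ K (λ u → 𝟙 (⁅ c ⁆ u)) ∷ [])
        ((1 , lit 5 ⊞ 2 ⊠ x₀ ≲ x₁) ∷ (1 , x₁ ≲ x₂ ⊞ 3 ⊠ x₃) ∷ (3 , x₃ ≲ lit 1) ∷ []) (lit 1 ⊞ 2 ⊠ x₀ ≲ x₂)
        (heavy K K⊆ c∈ , relabel-cost ⁅ c ⁆ κ 3 seal-cost K , ∑𝟙⁅⁆≤1 K c , tt)
      by-cases (inj₂ c∉) = linear (ends G K ∷ mass C K ∷ mass C′ K ∷ ∑ K (λ u → 𝟙 (⁅ c ⁆ u)) ∷ [])
        ((1 , lit 1 ⊞ 2 ⊠ x₀ ≲ x₁) ∷ (1 , x₁ ≲ x₂ ⊞ 3 ⊠ x₃) ∷ (3 , x₃ ≲ lit 0) ∷ []) (lit 1 ⊞ 2 ⊠ x₀ ≲ x₂)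
        ( sparse K (λ u p → A′⊆A u (K⊆ u p)) i , relabel-cost ⁅ c ⁆ κ 3 seal-cost K
        , ≤-reflexive (∑𝟙⁅⁆≡0 K c∉) , tt)

    abstract
      S : Solution C′
      S = solve-smaller C′ (card-< A′ A A′⊆A v∈ v∉) C′-sparse

    c-unsealed : Sealed (κ c) → ⊥
    c-unsealed s = sealed-light s (≤-trans (≤-trans (s≤s (s≤s (s≤s z≤n)))
      (heavy ⁅ c ⁆ (λ u p → subst (_∈ A′) (sym (∈⁅⁆⁻ c p)) c∈′) (∈⁅⁆ c)))
      (≤-reflexive (∑-⁅⁆ c (λ u → weight (κ u)))))

    c-out : c ∈ chosen S → ⊥
    c-out = not-chosen ⁅ c ⁆ seal S (λ k → sealed≢free (seal-sealed k)) (∈⁅⁆ c)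

    v-none : ∀ u → u ∈ chosen S → adj G v u ≡ true → ⊥
    v-none u p h with v-only u (A′⊆A u (chosen-verts S u p)) h
    ... | inj₁ refl        = escaped S p a∉
    ... | inj₂ (inj₁ refl) = escaped S p e∉
    ... | inj₂ (inj₂ refl) = c-out p

    a-none : ∀ u → u ∈ chosen S → adj G a u ≡ true → ⊥
    a-none u p h with Na.only u (A′⊆A u (chosen-verts S u p)) h
    ... | inj₁ refl = escaped S p v∉
    ... | inj₂ refl = escaped S p b∉

    b-only : ∀ u → u ∈ chosen S → adj G b u ≡ true → u ≡ z
    b-only u p h with Nb.only u (A′⊆A u (chosen-verts S u p)) h
    ... | inj₁ refl = ⊥-elim (escaped S p a∉)
    ... | inj₂ eq   = eq

    e-none : ∀ u → u ∈ chosen S → adj G e u ≡ true → ⊥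
    e-none u p h with Ne.only u (A′⊆A u (chosen-verts S u p)) h
    ... | inj₁ refl = escaped S p v∉
    ... | inj₂ refl = c-out p

    new-unique : ∀ x u w → x ∈ A → x ∉ A′ → u ∈ chosen S → w ∈ chosen S →
      adj G x u ≡ true → adj G x w ≡ true → u ≡ w
    new-unique x u w x∈ x∉ p q h h′ with deleted₄ A v a b e x∈ x∉
    ... | inj₁ refl               = ⊥-elim (v-none u p h)
    ... | inj₂ (inj₁ refl)        = ⊥-elim (a-none u p h)
    -- `b` is the one deleted vertex that may see a chosen vertex, namely `z`. This is harmless, as
    -- `clean` concerns only the neighbours of `v`.
    ... | inj₂ (inj₂ (inj₁ refl)) = trans (b-only u p h) (sym (b-only w q h′))
    ... | inj₂ (inj₂ (inj₂ refl)) = ⊥-elim (e-none u p h)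

    new-sealed : ∀ x u → x ∈ A → x ∉ A′ → Sealed (κ x) → u ∈ chosen S → adj G x u ≡ true → ⊥
    new-sealed x u x∈ x∉ s _ _ with deleted₄ A v a b e x∈ x∉
    ... | inj₁ refl               = sealed≢free s v-free
    ... | inj₂ (inj₁ refl)        = sealed≢free s (slim-free a-slim)
    ... | inj₂ (inj₂ (inj₁ refl)) = sealed≢free s (slim-free b-slim)
    ... | inj₂ (inj₂ (inj₂ refl)) = sealed≢free s (slim-free e-slim)

    solution : Solution C
    solution = Extend.extend-chosen C C′ S A′⊆A (λ _ _ _ _ h → h) (relabel-demotes ⁅ c ⁆ κ seal-demotes)
      new-unique new-sealed v v∈ v-free v-none clean unsealed
      (λ K sub x x∈ x∉ → inj₂ (leaf K sub (member? K a) x x∈ (deleted₄ A v a b e (∈∖ˡ A (chosen S ⊕ v) (sub x x∈)) x∉)))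
      where
      clean : ∀ x u → x ∈ A → adj G x v ≡ true → u ∈ chosen S → adj G x u ≡ true → ⊥
      clean x u x∈ h with v-only x x∈ (adj-swap G h)
      ... | inj₁ refl        = a-none u
      ... | inj₂ (inj₁ refl) = e-none u
      ... | inj₂ (inj₂ refl) = sealed S c u c∈′ (subst Sealed (sym (relabel-∈ ⁅ c ⁆ seal κ (∈⁅⁆ c))) (seal-sealed (κ c)))
      unsealed : ∀ x → x ∈ A → adj G x v ≡ true → Sealed (κ x) → ⊥
      unsealed x x∈ h s with v-only x x∈ (adj-swap G h)
      ... | inj₁ refl        = sealed≢free s (slim-free a-slim)
      ... | inj₂ (inj₁ refl) = sealed≢free s (slim-free e-slim)
      ... | inj₂ (inj₂ refl) = c-unsealed s
      leaf : ∀ K → K ⊆ A ∖ (chosen S ⊕ v) → a ∈ K ⊎ a ∉ K → ∀ x → x ∈ K →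
        x ≡ v ⊎ (x ≡ a ⊎ (x ≡ b ⊎ x ≡ e)) → HasLeaf G K
      leaf K sub a? x x∈ d = by-cases a? d
        where
        K⊆A : K ⊆ A
        K⊆A u p = ∈∖ˡ A (chosen S ⊕ v) (sub u p)
        v∉K : v ∉ K
        v∉K = missed (chosen S ⊕ v) sub (x∈⊕ (chosen S) v)
        by-cases : a ∈ K ⊎ a ∉ K → x ≡ v ⊎ (x ≡ a ⊎ (x ≡ b ⊎ x ≡ e)) → HasLeaf G K
        by-cases (inj₁ a∈K) _ = leaf-at b a∈K λ u u∈ h → only-second v∉K u u∈ (Na.only u (K⊆A u u∈) h)
        by-cases (inj₂ a∉K) (inj₁ refl) = ⊥-elim (true≢false x∈ v∉K)
        by-cases (inj₂ a∉K) (inj₂ (inj₁ refl)) = ⊥-elim (true≢false x∈ a∉K)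
        by-cases (inj₂ a∉K) (inj₂ (inj₂ (inj₁ refl))) = leaf-at z x∈ λ u u∈ h → only-second a∉K u u∈ (Nb.only u (K⊆A u u∈) h)
        by-cases (inj₂ a∉K) (inj₂ (inj₂ (inj₂ refl))) = leaf-at c x∈ λ u u∈ h → only-second v∉K u u∈ (Ne.only u (K⊆A u u∈) h)

  -- The paths v – a – b – z and v – e – d start at v, whose third neighbour is c: delete a, b, e and
  -- join v to d. If v is not chosen, either z is chosen and a, b join the forest, or a can be chosen.
  module ForkLong (v a b e c z d : Fin n) (v-free : κ v ≡ free)
    (a-slim : Slim C a) (b-slim : Slim C b) (e-slim : Slim C e) (a≢e : a ≢ e)
    (Na : Neighbours₂ C a v b) (Nb : Neighbours₂ C b a z) (Ne : Neighbours₂ C e v d)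
    (vd : adj G v d ≡ false)
    (v-only : ∀ u → u ∈ A → adj G v u ≡ true → u ≡ a ⊎ (u ≡ e ⊎ u ≡ c)) where

    private
      module Na = Neighbours₂ Na
      module Nb = Neighbours₂ Nb
      module Ne = Neighbours₂ Ne
      a∈ = slim-vert a-slim
      e∈ = slim-vert e-slim
    open AddEdge G v d Ne.x≢y

    A′ : VSet n
    A′ = A ⊖ a ⊖ b ⊖ e

    C′ : Config n
    C′ = record { verts = A′ ; graph = addEdge ; kind = relabel ⁅ c ⁆ demote κ }

    A′⊆A : A′ ⊆ A
    A′⊆A u p = ∈⊖ˡ A a (∈⊖ˡ (A ⊖ a) b (∈⊖ˡ (A ⊖ a ⊖ b) e p))

    a∉ : a ∉ A′
    a∉ = ∉⊖ (A ⊖ a ⊖ b) e (∉⊖ (A ⊖ a) b (x∉⊖ A a))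

    b∉ : b ∉ A′
    b∉ = ∉⊖ (A ⊖ a ⊖ b) e (x∉⊖ (A ⊖ a) b)

    e∉ : e ∉ A′
    e∉ = x∉⊖ (A ⊖ a ⊖ b) e

    module Pair (K : VSet n) (K⊆ : K ⊆ A′) (big : 2 ≤ card K) where

      K⊆A : K ⊆ A
      K⊆A u p = A′⊆A u (K⊆ u p)

      drop : mass C K ≤ mass C′ K + 1 * ∑ K (λ u → 𝟙 (⁅ c ⁆ u))
      drop = relabel-cost ⁅ c ⁆ κ 1 demote-cost K

      missing : v ∉ K ⊎ d ∉ K → Potential≥ C′ 1 K
      missing m = subst (λ x → 1 + 2 * x ≤ mass C′ K) (sym (ends-addEdge-missing K m))
        (linear (ends G K ∷ mass C K ∷ mass C′ K ∷ ∑ K (λ u → 𝟙 (⁅ c ⁆ u)) ∷ [])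
          ((1 , lit 3 ⊞ 2 ⊠ x₀ ≲ x₁) ∷ (1 , x₁ ≲ x₂ ⊞ 1 ⊠ x₃) ∷ (1 , x₃ ≲ lit 1) ∷ []) (lit 1 ⊞ 2 ⊠ x₀ ≲ x₂)
          (gap K K⊆A (a , a∈ , absent K K⊆ a∉) big , drop , ∑𝟙⁅⁆≤1 K c , tt))

      -- Since `a` is outside, `K ⊕ e` is proper and ρ(K) ≥ 3 + 8 - 5 = 6. The new edge takes 4 and
      -- the demotion of `c` takes 1.
      both : v ∈ K → d ∈ K → Potential≥ C′ 1 K
      both v∈K d∈K = subst (λ x → 1 + 2 * x ≤ mass C′ K) (sym (ends-addEdge vd K v∈K d∈K))
        (linear (ends G K ∷ mass C K ∷ mass C′ K ∷ ∑ K (λ u → 𝟙 (⁅ c ⁆ u)) ∷ weight (κ e) ∷ [])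
          ((1 , lit 11 ⊞ 2 ⊠ x₀ ≲ x₁ ⊞ x₄) ∷ (1 , x₄ ≲ lit 5) ∷ (1 , x₁ ≲ x₂ ⊞ 1 ⊠ x₃) ∷ (1 , x₃ ≲ lit 1) ∷ [])
          (lit 1 ⊞ 2 ⊠ (lit 2 ⊞ x₀) ≲ x₂)
          ( path-potential C K 3 (absent K K⊆ e∉) v∈K d∈K Ne.x≢y Ne.adj₁ Ne.adj₂
              (gap (K ⊕ e) (⊕-⊆ K A K⊆A e∈) (a , a∈ , ∉⊕ K (absent K K⊆ a∉) a≢e)
                (≤-trans big (∑-⊆ K (K ⊕ e) (λ _ → 1) λ u p → ∈∪ˡ K ⁅ e ⁆ p)))
          , ≤-reflexive (cong weight (slim-free e-slim)) , drop , ∑𝟙⁅⁆≤1 K c , tt))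

      by-cases : v ∈ K ⊎ v ∉ K → d ∈ K ⊎ d ∉ K → Potential≥ C′ 1 K
      by-cases (inj₁ p) (inj₁ q) = both p q
      by-cases (inj₂ p) _        = missing (inj₁ p)
      by-cases (inj₁ _) (inj₂ q) = missing (inj₂ q)

    abstract
      S : Solution C′
      S = solve-smaller C′ (card-< A′ A A′⊆A a∈ a∉)
        (sparse-from-pairs C′ λ K K⊆ big → Pair.by-cases K K⊆ big (member? K v) (member? K d))

    -- This is why `c` is demoted: when `a` gets chosen, its neighbour `v` must not see another
    -- chosen vertex.
    v-none : ∀ u → u ∈ chosen S → adj G v u ≡ true → ⊥
    v-none u p h with v-only u (A′⊆A u (chosen-verts S u p)) h
    ... | inj₁ refl        = escaped S p a∉
    ... | inj₂ (inj₁ refl) = escaped S p e∉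
    ... | inj₂ (inj₂ refl) = not-chosen ⁅ c ⁆ demote S demote≢free (∈⁅⁆ c) p

    a-only : ∀ u → u ∈ chosen S → adj G a u ≡ true → u ≡ v
    a-only u p h with Na.only u (A′⊆A u (chosen-verts S u p)) h
    ... | inj₁ eq   = eq
    ... | inj₂ refl = ⊥-elim (escaped S p b∉)

    b-only : ∀ u → u ∈ chosen S → adj G b u ≡ true → u ≡ z
    b-only u p h with Nb.only u (A′⊆A u (chosen-verts S u p)) h
    ... | inj₁ refl = ⊥-elim (escaped S p a∉)
    ... | inj₂ eq   = eq

    -- The new edge forbids choosing both `v` and `d`.
    e-unique : ∀ u w → u ∈ chosen S → w ∈ chosen S → adj G e u ≡ true → adj G e w ≡ true → u ≡ w
    e-unique u w p q h h′
      with Ne.only u (A′⊆A u (chosen-verts S u p)) h | Ne.only w (A′⊆A w (chosen-verts S w q)) h′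
    ... | inj₁ refl | inj₁ refl = refl
    ... | inj₂ refl | inj₂ refl = refl
    ... | inj₁ refl | inj₂ refl = ⊥-elim (independent S u w p q addEdge-new)
    ... | inj₂ refl | inj₁ refl = ⊥-elim (independent S w u q p addEdge-new)

    new-unique : ∀ x u w → x ∈ A → x ∉ A′ → u ∈ chosen S → w ∈ chosen S →
      adj G x u ≡ true → adj G x w ≡ true → u ≡ w
    new-unique x u w x∈ x∉ p q h h′ with deleted₃ A a b e x∈ x∉
    ... | inj₁ refl        = trans (a-only u p h) (sym (a-only w q h′))
    ... | inj₂ (inj₁ refl) = trans (b-only u p h) (sym (b-only w q h′))
    ... | inj₂ (inj₂ refl) = e-unique u w p q h h′

    new-sealed : ∀ x u → x ∈ A → x ∉ A′ → Sealed (κ x) → u ∈ chosen S → adj G x u ≡ true → ⊥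
    new-sealed x u x∈ x∉ s _ _ with deleted₃ A a b e x∈ x∉
    ... | inj₁ refl        = sealed≢free s (slim-free a-slim)
    ... | inj₂ (inj₁ refl) = sealed≢free s (slim-free b-slim)
    ... | inj₂ (inj₂ refl) = sealed≢free s (slim-free e-slim)

    open Extend C C′ S A′⊆A (λ _ _ _ _ h → addEdge-old h) (relabel-demotes ⁅ c ⁆ κ demote-demotes)
      new-unique new-sealed

    -- Stated for any `J` above the old chosen set, to serve both outcomes: `a` in the forest and
    -- `a` chosen.
    module Leaves (J : VSet n) (S⊆J : chosen S ⊆ J) (K : VSet n) (sub : K ⊆ A ∖ J) where

      K⊆A : K ⊆ A
      K⊆A u p = ∈∖ˡ A J (sub u p)

      a-leaf : a ∈ K → v ∉ K ⊎ b ∉ K → HasLeaf G K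
      a-leaf a∈K (inj₁ v∉K) = leaf-at b a∈K λ u u∈ h → only-second v∉K u u∈ (Na.only u (K⊆A u u∈) h)
      a-leaf a∈K (inj₂ b∉K) = leaf-at v a∈K λ u u∈ h → only-first b∉K u u∈ (Na.only u (K⊆A u u∈) h)

      b-leaf : b ∈ K → a ∉ K ⊎ z ∉ K → HasLeaf G K
      b-leaf b∈K (inj₁ a∉K) = leaf-at z b∈K λ u u∈ h → only-second a∉K u u∈ (Nb.only u (K⊆A u u∈) h)
      b-leaf b∈K (inj₂ z∉K) = leaf-at a b∈K λ u u∈ h → only-first z∉K u u∈ (Nb.only u (K⊆A u u∈) h)

      e-leaf : e ∈ K → v ∉ K ⊎ d ∉ K → HasLeaf G K
      e-leaf e∈K (inj₁ v∉K) = leaf-at d e∈K λ u u∈ h → only-second v∉K u u∈ (Ne.only u (K⊆A u u∈) h)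
      e-leaf e∈K (inj₂ d∉K) = leaf-at v e∈K λ u u∈ h → only-first d∉K u u∈ (Ne.only u (K⊆A u u∈) h)

      e-step : a ∉ K → b ∉ K → e ∈ K → v ∈ K ⊎ v ∉ K → d ∈ K ⊎ d ∉ K → Treelike G K ⊎ HasLeaf G K
      e-step a∉K b∉K e∈K (inj₂ v∉K) _          = inj₂ (e-leaf e∈K (inj₁ v∉K))
      e-step a∉K b∉K e∈K (inj₁ _)   (inj₂ d∉K) = inj₂ (e-leaf e∈K (inj₂ d∉K))
      e-step a∉K b∉K e∈K (inj₁ v∈K) (inj₁ d∈K) = inj₁ (treelike-subdivide G K e∈K
        (≤-trans (∑-⊆ K A (λ u → 𝟙 (adj G e u)) K⊆A) (≤-reflexive (slim-deg e-slim)))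
        (subst (λ x → 2 + x ≤ 2 * card (K ⊖ e)) (ends-addEdge vd (K ⊖ e) v∈′ d∈′) (acyclic S (K ⊖ e) inside (v , v∈′))))
        where
        v∈′ : v ∈ K ⊖ e
        v∈′ = ∈⊖ K e v∈K (adj-≢ G Ne.adj₁ ∘ sym)
        d∈′ : d ∈ K ⊖ e
        d∈′ = ∈⊖ K e d∈K (adj-≢ G Ne.adj₂ ∘ sym)
        inside : K ⊖ e ⊆ A′ ∖ chosen S
        inside u p = ∈∖ A′ (chosen S)
          (∈⊖ (A ⊖ a ⊖ b) e (∈⊖ (A ⊖ a) b (∈⊖ A a (K⊆A u u∈) (λ { refl → true≢false u∈ a∉K }))
            (λ { refl → true≢false u∈ b∉K })) (∈⊖ʳ K e p))
          (∉-intro (chosen S) λ q → true≢false (S⊆J u q) (∈∖ʳ A J (sub u u∈)))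
          where
          u∈ : u ∈ K
          u∈ = ∈⊖ˡ K e p

    solution : Solution C
    solution = by-colours (member? (chosen S) v) (member? (chosen S) z)
      where
      forest-step : (v ∈ chosen S) ⊎ (z ∈ chosen S) →
        ∀ K → K ⊆ A ∖ chosen S → a ∈ K ⊎ a ∉ K → b ∈ K ⊎ b ∉ K →
        ∀ x → x ∈ K → x ≡ a ⊎ (x ≡ b ⊎ x ≡ e) → Treelike G K ⊎ HasLeaf G K
      forest-step h K sub = go h
        where
        open Leaves (chosen S) (λ _ p → p) K sub
        off : ∀ {y} → y ∈ chosen S → y ∉ K
        off = missed (chosen S) sub
        go : (v ∈ chosen S) ⊎ (z ∈ chosen S) → a ∈ K ⊎ a ∉ K → b ∈ K ⊎ b ∉ K →
          ∀ x → x ∈ K → x ≡ a ⊎ (x ≡ b ⊎ x ≡ e) → Treelike G K ⊎ HasLeaf G K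
        -- The path through `a` and `b` is stripped from the end next to a chosen vertex: from `a`
        -- if `v` is chosen, from `b` if `z` is.
        go (inj₁ v∈I) (inj₁ a∈K) _ _ _ _          = inj₂ (a-leaf a∈K (inj₁ (off v∈I)))
        go (inj₁ _)   (inj₂ a∉K) (inj₁ b∈K) _ _ _ = inj₂ (b-leaf b∈K (inj₁ a∉K))
        go (inj₂ z∈I) _ (inj₁ b∈K) _ _ _          = inj₂ (b-leaf b∈K (inj₂ (off z∈I)))
        go (inj₂ _) (inj₁ a∈K) (inj₂ b∉K) _ _ _   = inj₂ (a-leaf a∈K (inj₂ b∉K))
        go _ (inj₂ a∉K) (inj₂ b∉K) x x∈ (inj₁ refl)        = ⊥-elim (true≢false x∈ a∉K)
        go _ (inj₂ a∉K) (inj₂ b∉K) x x∈ (inj₂ (inj₁ refl)) = ⊥-elim (true≢false x∈ b∉K)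
        go _ (inj₂ a∉K) (inj₂ b∉K) x x∈ (inj₂ (inj₂ refl)) = e-step a∉K b∉K x∈ (member? K v) (member? K d)
      chosen-step : ∀ K → K ⊆ A ∖ (chosen S ⊕ a) → b ∈ K ⊎ b ∉ K →
        ∀ x → x ∈ K → x ≡ a ⊎ (x ≡ b ⊎ x ≡ e) → Treelike G K ⊎ HasLeaf G K
      chosen-step K sub = go
        where
        open Leaves (chosen S ⊕ a) (λ _ p → ∈∪ˡ (chosen S) ⁅ a ⁆ p) K sub
        a∉K : a ∉ K
        a∉K = missed (chosen S ⊕ a) sub (x∈⊕ (chosen S) a)
        go : b ∈ K ⊎ b ∉ K → ∀ x → x ∈ K → x ≡ a ⊎ (x ≡ b ⊎ x ≡ e) → Treelike G K ⊎ HasLeaf G K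
        go (inj₁ b∈K) _ _ _ = inj₂ (b-leaf b∈K (inj₁ a∉K))
        go (inj₂ b∉K) x x∈ (inj₁ refl)        = ⊥-elim (true≢false x∈ a∉K)
        go (inj₂ b∉K) x x∈ (inj₂ (inj₁ refl)) = ⊥-elim (true≢false x∈ b∉K)
        go (inj₂ b∉K) x x∈ (inj₂ (inj₂ refl)) = e-step a∉K b∉K x∈ (member? K v) (member? K d)
      in-forest : (v ∈ chosen S) ⊎ (z ∈ chosen S) → Solution C
      in-forest h = extend-forest λ K sub x x∈ x∉ → forest-step h K sub (member? K a) (member? K b) x x∈
        (deleted₃ A a b e (∈∖ˡ A (chosen S) (sub x x∈)) x∉)
      a-none : v ∉ chosen S → ∀ u → u ∈ chosen S → adj G a u ≡ true → ⊥
      a-none v∉I u p h = true≢false (subst (_∈ chosen S) (a-only u p h) p) v∉I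
      clean : v ∉ chosen S → z ∉ chosen S → ∀ x u → x ∈ A → adj G x a ≡ true → u ∈ chosen S → adj G x u ≡ true → ⊥
      clean v∉I z∉I x u x∈ h p h′ with Na.only x x∈ (adj-swap G h)
      ... | inj₁ refl = v-none u p h′
      ... | inj₂ refl = true≢false (subst (_∈ chosen S) (b-only u p h′) p) z∉I
      unsealed : ∀ x → x ∈ A → adj G x a ≡ true → Sealed (κ x) → ⊥
      unsealed x x∈ h s with Na.only x x∈ (adj-swap G h)
      ... | inj₁ refl = sealed≢free s v-free
      ... | inj₂ refl = sealed≢free s (slim-free b-slim)
      by-colours : v ∈ chosen S ⊎ v ∉ chosen S → z ∈ chosen S ⊎ z ∉ chosen S → Solution C
      by-colours (inj₁ v∈I) _          = in-forest (inj₁ v∈I)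
      by-colours (inj₂ _)   (inj₁ z∈I) = in-forest (inj₂ z∈I)
      by-colours (inj₂ v∉I) (inj₂ z∉I) = extend-chosen a a∈ (slim-free a-slim) (a-none v∉I) (clean v∉I z∉I) unsealed
        λ K sub x x∈ x∉ → chosen-step K sub (member? K b) x x∈
          (deleted₃ A a b e (∈∖ˡ A (chosen S ⊕ a) (sub x x∈)) x∉)

-- Discharging

-- What a slim vertex a sends to its neighbour x: s and t tell whether a and x are slim,
-- e whether they are adjacent and h whether a has a slim neighbour.
portion : (s e t h : Bool) → ℕ
portion s e t h = if s ∧ (e ∧ not t) then 1 + 𝟙 h else 0

portion≤2 : ∀ s e t h → portion s e t h ≤ 2 * 𝟙 (s ∧ e)
portion≤2 false e     t     h     = z≤n
portion≤2 true  false t     h     = z≤n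
portion≤2 true  true  true  h     = z≤n
portion≤2 true  true  false true  = ≤-refl
portion≤2 true  true  false false = s≤s z≤n

portion≤1 : ∀ s e t h → (s ≡ true → e ≡ true → h ≡ true → ⊥) → portion s e t h ≤ 𝟙 (s ∧ e)
portion≤1 false e     t     h     k = z≤n
portion≤1 true  false t     h     k = z≤n
portion≤1 true  true  true  h     k = z≤n
portion≤1 true  true  false false k = ≤-refl
portion≤1 true  true  false true  k = ⊥-elim (k refl refl refl)

portion≡0 : ∀ s e t h → (s ≡ true → e ≡ true → ⊥) → portion s e t h ≡ 0
portion≡0 false e     t h k = refl
portion≡0 true  false t h k = refl
portion≡0 true  true  t h k = ⊥-elim (k refl refl)

portion-pays : ∀ {s e t} h → s ≡ true → e ≡ true → t ≡ false → portion s e t h ≡ 1 + 𝟙 h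
portion-pays h refl refl refl = refl

portion-slim : ∀ s e h → portion s e true h ≡ 0
portion-slim false e     h = refl
portion-slim true  false h = refl
portion-slim true  true  h = refl

module Discharge {n : ℕ} (C : Config n) (sparse : Sparse C)
  (solve-smaller : ∀ (C′ : Config n) → card (verts C′) < card (verts C) → Sparse C′ → Solution C′)
  (gap : ∀ K → K ⊆ verts C → (∃ λ v → v ∈ verts C × v ∉ K) → 2 ≤ card K → Potential≥ C 3 K)
  where

  private
    A = verts C
    G = graph C
    κ = kind C
  open Reduce C sparse solve-smaller gap




  abstract
    σ : VSet n
    σ a = does (slim? C a)

    σ⁻ : ∀ {a} → a ∈ σ → Slim C a
    σ⁻ {a} p = does⁻ (slim? C a) p

    σ⁺ : ∀ {a} → Slim C a → a ∈ σ
    σ⁺ {a} q = dec-true (slim? C a) q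

    has-slim : VSet n
    has-slim a = positive (∑ A (λ u → 𝟙 (σ u ∧ adj G a u)))

    has-slim⁻ : ∀ {a} → a ∈ has-slim → ∃ λ u → Slim C u × adj G a u ≡ true
    has-slim⁻ {a} p with ∑-positive A (λ u → 𝟙 (σ u ∧ adj G a u)) (positive⁻ p)
    ... | u , _ , q = u , σ⁻ (∧-trueˡ (σ u) (1≤𝟙 q)) , ∧-trueʳ (σ u) (1≤𝟙 q)

    has-slim⁺ : ∀ {a u} → Slim C u → adj G a u ≡ true → a ∈ has-slim
    has-slim⁺ {a} {u} q e = positive⁺ (≤-trans (≤-reflexive (sym (cong 𝟙 (∧-true (σ⁺ q) e))))
      (term≤∑ A (λ x → 𝟙 (σ x ∧ adj G a x)) (slim-vert q)))

  share : Fin n → Fin n → ℕ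
  share a x = portion (σ a) (adj G a x) (σ x) (has-slim a)

  received sent : Fin n → ℕ
  received x = ∑ A (λ a → share a x)
  sent a = ∑ A (share a)

  -- The charge `weight − 2 · deg`, doubled, is at most 0 after the transfers. Doubling makes the
  -- halves that a slim vertex splits between two neighbours integers.
  Balanced : Fin n → Set
  Balanced v = 2 * weight (κ v) + received v ≤ 4 * deg G A v + sent v

  slim-count : Fin n → ℕ
  slim-count v = ∑ A (λ a → 𝟙 (σ a ∧ adj G a v))

  slim-adjacent≤ : ∀ a v → 𝟙 (σ a ∧ adj G a v) ≤ 𝟙 (adj G v a)
  slim-adjacent≤ a v with σ a
  ... | false = z≤n
  ... | true  = ≤-reflexive (cong 𝟙 (adj-sym G a v))

  slim-count≤deg : ∀ v → slim-count v ≤ deg G A v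
  slim-count≤deg v = ∑-mono A λ a _ → slim-adjacent≤ a v

  slim-count<deg : ∀ v u → u ∈ A → adj G v u ≡ true → u ∉ σ → suc (slim-count v) ≤ deg G A v
  slim-count<deg v u u∈ e u∉ = begin
    suc (slim-count v)
      ≡⟨ cong suc (trans (∑-⊖ A (λ a → 𝟙 (σ a ∧ adj G a v)) u∈)
           (cong (λ s → 𝟙 (s ∧ adj G u v) + ∑ (A ⊖ u) (λ a → 𝟙 (σ a ∧ adj G a v))) u∉)) ⟩
    suc (∑ (A ⊖ u) (λ a → 𝟙 (σ a ∧ adj G a v)))
      ≤⟨ s≤s (∑-mono (A ⊖ u) λ a _ → slim-adjacent≤ a v) ⟩
    suc (∑ (A ⊖ u) (λ a → 𝟙 (adj G v a)))
      ≡⟨ sym (trans (∑-⊖ A (λ a → 𝟙 (adj G v a)) u∈) (cong (_+ ∑ (A ⊖ u) (λ a → 𝟙 (adj G v a))) (𝟙-adj G e))) ⟩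
    deg G A v ∎
    where
    open ≤-Reasoning

  received≤ : ∀ v → received v ≤ 2 * slim-count v
  received≤ v = ≤-trans (∑-mono A λ a _ → portion≤2 (σ a) (adj G a v) (σ v) (has-slim a))
    (≤-reflexive (∑-* 2 A (λ a → 𝟙 (σ a ∧ adj G a v))))

  tree-degree-two : ∀ f a → f ∈ A → κ f ≡ tree → deg G A f ≡ 2 → Slim C a → adj G f a ≡ true → Solution C
  tree-degree-two f a f∈ f-tree f-deg s e
    with neighbours₂ C f-deg (slim-vert s) e | neighbours₂ C (slim-deg s) f∈ (adj-swap G e)
  ... | w , Nf | z , Na = by-cases (member? (adj G a) w)
    where
    by-cases : adj G a w ≡ true ⊎ adj G a w ≡ false → Solution C
    by-cases (inj₂ nonadj) = TreePath.solution f a w f∈ f-tree f-deg Nf nonadj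
    by-cases (inj₁ aw) = pick (Neighbours₂.only Na w (Neighbours₂.y∈ Nf) aw)
      where
      pick : w ≡ f ⊎ w ≡ z → Solution C
      pick (inj₁ eq)   = ⊥-elim (adj-≢ G (Neighbours₂.adj₂ Nf) (sym eq))
      pick (inj₂ refl) = TreeTriangle.solution f a w f∈ f-tree s Nf Na

  tree-thread : ∀ f a b → f ∈ A → κ f ≡ tree → Slim C a → adj G a f ≡ true → Slim C b → adj G a b ≡ true → Solution C
  tree-thread f a b f∈ f-tree s e t e′ with neighbours₂ C (slim-deg s) f∈ e
  ... | y , Na = pick (Neighbours₂.only Na b (slim-vert t) e′)
    where
    pick : b ≡ f ⊎ b ≡ y → Solution C
    pick (inj₁ refl) with trans (sym f-tree) (slim-free t)
    ... | ()
    pick (inj₂ refl) with neighbours₂ C (slim-deg t) (slim-vert s) (adj-swap G e′)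
    ... | z , Nb = TreeThread.solution f a b z f∈ f-tree s t Na Nb

  -- The other neighbour `d` of `e` decides. If it is not adjacent to `v`, `ForkLong` applies. If it
  -- is, then either `d` is `a`, which forces `e` to be `b` and closes a triangle, or `d` is the
  -- third neighbour `c`, as in `ForkShort`.
  fork : ∀ v a b e → v ∈ A → κ v ≡ free → deg G A v ≡ 3 → Slim C a → adj G v a ≡ true →
    Slim C b → adj G a b ≡ true → Slim C e → adj G v e ≡ true → a ≢ e → Solution C
  fork v a b e v∈ v-free v-deg sa va sb ab se ve a≢e
    with neighbours₂ C (slim-deg sa) v∈ (adj-swap G va)
       | neighbours₂ C (slim-deg sb) (slim-vert sa) (adj-swap G ab)
       | neighbours₂ C (slim-deg se) v∈ (adj-swap G ve)
       | third-neighbour C v-deg (slim-vert sa) (slim-vert se) a≢e va ve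
  ... | y , Na | z , Nb | d , Ne | c , c∈ , vc , c≢a , c≢e , v-only =
    at-b (Neighbours₂.only Na b (slim-vert sb) ab)
    where
    at-b : b ≡ v ⊎ b ≡ y → Solution C
    at-b (inj₁ refl) with trans (sym v-deg) (slim-deg sb)
    ... | ()
    at-b (inj₂ refl) = by-cases (member? (adj G v) d)
      where
      -- Otherwise `b`, of degree 2, would be adjacent to the three distinct vertices `a`, `v` and
      -- `e`.
      c≢b : adj G e c ≡ true → c ≢ b
      c≢b ec refl = two-ways (Neighbours₂.only Nb v v∈ (adj-swap G vc))
                             (Neighbours₂.only Nb e (slim-vert se) (adj-swap G ec))
        where
        two-ways : v ≡ a ⊎ v ≡ z → e ≡ a ⊎ e ≡ z → ⊥
        two-ways (inj₁ p) _        = adj-≢ G va p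
        two-ways (inj₂ _) (inj₁ q) = a≢e (sym q)
        two-ways (inj₂ p) (inj₂ q) = adj-≢ G ve (trans p (sym q))
      triangle : e ≡ b → Solution C
      triangle refl = at-z (Neighbours₂.only Nb v v∈ (adj-swap G ve))
        where
        at-z : v ≡ a ⊎ v ≡ z → Solution C
        at-z (inj₁ p)    = ⊥-elim (adj-≢ G va p)
        at-z (inj₂ refl) = ForkTriangle.solution v a b c v∈ v-free sa sb Na Nb v-only
      at-d : d ≡ a ⊎ (d ≡ e ⊎ d ≡ c) → Solution C
      at-d (inj₁ refl) = at-e (Neighbours₂.only Na e (slim-vert se) (adj-swap G (Neighbours₂.adj₂ Ne)))
        where
        at-e : e ≡ v ⊎ e ≡ b → Solution C
        at-e (inj₁ p) = ⊥-elim (adj-≢ G ve (sym p))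
        at-e (inj₂ p) = triangle p
      at-d (inj₂ (inj₁ p))    = ⊥-elim (adj-≢ G (Neighbours₂.adj₂ Ne) (sym p))
      at-d (inj₂ (inj₂ refl)) = ForkShort.solution v a b e c z v∈ v-free sa sb se a≢e Na Nb Ne vc c≢a
        (c≢b (Neighbours₂.adj₂ Ne)) v-only
      by-cases : adj G v d ≡ true ⊎ adj G v d ≡ false → Solution C
      by-cases (inj₁ vd) = at-d (v-only d (Neighbours₂.y∈ Ne) vd)
      by-cases (inj₂ vd) = ForkLong.solution v a b e c z d v-free sa sb se a≢e Na Nb Ne vd v-only

  slim-neighbourhood : ∀ v → v ∈ A → κ v ≡ free →
    Solution C ⊎ ∃ λ u → u ∈ A × adj G v u ≡ true × u ∉ σ
  slim-neighbourhood v v∈ v-free = by-cases (inhabited? ((A ∩ adj G v) ∖ σ))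
    where
    by-cases : Inhabited ((A ∩ adj G v) ∖ σ) ⊎ (∀ u → u ∉ (A ∩ adj G v) ∖ σ) →
      Solution C ⊎ ∃ λ u → u ∈ A × adj G v u ≡ true × u ∉ σ
    by-cases (inj₁ (u , p)) = inj₂ (u , ∧-trueˡ (A u) N , ∧-trueʳ (A u) N , ∈∖ʳ (A ∩ adj G v) σ p)
      where
      N : u ∈ A ∩ adj G v
      N = ∈∖ˡ (A ∩ adj G v) σ p
    by-cases (inj₂ none) = inj₁ (SlimNeighbourhood.solution v v∈ v-free λ u u∈ e → inside u u∈ e (member? σ u))
      where
      inside : ∀ u → u ∈ A → adj G v u ≡ true → u ∈ σ ⊎ u ∉ σ → Slim C u
      inside u u∈ e (inj₁ p) = σ⁻ p
      inside u u∈ e (inj₂ p) = ⊥-elim (true≢false (∈∖ (A ∩ adj G v) σ {u} (∧-true u∈ e) p) (none u))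

  -- Needed is 10 ≤ 8 + 2. Slim vertices receive nothing, and irreducibility provides a non-slim
  -- neighbour, which takes 2 if the other neighbour is slim and 1 otherwise.
  slim-balanced : ∀ v → Slim C v → Solution C ⊎ Balanced v
  slim-balanced v s = by-cases (slim-neighbourhood v (slim-vert s) (slim-free s))
    where
    conclude : 2 ≤ sent v → Balanced v
    conclude pays = linear (weight (κ v) ∷ received v ∷ deg G A v ∷ sent v ∷ [])
      ((2 , x₀ ≲ lit 5) ∷ (1 , x₁ ≲ lit 0) ∷ (4 , lit 2 ≲ x₂) ∷ (1 , lit 2 ≲ x₃) ∷ [])
      (2 ⊠ x₀ ⊞ x₁ ≲ 4 ⊠ x₂ ⊞ x₃)
      ( ≤-reflexive (cong weight (slim-free s))
      , ≤-reflexive (∑≡0 A (λ a → share a v) λ a _ →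
          trans (cong (λ t → portion (σ a) (adj G a v) t (has-slim a)) (σ⁺ s)) (portion-slim (σ a) (adj G a v) (has-slim a)))
      , ≤-reflexive (sym (slim-deg s)) , pays , tt)
    pays-one : ∀ x → adj G v x ≡ true → x ∉ σ → 1 ≤ share v x
    pays-one x e x∉ = ≤-trans (s≤s z≤n) (≤-reflexive (sym (portion-pays (has-slim v) (σ⁺ s) e x∉)))
    by-cases : Solution C ⊎ (∃ λ u → u ∈ A × adj G v u ≡ true × u ∉ σ) → Solution C ⊎ Balanced v
    by-cases (inj₁ sol) = inj₁ sol
    by-cases (inj₂ (y , y∈ , vy , y∉)) with neighbours₂ C (slim-deg s) y∈ vy
    ... | x , N = inj₂ (conclude (other (member? σ x)))
      where
      module N = Neighbours₂ N
      other : x ∈ σ ⊎ x ∉ σ → 2 ≤ sent v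
      other (inj₁ x∈) = ≤-trans
        (≤-reflexive (sym (trans (portion-pays (has-slim v) (σ⁺ s) vy y∉) (cong (λ h → 1 + 𝟙 h) (has-slim⁺ (σ⁻ x∈) N.adj₂)))))
        (term≤∑ A (share v) y∈)
      other (inj₂ x∉) = ≤-trans (+-mono-≤ (pays-one y vy y∉) (pays-one x N.adj₂ x∉)) (terms≤∑ A (share v) y∈ N.y∈ N.x≢y)

  -- At degree d ≥ 2, even 2 from every neighbour is harmless: 4 + 2d ≤ 4d.
  sealed-balanced : ∀ v → weight (κ v) ≤ 2 → 2 ≤ deg G A v → Balanced v
  sealed-balanced v w d = linear (weight (κ v) ∷ received v ∷ deg G A v ∷ sent v ∷ slim-count v ∷ [])
    ((2 , x₀ ≲ lit 2) ∷ (1 , x₁ ≲ 2 ⊠ x₄) ∷ (2 , x₄ ≲ x₂) ∷ (2 , lit 2 ≲ x₂) ∷ []) (2 ⊠ x₀ ⊞ x₁ ≲ 4 ⊠ x₂ ⊞ x₃)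
    (w , received≤ v , slim-count≤deg v , d , tt)

  -- At degree 2, 8 ≤ 8 leaves no room, and `tree-degree-two` excludes slim neighbours. At degree d
  -- ≥ 3, `tree-thread` limits every neighbour to 1, and 8 + d ≤ 4d.
  tree-balanced : ∀ v → v ∈ A → κ v ≡ tree → 2 ≤ deg G A v → Solution C ⊎ Balanced v
  tree-balanced v v∈ v-tree d = by-degree (deg G A v ≟ⁿ 2)
    where
    w≤4 : weight (κ v) ≤ 4
    w≤4 = ≤-reflexive (cong weight v-tree)
    by-degree : Dec (deg G A v ≡ 2) → Solution C ⊎ Balanced v
    by-degree (yes two) = conclude (either-all silent)
      where
      silent : ∀ a → Solution C ⊎ (share a v ≡ 0)
      silent a = by-cases (member? σ a) (member? (adj G a) v)
        where
        by-cases : a ∈ σ ⊎ a ∉ σ → adj G a v ≡ true ⊎ adj G a v ≡ false → Solution C ⊎ (share a v ≡ 0)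
        by-cases (inj₁ p) (inj₁ e) = inj₁ (tree-degree-two v a v∈ v-tree two (σ⁻ p) (adj-swap G e))
        by-cases (inj₂ p) _        = inj₂ (portion≡0 (σ a) (adj G a v) (σ v) (has-slim a) λ q _ → true≢false q p)
        by-cases (inj₁ _) (inj₂ e) = inj₂ (portion≡0 (σ a) (adj G a v) (σ v) (has-slim a) λ _ q → true≢false q e)
      conclude : Solution C ⊎ (∀ a → share a v ≡ 0) → Solution C ⊎ Balanced v
      conclude (inj₁ sol) = inj₁ sol
      conclude (inj₂ h) = inj₂ (linear (weight (κ v) ∷ received v ∷ deg G A v ∷ sent v ∷ [])
        ((2 , x₀ ≲ lit 4) ∷ (1 , x₁ ≲ lit 0) ∷ (4 , lit 2 ≲ x₂) ∷ []) (2 ⊠ x₀ ⊞ x₁ ≲ 4 ⊠ x₂ ⊞ x₃)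
        (w≤4 , ≤-reflexive (∑≡0 A (λ a → share a v) λ a _ → h a) , d , tt))
    by-degree (no ¬two) = conclude (either-all modest)
      where
      modest : ∀ a → Solution C ⊎ (share a v ≤ 𝟙 (σ a ∧ adj G a v))
      modest a = by-cases (member? σ a) (member? (adj G a) v) (member? has-slim a)
        where
        bound : (a ∈ σ → adj G a v ≡ true → a ∈ has-slim → ⊥) → share a v ≤ 𝟙 (σ a ∧ adj G a v)
        bound = portion≤1 (σ a) (adj G a v) (σ v) (has-slim a)
        by-cases : a ∈ σ ⊎ a ∉ σ → adj G a v ≡ true ⊎ adj G a v ≡ false → a ∈ has-slim ⊎ a ∉ has-slim →
          Solution C ⊎ (share a v ≤ 𝟙 (σ a ∧ adj G a v))
        by-cases (inj₂ p) _        _        = inj₂ (bound λ q _ _ → true≢false q p)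
        by-cases (inj₁ _) (inj₂ e) _        = inj₂ (bound λ _ q _ → true≢false q e)
        by-cases (inj₁ _) (inj₁ _) (inj₂ h) = inj₂ (bound λ _ _ q → true≢false q h)
        by-cases (inj₁ p) (inj₁ e) (inj₁ h) with has-slim⁻ h
        ... | b , t , ab = inj₁ (tree-thread v a b v∈ v-tree (σ⁻ p) e t ab)
      conclude : Solution C ⊎ (∀ a → share a v ≤ 𝟙 (σ a ∧ adj G a v)) → Solution C ⊎ Balanced v
      conclude (inj₁ sol) = inj₁ sol
      conclude (inj₂ h) = inj₂ (linear (weight (κ v) ∷ received v ∷ deg G A v ∷ sent v ∷ slim-count v ∷ [])
        ((2 , x₀ ≲ lit 4) ∷ (1 , x₁ ≲ x₄) ∷ (1 , x₄ ≲ x₂) ∷ (3 , lit 3 ≲ x₂) ∷ []) (2 ⊠ x₀ ⊞ x₁ ≲ 4 ⊠ x₂ ⊞ x₃)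
        (w≤4 , ∑-mono A (λ a _ → h a) , slim-count≤deg v , ≤∧≢⇒< d (¬two ∘ sym) , tt))

  -- Some neighbour is not slim, so at degree d ≥ 4 the bound 10 + 2(d - 1) ≤ 4d holds. At degree 3
  -- only 2 may be received: by `fork`, a neighbour sending 2 is the only slim one; otherwise at
  -- most two neighbours send 1 each.
  free-balanced : ∀ v → v ∈ A → κ v ≡ free → v ∉ σ → 2 ≤ deg G A v → Solution C ⊎ Balanced v
  free-balanced v v∈ v-free v∉σ d = by-neighbours (slim-neighbourhood v v∈ v-free)
    where
    w≤5 : weight (κ v) ≤ 5
    w≤5 = ≤-reflexive (cong weight v-free)
    3≤deg : 3 ≤ deg G A v
    3≤deg = ≤∧≢⇒< d λ two → true≢false (σ⁺ (slim v∈ v-free (sym two))) v∉σ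
    by-neighbours : Solution C ⊎ (∃ λ u → u ∈ A × adj G v u ≡ true × u ∉ σ) → Solution C ⊎ Balanced v
    by-neighbours (inj₁ sol) = inj₁ sol
    by-neighbours (inj₂ (u , u∈ , vu , u∉)) = by-degree (deg G A v ≟ⁿ 3)
      where
      count< : suc (slim-count v) ≤ deg G A v
      count< = slim-count<deg v u u∈ vu u∉
      by-degree : Dec (deg G A v ≡ 3) → Solution C ⊎ Balanced v
      by-degree (no ¬three) = inj₂ (linear (weight (κ v) ∷ received v ∷ deg G A v ∷ sent v ∷ slim-count v ∷ [])
        ((2 , x₀ ≲ lit 5) ∷ (1 , x₁ ≲ 2 ⊠ x₄) ∷ (2 , lit 1 ⊞ x₄ ≲ x₂) ∷ (2 , lit 4 ≲ x₂) ∷ [])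
        (2 ⊠ x₀ ⊞ x₁ ≲ 4 ⊠ x₂ ⊞ x₃)
        (w≤5 , received≤ v , count< , ≤∧≢⇒< 3≤deg (¬three ∘ sym) , tt))
      by-degree (yes three) = conclude (either-all modest)
        where
        Bound : Fin n → Set
        Bound a = share a v ≤ 𝟙 (σ a ∧ adj G a v)
        lonely : ∀ a → a ∈ σ → adj G a v ≡ true → a ∈ has-slim → Solution C ⊎ received v ≤ 2
        lonely a p e h with has-slim⁻ h
        ... | b , t , ab = total (either-all silent)
          where
          silent : ∀ x → Solution C ⊎ (x ≢ a → share x v ≡ 0)
          silent x = by-cases (x ≟ a) (member? σ x) (member? (adj G x) v)
            where
            by-cases : Dec (x ≡ a) → x ∈ σ ⊎ x ∉ σ → adj G x v ≡ true ⊎ adj G x v ≡ false →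
              Solution C ⊎ (x ≢ a → share x v ≡ 0)
            by-cases (yes eq) _        _        = inj₂ λ ne → ⊥-elim (ne eq)
            by-cases (no _)   (inj₂ q) _        = inj₂ λ _ → portion≡0 (σ x) (adj G x v) (σ v) (has-slim x) λ r _ → true≢false r q
            by-cases (no _)   (inj₁ _) (inj₂ f) = inj₂ λ _ → portion≡0 (σ x) (adj G x v) (σ v) (has-slim x) λ _ r → true≢false r f
            by-cases (no ne)  (inj₁ q) (inj₁ f) = inj₁ (fork v a b x v∈ v-free three (σ⁻ p) (adj-swap G e) t ab
              (σ⁻ q) (adj-swap G f) (ne ∘ sym))
          total : Solution C ⊎ (∀ x → x ≢ a → share x v ≡ 0) → Solution C ⊎ received v ≤ 2
          total (inj₁ sol) = inj₁ sol
          total (inj₂ z) = inj₂ (≤-trans (∑≤term A a (λ x → share x v) λ x _ → z x)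
            (≤-trans (portion≤2 (σ a) (adj G a v) (σ v) (has-slim a)) (*-monoʳ-≤ 2 (𝟙≤1 (σ a ∧ adj G a v)))))
        modest : ∀ a → (Solution C ⊎ received v ≤ 2) ⊎ Bound a
        modest a = by-cases (member? σ a) (member? (adj G a) v) (member? has-slim a)
          where
          bound : (a ∈ σ → adj G a v ≡ true → a ∈ has-slim → ⊥) → Bound a
          bound = portion≤1 (σ a) (adj G a v) (σ v) (has-slim a)
          by-cases : a ∈ σ ⊎ a ∉ σ → adj G a v ≡ true ⊎ adj G a v ≡ false → a ∈ has-slim ⊎ a ∉ has-slim →
            (Solution C ⊎ received v ≤ 2) ⊎ Bound a
          by-cases (inj₂ p) _        _        = inj₂ (bound λ q _ _ → true≢false q p)
          by-cases (inj₁ _) (inj₂ e) _        = inj₂ (bound λ _ q _ → true≢false q e)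
          by-cases (inj₁ _) (inj₁ _) (inj₂ h) = inj₂ (bound λ _ _ q → true≢false q h)
          by-cases (inj₁ p) (inj₁ e) (inj₁ h) = inj₁ (lonely a p e h)
        balanced : received v ≤ 2 → Balanced v
        balanced r = linear (weight (κ v) ∷ received v ∷ deg G A v ∷ sent v ∷ [])
          ((2 , x₀ ≲ lit 5) ∷ (1 , x₁ ≲ lit 2) ∷ (4 , lit 3 ≲ x₂) ∷ []) (2 ⊠ x₀ ⊞ x₁ ≲ 4 ⊠ x₂ ⊞ x₃)
          (w≤5 , r , 3≤deg , tt)
        conclude : (Solution C ⊎ received v ≤ 2) ⊎ (∀ a → Bound a) → Solution C ⊎ Balanced v
        conclude (inj₁ (inj₁ sol)) = inj₁ sol
        conclude (inj₁ (inj₂ r))   = inj₂ (balanced r)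
        conclude (inj₂ h) = inj₂ (balanced (≤-trans (∑-mono A λ a _ → h a)
          (≤-pred (≤-trans count< (≤-reflexive three)))))

  balance : (∀ v → v ∈ A → 2 ≤ deg G A v) → ∀ v → Solution C ⊎ (v ∈ A → Balanced v)
  balance d v = by-membership (member? A v)
    where
    by-slim : v ∈ A → κ v ≡ free → v ∈ σ ⊎ v ∉ σ → Solution C ⊎ Balanced v
    by-slim v∈ k (inj₁ p) = slim-balanced v (σ⁻ p)
    by-slim v∈ k (inj₂ p) = free-balanced v v∈ k p (d v v∈)
    by-kind : ∀ k → κ v ≡ k → v ∈ A → Solution C ⊎ Balanced v
    by-kind free    e v∈ = by-slim v∈ e (member? σ v)
    by-kind tree    e v∈ = tree-balanced v v∈ e (d v v∈)
    by-kind sealed₂ e v∈ = inj₂ (sealed-balanced v (≤-reflexive (cong weight e)) (d v v∈))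
    by-kind sealed₁ e v∈ = inj₂ (sealed-balanced v (≤-trans (≤-reflexive (cong weight e)) (s≤s z≤n)) (d v v∈))
    by-membership : v ∈ A ⊎ v ∉ A → Solution C ⊎ (v ∈ A → Balanced v)
    by-membership (inj₂ p) = inj₂ λ q → ⊥-elim (true≢false q p)
    by-membership (inj₁ p) with by-kind (κ v) refl p
    ... | inj₁ sol = inj₁ sol
    ... | inj₂ b   = inj₂ λ _ → b

  -- The transfers cancel in the sum over all vertices, leaving ρ(A) ≤ 0 against sparsity.
  overloaded : Inhabited A → (∀ v → v ∈ A → Balanced v) → ⊥
  overloaded i balanced = 1+n≰n {4 * ends G A} (linear
    (ends G A ∷ mass C A ∷ ∑ A received ∷ ∑ A sent ∷ [])
    ((2 , lit 1 ⊞ 2 ⊠ x₀ ≲ x₁) ∷ (1 , 2 ⊠ x₁ ⊞ x₂ ≲ 4 ⊠ x₀ ⊞ x₃) ∷ (1 , x₃ ≲ x₂) ∷ []) (lit 1 ⊞ 4 ⊠ x₀ ≲ 4 ⊠ x₀)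
    (sparse A (λ _ p → p) i , summed , ≤-reflexive (∑-swap A A share) , tt))
    where
    split : ∀ c (f g : Fin n → ℕ) → ∑ A (λ v → c * f v + g v) ≡ c * ∑ A f + ∑ A g
    split c f g = trans (∑-+ A (λ v → c * f v) g) (cong (_+ ∑ A g) (∑-* c A f))
    summed : 2 * mass C A + ∑ A received ≤ 4 * ends G A + ∑ A sent
    summed = subst₂ _≤_ (split 2 (λ v → weight (κ v)) received) (split 4 (deg G A) sent) (∑-mono A balanced)

  solution : Inhabited A → Solution C
  solution i = by-degrees (either-all low)
    where
    low : ∀ v → Solution C ⊎ (v ∈ A → 2 ≤ deg G A v)
    low v = by-cases (member? A v) (2 ≤? deg G A v)
      where
      by-cases : v ∈ A ⊎ v ∉ A → Dec (2 ≤ deg G A v) → Solution C ⊎ (v ∈ A → 2 ≤ deg G A v)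
      by-cases _        (yes d) = inj₂ λ _ → d
      by-cases (inj₂ p) (no _)  = inj₂ λ q → ⊥-elim (true≢false q p)
      by-cases (inj₁ p) (no ¬d) = inj₁ (LowDegree.solution v p (≤-pred (≰⇒> ¬d)))
    by-degrees : Solution C ⊎ (∀ v → v ∈ A → 2 ≤ deg G A v) → Solution C
    by-degrees (inj₁ sol) = sol
    by-degrees (inj₂ d) = by-balance (either-all (balance d))
      where
      by-balance : Solution C ⊎ (∀ v → v ∈ A → Balanced v) → Solution C
      by-balance (inj₁ sol) = sol
      by-balance (inj₂ b)   = ⊥-elim (overloaded i b)

-- Contracting a set of small potential

-- ρ(H) ≤ ρ(K) + c, where ρ(K) = mass C K − 2 · ends (graph C) K.
Below : Config n → ℕ → VSet n → VSet n → Set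
Below C c H K = mass C H + 2 * ends (graph C) K ≤ mass C K + 2 * ends (graph C) H + c

-- The adjacency of u and v after a vertex x has replaced a set: s and t tell whether u and v are x,
-- and p and q whether u and v have a neighbour in the set.
glue : (s t e p q : Bool) → Bool
glue true  true  e p q = false
glue true  false e p q = q
glue false true  e p q = p
glue false false e p q = e

glue-sym : ∀ s t {e e′} p q → e ≡ e′ → glue s t e p q ≡ glue t s e′ q p
glue-sym true  true  p q eq = refl
glue-sym true  false p q eq = refl
glue-sym false true  p q eq = refl
glue-sym false false p q eq = eq

glue-irrefl : ∀ s {e} p → e ≡ false → glue s s e p p ≡ false
glue-irrefl true  p eq = refl
glue-irrefl false p eq = eq

-- `x` survives as the contracted vertex, and `x′` makes the result smaller. `boundary` handles the
-- deficit of 1 left by `top`: there is none, or some outside vertex has a forest neighbour in `H`,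
-- or no chosen vertex of `H` has an outside neighbour.
module Contract {n : ℕ} (C : Config n) (sparse : Sparse C)
  (solve-smaller : ∀ (C′ : Config n) → card (verts C′) < card (verts C) → Sparse C′ → Solution C′)
  (H : VSet n) (H⊆A : H ⊆ verts C) (x x′ : Fin n) (x∈H : x ∈ H) (x′∈H : x′ ∈ H) (x≢x′ : x ≢ x′)
  (minimal : ∀ K → K ⊆ verts C → (∃ λ v → v ∈ verts C × v ∉ K) → 2 ≤ card K → Below C 0 H K)
  (top : Below C 1 H (verts C))
  (κ₀ : Fin n → Kind) (κ₀-demotes : ∀ v → Demotes (kind C v) (κ₀ v))
  (T : Solution (restrict C H κ₀))
  (boundary : Below C 0 H (verts C)
    ⊎ ((∃ λ y → y ∈ verts C ∖ H × ∃ λ h → h ∈ H ∖ chosen T × adj (graph C) y h ≡ true)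
    ⊎ (∀ y h → y ∈ verts C ∖ H → h ∈ chosen T → adj (graph C) y h ≡ true → ⊥)))
  where

  private
    A = verts C
    G = graph C
    κ = kind C
    I₀ = chosen T

  O A′ F₀ : VSet n
  O = A ∖ H
  A′ = O ⊕ x
  F₀ = H ∖ I₀

  hI hF : Fin n → ℕ
  hI = deg G I₀
  hF = deg G F₀

  O⊆A : O ⊆ A
  O⊆A v = ∈∖ˡ A H

  O-out : ∀ {v} → v ∈ O → v ∉ H
  O-out p = ∈∖ʳ A H p

  x∉O : x ∉ O
  x∉O = ∉-intro O λ p → true≢false x∈H (O-out p)

  O≢x : ∀ {v} → v ∈ O → v ≢ x
  O≢x p refl = true≢false p x∉O

  I₀⊆H : I₀ ⊆ H
  I₀⊆H = chosen-verts T

  degH : ∀ y → deg G H y ≡ hI y + hF y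
  degH y = trans (∑-ext H (I₀ ∪ F₀) (λ u → 𝟙 (adj G y u)) (≐-intro H (I₀ ∪ F₀) there back))
    (∑-∪ I₀ F₀ (λ u → 𝟙 (adj G y u)) λ u p → ∉-intro F₀ λ q → true≢false p (∈∖ʳ H I₀ q))
    where
    there : H ⊆ I₀ ∪ F₀
    there v p with member? I₀ v
    ... | inj₁ q = ∈∪ˡ I₀ F₀ q
    ... | inj₂ q = ∈∪ʳ I₀ F₀ (∈∖ H I₀ p q)
    back : I₀ ∪ F₀ ⊆ H
    back v p with ∈∪⁻ I₀ F₀ {v} p
    ... | inj₁ q = I₀⊆H v q
    ... | inj₂ q = ∈∖ˡ H I₀ q

  module Outer (B : VSet n) (B⊆O : B ⊆ O) where

    τ μ : ℕ
    τ = ∑ B hI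
    μ = ∑ B hF

    disjoint : ∀ v → v ∈ H → v ∉ B
    disjoint v p = ∉-intro B λ q → true≢false p (O-out (B⊆O v q))

    H∪B⊆A : H ∪ B ⊆ A
    H∪B⊆A v p with ∈∪⁻ H B {v} p
    ... | inj₁ q = H⊆A v q
    ... | inj₂ q = O⊆A v (B⊆O v q)

    big : 2 ≤ card (H ∪ B)
    big = terms≤∑ (H ∪ B) (λ _ → 1) (∈∪ˡ H B x∈H) (∈∪ˡ H B x′∈H) x≢x′

    crossing : ∑ H (deg G B) ≡ τ + μ
    crossing = trans (cross-sym G B H) (trans (∑-cong B λ y _ → degH y) (∑-+ B hI hF))

    -- ρ(H ∪ B) = ρ(H) + ρ(B) - 4(τ + μ), so an upper bound on ρ(H) relative to ρ(H ∪ B) is a lower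
    -- bound on ρ(B) by the edges leaving `B` for `H`.
    expand : ∀ c → Below C c H (H ∪ B) → 2 * ends G B + 4 * τ + 4 * μ ≤ mass C B + c
    expand c h = linear
      (mass C H ∷ ends G H ∷ mass C B ∷ ends G B ∷ τ ∷ μ ∷ c ∷ [])
      ((1 , x₀ ⊞ 2 ⊠ (x₁ ⊞ x₃ ⊞ 2 ⊠ (x₄ ⊞ x₅)) ≲ (x₀ ⊞ x₂) ⊞ 2 ⊠ x₁ ⊞ x₆) ∷ [])
      (2 ⊠ x₃ ⊞ 4 ⊠ x₄ ⊞ 4 ⊠ x₅ ≲ x₂ ⊞ x₆)
      ( subst₂ (λ e w → mass C H + 2 * e ≤ w + 2 * ends G H + c)
          (trans (ends-∪ G H B disjoint) (cong (λ s → ends G H + ends G B + 2 * s) crossing))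
          (∑-∪ H B (λ v → weight (κ v)) disjoint) h
      , tt)

    whole : A ⊆ H ∪ B → ∀ c → Below C c H A → Below C c H (H ∪ B)
    whole A⊆ c = subst₂ (λ e w → mass C H + 2 * e ≤ w + 2 * ends G H + c)
      (ends-ext G A (H ∪ B) same) (∑-ext A (H ∪ B) (λ v → weight (κ v)) same)
      where
      same : ∀ v → A v ≡ (H ∪ B) v
      same = ≐-intro A (H ∪ B) A⊆ H∪B⊆A

    strict : (∃ λ v → v ∈ A × v ∉ H ∪ B) → Below C 0 H (H ∪ B)
    strict p = minimal (H ∪ B) H∪B⊆A p big

    loose : 2 * ends G B + 4 * τ + 4 * μ ≤ mass C B + 1
    loose = by-cases (⊆-or-escapes A (H ∪ B))
      where
      by-cases : A ⊆ H ∪ B ⊎ (∃ λ v → v ∈ A × v ∉ H ∪ B) → 2 * ends G B + 4 * τ + 4 * μ ≤ mass C B + 1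
      by-cases (inj₁ A⊆) = expand 1 (whole A⊆ 1 top)
      by-cases (inj₂ p)  = ≤-trans (expand 0 (strict p)) (+-monoʳ-≤ (mass C B) z≤n)

    -- Minimality loses nothing unless `H ∪ B` is everything. In that case all outside vertices lie
    -- in `B`, so the edge supplied by `boundary` counts in `μ`, or `τ` would have to vanish.
    tight : 1 ≤ τ → 2 * ends G B + 4 * τ + 4 * μ ≤ mass C B + 0 ⊎ 1 ≤ μ
    tight τ≥1 = by-cases (⊆-or-escapes A (H ∪ B)) boundary
      where
      by-cases : A ⊆ H ∪ B ⊎ (∃ λ v → v ∈ A × v ∉ H ∪ B) → _ →
        2 * ends G B + 4 * τ + 4 * μ ≤ mass C B + 0 ⊎ 1 ≤ μ
      by-cases (inj₂ p)  _        = inj₁ (expand 0 (strict p))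
      by-cases (inj₁ A⊆) (inj₁ h) = inj₁ (expand 0 (whole A⊆ 0 h))
      by-cases (inj₁ A⊆) (inj₂ (inj₁ (y , y∈ , h , h∈ , e))) =
        inj₂ (≤-trans (1≤deg G F₀ h∈ e) (term≤∑ B hF (in-B (∈∪⁻ H B {y} (A⊆ y (O⊆A y y∈))))))
        where
        in-B : y ∈ H ⊎ y ∈ B → y ∈ B
        in-B (inj₁ p) = ⊥-elim (true≢false p (O-out y∈))
        in-B (inj₂ p) = p
      by-cases (inj₁ A⊆) (inj₂ (inj₂ none)) with ∑-positive B hI τ≥1
      ... | y , y∈ , p with ∑-positive I₀ (λ u → 𝟙 (adj G y u)) p
      ...   | h , h∈ , q = ⊥-elim (none y h (B⊆O y y∈) h∈ (1≤𝟙 q))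

  few-neighbours : ∀ {y} → y ∈ O → 4 * deg G H y ≤ weight (κ y) + 1
  few-neighbours {y} p = linear (deg G H y ∷ weight (κ y) ∷ hI y ∷ hF y ∷ ends G ⁅ y ⁆ ∷ [])
    ((1 , 2 ⊠ x₄ ⊞ 4 ⊠ x₂ ⊞ 4 ⊠ x₃ ≲ x₁ ⊞ lit 1) ∷ (4 , x₀ ≲ x₂ ⊞ x₃) ∷ []) (4 ⊠ x₀ ≲ x₁ ⊞ lit 1)
    ( subst₂ (λ s w → s ≤ w + 1)
        (cong₂ (λ a b → 2 * ends G ⁅ y ⁆ + 4 * a + 4 * b) (∑-⁅⁆ y hI) (∑-⁅⁆ y hF)) (∑-⁅⁆ y (λ v → weight (κ v)))
        (Outer.loose ⁅ y ⁆ λ v q → subst (_∈ O) (sym (∈⁅⁆⁻ y q)) p)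
    , ≤-reflexive (degH y) , tt)

  degH≤1 : ∀ {y} → y ∈ O → deg G H y ≤ 1
  degH≤1 {y} p = small (deg G H y) (≤-trans (few-neighbours p) (+-monoˡ-≤ 1 (weight≤5 (κ y))))
    where
    small : ∀ d → 4 * d ≤ 6 → d ≤ 1
    small zero          _ = z≤n
    small (suc zero)    _ = ≤-refl
    small (suc (suc d)) h = ⊥-elim (1+n≰n {6} (linear (d ∷ []) ((1 , 4 ⊠ (lit 2 ⊞ x₀) ≲ lit 6) ∷ []) (lit 7 ≲ lit 6) (h , tt)))

  -- Only edges to the forest part of `H` survive at `x`; those to chosen vertices are replaced by
  -- seals in `κ₁`.
  G′ : SimpleGraph n
  G′ = record
    { adj    = λ u v → glue (⁅ x ⁆ u) (⁅ x ⁆ v) (adj G u v) (positive (hF u)) (positive (hF v))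
    ; sym    = λ u v → glue-sym (⁅ x ⁆ u) (⁅ x ⁆ v) (positive (hF u)) (positive (hF v)) (adj-sym G u v)
    ; irrefl = λ v → glue-irrefl (⁅ x ⁆ v) (positive (hF v)) (adj-irrefl G v)
    }

  κ₁ κ′ : Fin n → Kind
  κ₁ = relabel (positive ∘ hI) seal κ
  κ′ = relabel ⁅ x ⁆ (λ _ → sealed₂) κ₁

  C′ : Config n
  C′ = record { verts = A′ ; graph = G′ ; kind = κ′ }

  adj′-old : ∀ {u v} → u ≢ x → v ≢ x → adj G u v ≡ adj G′ u v
  adj′-old {u} {v} p q = sym (cong₂ (λ s t → glue s t (adj G u v) (positive (hF u)) (positive (hF v))) (∉⁅⁆ x p) (∉⁅⁆ x q))

  adj′-x : ∀ {v} → v ≢ x → adj G′ x v ≡ positive (hF v)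
  adj′-x {v} q = cong₂ (λ s t → glue s t (adj G x v) (positive (hF x)) (positive (hF v))) (∈⁅⁆ x) (∉⁅⁆ x q)

  κ′-x : κ′ x ≡ sealed₂
  κ′-x = relabel-∈ ⁅ x ⁆ (λ _ → sealed₂) κ₁ (∈⁅⁆ x)

  κ′-old : ∀ {v} → v ≢ x → κ′ v ≡ κ₁ v
  κ′-old p = relabel-∉ ⁅ x ⁆ (λ _ → sealed₂) κ₁ (∉⁅⁆ x p)

  κ′-sealed : ∀ {v} → v ≢ x → 1 ≤ hI v → Sealed (κ′ v)
  κ′-sealed {v} p q = subst Sealed (sym (trans (κ′-old p) (relabel-∈ (positive ∘ hI) seal κ {v} (positive⁺ q)))) (seal-sealed (κ v))

  κ′-demotes : ∀ {v} → v ≢ x → Demotes (κ v) (κ′ v)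
  κ′-demotes {v} p = subst (Demotes (κ v)) (sym (κ′-old p)) (relabel-demotes (positive ∘ hI) κ seal-demotes v)

  module Outer′ (B : VSet n) (B⊆O : B ⊆ O) where
    open Outer B B⊆O public

    ends′ : ends G′ B ≡ ends G B
    ends′ = sym (ends-agree G G′ B λ u v p q → adj′-old (O≢x (B⊆O u p)) (O≢x (B⊆O v q)))

    mass′ : mass C B ≤ mass C′ B + 3 * τ
    mass′ = ≤-trans (relabel-cost (positive ∘ hI) κ 3 seal-cost B) (+-mono-≤
      (≤-reflexive (∑-cong B λ v p → cong weight (sym (κ′-old (O≢x (B⊆O v p))))))
      (*-monoʳ-≤ 3 (∑-mono B λ v _ → 𝟙positive≤ (hI v))))

    deg-x : deg G′ B x ≡ ∑ B (λ v → 𝟙 (positive (hF v)))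
    deg-x = ∑-cong B λ v p → cong 𝟙 (adj′-x (O≢x (B⊆O v p)))

    deg-x≤ : deg G′ B x ≤ μ
    deg-x≤ = ≤-trans (≤-reflexive deg-x) (∑-mono B λ v _ → 𝟙positive≤ (hF v))

  -- With `x` in `K`, the bound is 2 - 1 + 4(τ + μ) - 3τ - 4μ = 1 + τ. Without it, for τ ≥ 1, it is
  -- τ + 4μ minus the deficit, and `tight` says that the deficit is 0 or μ ≥ 1. For τ = 0 nothing in
  -- `K` has been relabelled.
  C′-sparse : Sparse C′
  C′-sparse K K⊆ i = by-cases (member? K x)
    where
    by-cases : x ∈ K ⊎ x ∉ K → Potential≥ C′ 1 K
    by-cases (inj₁ x∈) = subst₂ (λ e w → 1 + 2 * e ≤ w)
      (sym (trans (ends-⊖ G′ K x∈) (cong (_+ 2 * deg G′ B x) ends′)))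
      (sym (trans (∑-⊖ K (λ v → weight (κ′ v)) x∈) (cong (λ k → weight k + mass C′ B) κ′-x)))
      (linear (ends G B ∷ deg G′ B x ∷ mass C′ B ∷ mass C B ∷ τ ∷ μ ∷ [])
        ((1 , 2 ⊠ x₀ ⊞ 4 ⊠ x₄ ⊞ 4 ⊠ x₅ ≲ x₃ ⊞ lit 1) ∷ (1 , x₃ ≲ x₂ ⊞ 3 ⊠ x₄) ∷ (4 , x₁ ≲ x₅) ∷ [])
        (lit 1 ⊞ 2 ⊠ (x₀ ⊞ 2 ⊠ x₁) ≲ lit 2 ⊞ x₂)
        (loose , mass′ , deg-x≤ , tt))
      where
      B : VSet n
      B = K ⊖ x
      B⊆O : B ⊆ O
      B⊆O v p with ∈∪⁻ O ⁅ x ⁆ {v} (K⊆ v (∈⊖ˡ K x p))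
      ... | inj₁ q = q
      ... | inj₂ q = ⊥-elim (∈⊖ʳ K x p (∈⁅⁆⁻ x q))
      open Outer′ B B⊆O
    by-cases (inj₂ x∉) = subst (λ e → 1 + 2 * e ≤ mass C′ K) (sym ends′) (by-τ (1 ≤? τ))
      where
      K⊆O : K ⊆ O
      K⊆O v p with ∈∪⁻ O ⁅ x ⁆ {v} (K⊆ v p)
      ... | inj₁ q = q
      ... | inj₂ q = ⊥-elim (true≢false (subst (_∈ K) (∈⁅⁆⁻ x q) p) x∉)
      open Outer′ K K⊆O
      finish : 2 * ends G K + 4 * τ + 4 * μ ≤ mass C K + 0 ⊎ 1 ≤ μ → 1 ≤ τ → 1 + 2 * ends G K ≤ mass C′ K
      finish (inj₁ h) τ≥1 = linear (ends G K ∷ mass C K ∷ mass C′ K ∷ τ ∷ μ ∷ [])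
        ((1 , 2 ⊠ x₀ ⊞ 4 ⊠ x₃ ⊞ 4 ⊠ x₄ ≲ x₁ ⊞ lit 0) ∷ (1 , x₁ ≲ x₂ ⊞ 3 ⊠ x₃) ∷ (1 , lit 1 ≲ x₃) ∷ [])
        (lit 1 ⊞ 2 ⊠ x₀ ≲ x₂) (h , mass′ , τ≥1 , tt)
      finish (inj₂ μ≥1) τ≥1 = linear (ends G K ∷ mass C K ∷ mass C′ K ∷ τ ∷ μ ∷ [])
        ((1 , 2 ⊠ x₀ ⊞ 4 ⊠ x₃ ⊞ 4 ⊠ x₄ ≲ x₁ ⊞ lit 1) ∷ (1 , x₁ ≲ x₂ ⊞ 3 ⊠ x₃) ∷ (4 , lit 1 ≲ x₄) ∷ [])
        (lit 1 ⊞ 2 ⊠ x₀ ≲ x₂) (loose , mass′ , μ≥1 , tt)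
      by-τ : Dec (1 ≤ τ) → 1 + 2 * ends G K ≤ mass C′ K
      by-τ (yes τ≥1) = finish (tight τ≥1) τ≥1
      by-τ (no τ≱1) = linear (ends G K ∷ mass C K ∷ mass C′ K ∷ τ ∷ [])
        ((1 , lit 1 ⊞ 2 ⊠ x₀ ≲ x₁) ∷ (1 , x₁ ≲ x₂ ⊞ 3 ⊠ x₃) ∷ (3 , x₃ ≲ lit 0) ∷ []) (lit 1 ⊞ 2 ⊠ x₀ ≲ x₂)
        (sparse K (λ v p → O⊆A v (K⊆O v p)) i , mass′ , ≤-pred (≰⇒> τ≱1) , tt)

  abstract
    S : Solution C′
    S = solve-smaller C′ (card-< A′ A (⊕-⊆ O A O⊆A (H⊆A x x∈H)) (H⊆A x′ x′∈H)
      (∉⊕ O (∉-intro O λ p → true≢false x′∈H (O-out p)) (x≢x′ ∘ sym))) C′-sparse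

  J : VSet n
  J = chosen S

  J≢x : ∀ {u} → u ∈ J → u ≢ x
  J≢x p refl = sealed≢free (subst Sealed (sym κ′-x) is-sealed₂) (chosen-free S x p)

  J⊆O : J ⊆ O
  J⊆O u p with ∈∪⁻ O ⁅ x ⁆ {u} (chosen-verts S u p)
  ... | inj₁ q = q
  ... | inj₂ q = ⊥-elim (J≢x p (∈⁅⁆⁻ x q))

  O⊆A′ : ∀ {v} → v ∈ O → v ∈ A′
  O⊆A′ p = ∈∪ˡ O ⁅ x ⁆ p

  old′ : ∀ {u v} → u ∈ O → v ∈ O → adj G u v ≡ true → adj G′ u v ≡ true
  old′ p q e = trans (sym (adj′-old (O≢x p) (O≢x q))) e

  sealed-off : ∀ {y h} → y ∈ O → h ∈ I₀ → adj G y h ≡ true → Sealed (κ′ y)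
  sealed-off p q e = κ′-sealed (O≢x p) (1≤deg G I₀ q e)

  -- An outside neighbour of a chosen vertex of `H` is sealed, hence not chosen; one of a forest
  -- vertex of `H` is adjacent to the sealed `x`.
  H-J-apart : ∀ {h u} → h ∈ H → u ∈ J → adj G h u ≡ true → ⊥
  H-J-apart {h} {u} p q e = by-cases (member? I₀ h)
    where
    by-cases : h ∈ I₀ ⊎ h ∉ I₀ → ⊥
    by-cases (inj₁ r) = sealed≢free (sealed-off (J⊆O u q) r (adj-swap G e)) (chosen-free S u q)
    by-cases (inj₂ r) = sealed S x u (x∈⊕ O x) (subst Sealed (sym κ′-x) is-sealed₂) q
      (trans (adj′-x (J≢x q)) (positive⁺ (1≤deg G F₀ (∈∖ H I₀ p r) (adj-swap G e))))

  -- One edge into `H` forces weight at least 4 - 1 = 3 by `few-neighbours`.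
  unsealed-boundary : ∀ {y h} → y ∈ O → h ∈ H → adj G y h ≡ true → Sealed (κ y) → ⊥
  unsealed-boundary {y} p q e s = sealed-light s (linear (deg G H y ∷ weight (κ y) ∷ [])
    ((1 , 4 ⊠ x₀ ≲ x₁ ⊞ lit 1) ∷ (4 , lit 1 ≲ x₀) ∷ []) (lit 3 ≲ x₁) (few-neighbours p , 1≤deg G H q e , tt))

  Side : Fin n → Set
  Side v = v ∈ H ⊎ v ∈ O

  side : ∀ {v} → v ∈ A → Side v
  side {v} p with member? H v
  ... | inj₁ q = inj₁ q
  ... | inj₂ q = inj₂ (∈∖ A H p q)

  cases : ∀ {v} → v ∈ I₀ ∪ J → v ∈ I₀ ⊎ v ∈ J
  cases {v} = ∈∪⁻ I₀ J {v}

  frees : ∀ v → v ∈ I₀ ⊎ v ∈ J → κ v ≡ free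
  frees v (inj₁ p) = reflects-free (κ₀-demotes v) (chosen-free T v p)
  frees v (inj₂ p) = reflects-free (κ′-demotes (J≢x p)) (chosen-free S v p)

  vertss : ∀ v → v ∈ I₀ ⊎ v ∈ J → v ∈ A
  vertss v (inj₁ p) = H⊆A v (I₀⊆H v p)
  vertss v (inj₂ p) = O⊆A v (J⊆O v p)

  independents : ∀ u v → u ∈ I₀ ⊎ u ∈ J → v ∈ I₀ ⊎ v ∈ J → adj G u v ≡ true → ⊥
  independents u v (inj₁ p) (inj₁ q) e = independent T u v p q e
  independents u v (inj₁ p) (inj₂ q) e = H-J-apart (I₀⊆H u p) q e
  independents u v (inj₂ p) (inj₁ q) e = H-J-apart (I₀⊆H v q) p (adj-swap G e)
  independents u v (inj₂ p) (inj₂ q) e = independent S u v p q (old′ (J⊆O u p) (J⊆O v q) e)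

  -- An outside `w` cannot see both `I₀` and `J`, because seeing `I₀` seals it; and it has at most
  -- one neighbour in `H`.
  uniques : ∀ w u v → Side w → u ∈ I₀ ⊎ u ∈ J → v ∈ I₀ ⊎ v ∈ J → adj G w u ≡ true → adj G w v ≡ true → u ≡ v
  uniques w u v (inj₁ r) (inj₁ p) (inj₁ q) e f = unique T w u v r p q e f
  uniques w u v (inj₁ r) (inj₂ p) _        e f = ⊥-elim (H-J-apart r p e)
  uniques w u v (inj₁ r) (inj₁ _) (inj₂ q) e f = ⊥-elim (H-J-apart r q f)
  uniques w u v (inj₂ r) (inj₂ p) (inj₂ q) e f =
    unique S w u v (O⊆A′ r) p q (old′ r (J⊆O u p) e) (old′ r (J⊆O v q) f)
  uniques w u v (inj₂ r) (inj₁ p) (inj₂ q) e f =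
    ⊥-elim (sealed S w v (O⊆A′ r) (sealed-off r p e) q (old′ r (J⊆O v q) f))
  uniques w u v (inj₂ r) (inj₂ p) (inj₁ q) e f =
    ⊥-elim (sealed S w u (O⊆A′ r) (sealed-off r q f) p (old′ r (J⊆O u p) e))
  uniques w u v (inj₂ r) (inj₁ p) (inj₁ q) e f with u ≟ v
  ... | yes eq = eq
  ... | no ne  = ⊥-elim (1+n≰n (≤-trans (2≤deg G H (I₀⊆H u p) (I₀⊆H v q) ne e f) (degH≤1 r)))

  sealeds : ∀ w u → Side w → Sealed (κ w) → u ∈ I₀ ⊎ u ∈ J → adj G w u ≡ true → ⊥
  sealeds w u (inj₁ r) s (inj₁ p) e = sealed T w u r (preserves-sealed (κ₀-demotes w) s) p e
  sealeds w u (inj₁ r) s (inj₂ p) e = H-J-apart r p e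
  sealeds w u (inj₂ r) s (inj₁ p) e = unsealed-boundary r (I₀⊆H u p) e s
  sealeds w u (inj₂ r) s (inj₂ p) e =
    sealed S w u (O⊆A′ r) (preserves-sealed (κ′-demotes (O≢x r)) s) p (old′ r (J⊆O u p) e)

  -- The part in `H` is a forest with at most `card K₀ − 1` edges. The part outside together with
  -- `x` has at most `card B` edges in `G′`, and these account for all crossing edges since an
  -- outside vertex has at most one neighbour in `H`.
  glued-acyclic : Acyclic G (A ∖ (I₀ ∪ J))
  glued-acyclic K sub i = by-cases (inhabited? K₀)
    where
    K₀ B : VSet n
    K₀ = K ∩ H
    B = K ∖ H
    off : ∀ {v} → v ∈ I₀ ∪ J → v ∈ K → ⊥
    off {v} p q = true≢false p (∈∖ʳ A (I₀ ∪ J) (sub v q))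
    B⊆O : B ⊆ O
    B⊆O v p = ∈∖ A H (∈∖ˡ A (I₀ ∪ J) (sub v (∈∖ˡ K H p))) (∈∖ʳ K H p)
    K₀⊆F₀ : K₀ ⊆ F₀
    K₀⊆F₀ v p = ∈∖ H I₀ (∧-trueʳ (K v) p) (∉-intro I₀ λ q → off (∈∪ˡ I₀ J q) (∧-trueˡ (K v) p))
    J-avoids : ∀ {v} → v ∈ K → v ∉ J
    J-avoids {v} p = ∉-intro J λ q → off (∈∪ʳ I₀ J q) p
    same : ∀ v → K v ≡ (K₀ ∪ B) v
    same = ≐-intro K (K₀ ∪ B) there back
      where
      there : K ⊆ K₀ ∪ B
      there v p with member? H v
      ... | inj₁ q = ∈∪ˡ K₀ B (∧-true p q)
      ... | inj₂ q = ∈∪ʳ K₀ B (∈∖ K H p q)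
      back : K₀ ∪ B ⊆ K
      back v p with ∈∪⁻ K₀ B {v} p
      ... | inj₁ q = ∧-trueˡ (K v) q
      ... | inj₂ q = ∈∖ˡ K H q
    disjoint : ∀ v → v ∈ K₀ → v ∉ B
    disjoint v p = ∉-intro B λ q → true≢false (∧-trueʳ (K v) p) (∈∖ʳ K H q)
    open Outer′ B B⊆O using (deg-x; ends′)
    x∉B : x ∉ B
    x∉B = ∉-intro B λ p → true≢false (B⊆O x p) x∉O
    crossing : ∑ K₀ (deg G B) ≤ deg G′ B x
    crossing = ≤-trans (≤-reflexive (cross-sym G B K₀)) (≤-trans (∑-mono B bound) (≤-reflexive (sym deg-x)))
      where
      bound : ∀ y → y ∈ B → deg G K₀ y ≤ 𝟙 (positive (hF y))
      bound y p = ≤-trans (∑-⊆ K₀ F₀ (λ u → 𝟙 (adj G y u)) K₀⊆F₀) (≤𝟙positive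
        (≤-trans (∑-⊆ F₀ H (λ u → 𝟙 (adj G y u)) λ _ → ∈∖ˡ H I₀) (degH≤1 (B⊆O y p))))
    outer : 2 + (ends G B + 2 * deg G′ B x) ≤ 2 * (card B + 1)
    outer = subst₂ (λ e c → 2 + e ≤ 2 * c)
      (trans (ends-⊕ G′ B x∉B) (cong (_+ 2 * deg G′ B x) ends′)) (∑-⊕ B (λ _ → 1) x∉B)
      (acyclic S (B ⊕ x) inside (x , x∈⊕ B x))
      where
      inside : B ⊕ x ⊆ A′ ∖ J
      inside = ⊕-⊆ B (A′ ∖ J)
        (λ v p → ∈∖ A′ J (O⊆A′ (B⊆O v p)) (J-avoids (∈∖ˡ K H p)))
        (∈∖ A′ J (x∈⊕ O x) (∉-intro J λ p → J≢x p refl))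
    by-cases : Inhabited K₀ ⊎ (∀ v → v ∉ K₀) → Treelike G K
    by-cases (inj₁ j) = subst₂ (λ e c → 2 + e ≤ 2 * c)
      (sym (trans (ends-ext G K (K₀ ∪ B) same) (ends-∪ G K₀ B disjoint)))
      (sym (trans (∑-ext K (K₀ ∪ B) (λ _ → 1) same) (∑-∪ K₀ B (λ _ → 1) disjoint)))
      (linear (ends G K₀ ∷ ends G B ∷ ∑ K₀ (deg G B) ∷ card K₀ ∷ card B ∷ deg G′ B x ∷ [])
        ((1 , lit 2 ⊞ x₀ ≲ 2 ⊠ x₃) ∷ (1 , lit 2 ⊞ (x₁ ⊞ 2 ⊠ x₅) ≲ 2 ⊠ (x₄ ⊞ lit 1)) ∷ (2 , x₂ ≲ x₅) ∷ [])
        (lit 2 ⊞ (x₀ ⊞ x₁ ⊞ 2 ⊠ x₂) ≲ 2 ⊠ (x₃ ⊞ x₄))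
        (acyclic T K₀ K₀⊆F₀ j , outer , crossing , tt))
    by-cases (inj₂ none) = subst (λ e → 2 + e ≤ 2 * card K) (sym (ends-agree G G′ K λ u v p q →
        adj′-old (O≢x (K⊆O u p)) (O≢x (K⊆O v q))))
      (acyclic S K (λ v p → ∈∖ A′ J (O⊆A′ (K⊆O v p)) (J-avoids p)) i)
      where
      K⊆O : K ⊆ O
      K⊆O v p = B⊆O v (∈∖ K H p (∉-intro H λ q → true≢false (∧-true p q) (none v)))

  solution : Solution C
  solution = record
    { chosen       = I₀ ∪ J
    ; chosen-verts = λ v p → vertss v (cases p)
    ; chosen-free  = λ v p → frees v (cases p)
    ; independent  = λ u v p q → independents u v (cases p) (cases q)
    ; unique       = λ w u v r p q → uniques w u v (side r) (cases p) (cases q)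
    ; sealed       = λ w u r s p → sealeds w u (side r) s (cases p)
    ; acyclic      = glued-acyclic
    }

-- Searching the vertex sets

module Search (P : VSet n → Set) (P-resp : ∀ K L → (∀ v → K v ≡ L v) → P K → P L) (P? : ∀ K → Dec (P K)) where

  -- A set returns from its bit vector only up to pointwise equality, which `P-resp` absorbs.
  any-set? : Dec (∃ P)
  any-set? with anySubset? (λ s → P? (Vec.lookup s))
  ... | yes (s , p) = yes (Vec.lookup s , p)
  ... | no ¬p = no λ { (K , p) → ¬p (Vec.tabulate K , P-resp K (Vec.lookup (Vec.tabulate K)) (λ v → sym (lookup∘tabulate K v)) p) }

argmin : (P : VSet n → Set) → (∀ K L → (∀ v → K v ≡ L v) → P K → P L) → (∀ K → Dec (P K)) →
  (f : VSet n → ℕ) → (∀ K L → (∀ v → K v ≡ L v) → f K ≡ f L) →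
  ∃ P → ∃ λ H → P H × (∀ K → P K → f H ≤ f K)
argmin {n} P P-resp P? f f-resp (H , p) = go (f H) H p ≤-refl
  where
  go : ∀ k H → P H → f H ≤ k → ∃ λ H → P H × (∀ K → P K → f H ≤ f K)
  go k H p b = improve k b any-set?
    where
    open Search (λ K → P K × f K < f H) (λ K L e (q , r) → P-resp K L e q , subst (_< f H) (f-resp K L e) r)
      (λ K → P? K ×-dec (f K <? f H))
    improve : ∀ k → f H ≤ k → Dec (∃ λ K → P K × f K < f H) → ∃ λ H → P H × (∀ K → P K → f H ≤ f K)
    improve k       b (no ¬better) = H , p , λ K q → ≮⇒≥ λ r → ¬better (K , q , r)
    improve zero    b (yes (K , q , r)) = ⊥-elim (1+n≰n (≤-trans r (≤-trans b z≤n)))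
    improve (suc k) b (yes (K , q , r)) = go k K q (≤-pred (≤-trans r b))

-- The induction step: contraction or discharging

module Step {n : ℕ} (C : Config n) (sparse : Sparse C)
  (solve-smaller : ∀ (C′ : Config n) → card (verts C′) < card (verts C) → Sparse C′ → Solution C′)
  (inhabited : Inhabited (verts C)) where

  private
    A = verts C
    G = graph C
    κ = kind C

  Proper : VSet n → Set
  Proper K = K ⊆ A × (∃ λ v → v ∈ A × v ∉ K) × 2 ≤ card K

  Proper-resp : ∀ K L → (∀ v → K v ≡ L v) → Proper K → Proper L
  Proper-resp K L e (sub , (v , v∈ , v∉) , big) =
    (λ u p → sub u (trans (e u) p)) , (v , v∈ , trans (sym (e v)) v∉) , subst (2 ≤_) (∑-ext K L (λ _ → 1) e) big

  Proper? : ∀ K → Dec (Proper K)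
  Proper? K with ⊆-or-escapes K A | ⊆-or-escapes A K | 2 ≤? card K
  ... | inj₁ sub           | inj₂ out | yes big = yes (sub , out , big)
  ... | inj₂ (v , v∈ , v∉) | _        | _       = no λ (sub , _) → true≢false (sub v v∈) v∉
  ... | inj₁ _             | inj₁ sub | _       = no λ (_ , (v , v∈ , v∉) , _) → true≢false (sub v v∈) v∉
  ... | inj₁ _             | inj₂ _   | no ¬big = no λ (_ , _ , big) → ¬big big

  -- Truncated subtraction is exact on proper sets by sparsity; see `ρ-sound`.
  ρ : VSet n → ℕ
  ρ K = mass C K ∸ 2 * ends G K

  ρ-resp : ∀ K L → (∀ v → K v ≡ L v) → ρ K ≡ ρ L
  ρ-resp K L e = cong₂ (λ w s → w ∸ 2 * s) (∑-ext K L (λ v → weight (κ v)) e) (ends-ext G K L e)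

  inhabited-by-card : ∀ (K : VSet n) → 2 ≤ card K → Inhabited K
  inhabited-by-card K big with ∑-positive K (λ _ → 1) (≤-trans (s≤s z≤n) big)
  ... | v , p , _ = v , p

  ρ-sound : ∀ K → Proper K → ρ K + 2 * ends G K ≡ mass C K
  ρ-sound K (sub , _ , big) = m∸n+n≡m (≤-trans (n≤1+n _) (sparse K sub (inhabited-by-card K big)))

  below : ∀ H K → Proper H → Proper K → ρ H ≤ ρ K → Below C 0 H K
  below H K p q le = linear (mass C H ∷ ends G H ∷ mass C K ∷ ends G K ∷ ρ H ∷ ρ K ∷ [])
    ((1 , x₀ ≲ x₄ ⊞ 2 ⊠ x₁) ∷ (1 , x₅ ⊞ 2 ⊠ x₃ ≲ x₂) ∷ (1 , x₄ ≲ x₅) ∷ []) (x₀ ⊞ 2 ⊠ x₃ ≲ x₂ ⊞ 2 ⊠ x₁ ⊞ lit 0)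
    (≤-reflexive (sym (ρ-sound H p)) , ≤-reflexive (ρ-sound K q) , le , tt)

  Low : VSet n → Set
  Low K = Proper K × Below C 1 K A

  Low? : ∀ K → Dec (Low K)
  Low? K = Proper? K ×-dec (_ ≤? _)

  Low-resp : ∀ K L → (∀ v → K v ≡ L v) → Low K → Low L
  Low-resp K L e (p , b) = Proper-resp K L e p ,
    subst₂ (λ w s → w + 2 * ends G A ≤ mass C A + 2 * s + 1)
      (∑-ext K L (λ v → weight (κ v)) e) (ends-ext G K L e) b

  -- A proper set that is not low has potential at least ρ(A) + 2, and ρ(A) ≥ 1.
  gap : (∀ K → ¬ Low K) → ∀ K → K ⊆ A → (∃ λ v → v ∈ A × v ∉ K) → 2 ≤ card K → Potential≥ C 3 K
  gap none K sub out big = linear (mass C K ∷ ends G K ∷ mass C A ∷ ends G A ∷ [])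
    ((1 , lit 1 ⊞ (x₂ ⊞ 2 ⊠ x₁ ⊞ lit 1) ≲ x₀ ⊞ 2 ⊠ x₃) ∷ (1 , lit 1 ⊞ 2 ⊠ x₃ ≲ x₂) ∷ []) (lit 3 ⊞ 2 ⊠ x₁ ≲ x₀)
    (≰⇒> (λ b → none K ((sub , out , big) , b)) , sparse A (λ _ p → p) inhabited , tt)

  module Minimum (H : VSet n) (H-proper : Proper H) (minimal : ∀ K → Proper K → ρ H ≤ ρ K) (top : Below C 1 H A) where

    H⊆A : H ⊆ A
    H⊆A = proj₁ H-proper

    below-all : ∀ K → K ⊆ A → (∃ λ v → v ∈ A × v ∉ K) → 2 ≤ card K → Below C 0 H K
    below-all K sub out big = below H K H-proper (sub , out , big) (minimal K (sub , out , big))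

    smaller : card H < card A
    smaller with proj₁ (proj₂ H-proper)
    ... | v , v∈ , v∉ = card-< H A H⊆A v∈ v∉

    two-elements : ∃ λ x → ∃ λ y → x ∈ H × y ∈ H × x ≢ y
    two-elements with inhabited-by-card H (proj₂ (proj₂ H-proper))
    ... | x , x∈ with ∑-positive (H ⊖ x) (λ _ → 1)
                       (≤-pred (≤-trans (proj₂ (proj₂ H-proper)) (≤-reflexive (∑-⊖ H (λ _ → 1) x∈))))
    ...   | y , y∈ , _ = x , y , x∈ , ∈⊖ˡ H x y∈ , ∈⊖ʳ H x y∈ ∘ sym

    contract : (κ₀ : Fin n → Kind) → (∀ v → Demotes (κ v) (κ₀ v)) →
      (T : Solution (restrict C H κ₀)) →
      (Below C 0 H A
        ⊎ ((∃ λ y → y ∈ A ∖ H × ∃ λ h → h ∈ H ∖ chosen T × adj G y h ≡ true)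
        ⊎ (∀ y h → y ∈ A ∖ H → h ∈ chosen T → adj G y h ≡ true → ⊥))) → Solution C
    contract κ₀ d T b with two-elements
    ... | x , y , x∈ , y∈ , x≢y = Contract.solution C sparse solve-smaller H H⊆A x y x∈ y∈ x≢y below-all top κ₀ d T b

    plain : Solution (restrict C H κ)
    plain = solve-smaller _ smaller λ K sub i → sparse K (λ v p → H⊆A v (sub v p)) i

    -- If ρ(H) exceeds ρ(A) ≥ 1, minimality gives potential at least 2 to every subset of `H` with
    -- two or more vertices, which pays 1 for demoting `b`.
    demoted : (b : Fin n) → (Below C 0 H A → ⊥) →
      Solution (restrict C H (relabel ⁅ b ⁆ demote κ))
    demoted b above = solve-smaller C₀ smaller (sparse-from-pairs C₀ λ K sub big →
      linear (mass C K ∷ ends G K ∷ mass C H ∷ ends G H ∷ mass C A ∷ ends G A ∷ mass C₀ K ∷ ∑ K (λ v → 𝟙 (⁅ b ⁆ v)) ∷ [])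
        ((1 , x₂ ⊞ 2 ⊠ x₁ ≲ x₀ ⊞ 2 ⊠ x₃ ⊞ lit 0) ∷ (1 , lit 1 ⊞ (x₄ ⊞ 2 ⊠ x₃ ⊞ lit 0) ≲ x₂ ⊞ 2 ⊠ x₅)
          ∷ (1 , lit 1 ⊞ 2 ⊠ x₅ ≲ x₄) ∷ (1 , x₀ ≲ x₆ ⊞ 1 ⊠ x₇) ∷ (1 , x₇ ≲ lit 1) ∷ [])
        (lit 1 ⊞ 2 ⊠ x₁ ≲ x₆)
        ( below-all K (λ v p → H⊆A v (sub v p)) (outside K sub) big
        , ≰⇒> above , sparse A (λ _ p → p) inhabited , relabel-cost ⁅ b ⁆ κ 1 demote-cost K , ∑𝟙⁅⁆≤1 K b , tt))
      where
      C₀ : Config n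
      C₀ = restrict C H (relabel ⁅ b ⁆ demote κ)
      outside : ∀ K → K ⊆ H → ∃ λ v → v ∈ A × v ∉ K
      outside K sub with proj₁ (proj₂ H-proper)
      ... | v , v∈ , v∉ = v , v∈ , ∉-intro K λ p → true≢false (sub v p) v∉

    solution : Solution C
    solution = by-top (_ ≤? _)
      where
      Touches : VSet n
      Touches h = H h ∧ positive (deg G (A ∖ H) h)
      -- A vertex of `H` with an outside neighbour is forced into the forest to supply the edge that
      -- `tight` needs; without such a vertex there is nothing to seal.
      by-boundary : (Below C 0 H A → ⊥) → Inhabited Touches ⊎ (∀ h → h ∉ Touches) → Solution C
      by-boundary above (inj₂ none) = contract κ (λ _ → demotes-refl) plain (inj₂ (inj₂ λ y h y∈ h∈ e →
        true≢false (∧-true (chosen-verts plain h h∈) (positive⁺ (1≤deg G (A ∖ H) y∈ (adj-swap G e)))) (none h)))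
      by-boundary above (inj₁ (b , p))
        with ∑-positive (A ∖ H) (λ u → 𝟙 (adj G b u)) (positive⁻ (∧-trueʳ (H b) p))
      ... | y , y∈ , q = contract (relabel ⁅ b ⁆ demote κ) (relabel-demotes ⁅ b ⁆ κ demote-demotes) (demoted b above)
        (inj₂ (inj₁ (y , y∈ , b , ∈∖ H (chosen (demoted b above)) (∧-trueˡ (H b) p) b-out , adj-swap G (1≤𝟙 q))))
        where
        b-out : b ∉ chosen (demoted b above)
        b-out = ∉-intro (chosen (demoted b above)) λ c → demote≢free (κ b)
          (trans (sym (relabel-∈ ⁅ b ⁆ demote κ (∈⁅⁆ b))) (chosen-free (demoted b above) b c))
      by-top : Dec (Below C 0 H A) → Solution C
      by-top (yes t)     = contract κ (λ _ → demotes-refl) plain (inj₁ t)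
      by-top (no above) = by-boundary above (inhabited? Touches)

  solution : Solution C
  solution = by-search (Search.any-set? Low Low-resp Low?)
    where
    by-search : Dec (∃ Low) → Solution C
    by-search (no none) = Discharge.solution C sparse solve-smaller (gap λ K p → none (K , p)) inhabited
    -- The minimum ranges over all proper sets, not only the low ones, so that every proper set can
    -- be compared with `H`; being at most ρ(K), it is low as well.
    by-search (yes (K , K-proper , K-low)) with argmin Proper Proper-resp Proper? ρ ρ-resp (K , K-proper)
    ... | H , H-proper , minimal = Minimum.solution H H-proper minimal
      (linear (mass C H ∷ ends G H ∷ mass C K ∷ ends G K ∷ mass C A ∷ ends G A ∷ [])
        ((1 , x₀ ⊞ 2 ⊠ x₃ ≲ x₂ ⊞ 2 ⊠ x₁ ⊞ lit 0) ∷ (1 , x₂ ⊞ 2 ⊠ x₅ ≲ x₄ ⊞ 2 ⊠ x₃ ⊞ lit 1) ∷ [])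
        (x₀ ⊞ 2 ⊠ x₅ ≲ x₄ ⊞ 2 ⊠ x₁ ⊞ lit 1)
        (below H K H-proper K-proper (minimal K K-proper) , K-low , tt))

solve-config : (C : Config n) → Sparse C → Solution C
solve-config {n} C sparse = go (suc (card (verts C))) C ≤-refl sparse
  where
  go : ∀ k (C : Config n) → card (verts C) < k → Sparse C → Solution C
  go (suc k) C b sparse with inhabited? (verts C)
  ... | inj₁ i = Step.solution C sparse (λ C′ lt → go k C′ (≤-trans lt (≤-pred b))) i
  ... | inj₂ empty = record
    { chosen       = ∅
    ; chosen-verts = λ _ ()
    ; chosen-free  = λ _ ()
    ; independent  = λ _ _ ()
    ; unique       = λ _ _ _ _ ()
    ; sealed       = λ _ _ _ _ ()
    ; acyclic      = λ { K sub (v , p) → ⊥-elim (true≢false (∈∖ˡ (verts C) ∅ (sub v p)) (empty v)) }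
    }

-- From labelled graphs to configurations

-- `I` gets `sealed₁` only for its weight 1; these vertices are removed before a configuration is
-- solved.
toKind : Label → Kind
toKind I = sealed₁
toKind F = tree
toKind U = free

count-∑ : ∀ (K q : VSet n) → count (λ v → K v ∧ q v) ≡ ∑ K (λ v → 𝟙 (q v))
count-∑ {zero}  K q = refl
count-∑ {suc n} K q = cong₂ _+_ (head (K zero) (q zero)) (count-∑ (K ∘ suc) (q ∘ suc))
  where
  head : ∀ a b → (if a ∧ b then 1 else 0) ≡ (if a then 𝟙 b else 0)
  head true  b = refl
  head false b = refl

potPos-∑ : ∀ {G : SimpleGraph n} ℓ (H : Subgraph G) → potPos ℓ H ≡ ∑ (vert H) (λ v → weight (toKind (ℓ v)))
potPos-∑ ℓ H = sym (begin
  ∑ K (λ v → weight (toKind (ℓ v)))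
    ≡⟨ ∑-cong K (λ v _ → split (ℓ v)) ⟩
  ∑ K (λ v → 𝟙 (isI (ℓ v)) + 4 * 𝟙 (isF (ℓ v)) + 5 * 𝟙 (isU (ℓ v)))
    ≡⟨ ∑-+ K (λ v → 𝟙 (isI (ℓ v)) + 4 * 𝟙 (isF (ℓ v))) (λ v → 5 * 𝟙 (isU (ℓ v))) ⟩
  ∑ K (λ v → 𝟙 (isI (ℓ v)) + 4 * 𝟙 (isF (ℓ v))) + ∑ K (λ v → 5 * 𝟙 (isU (ℓ v)))
    ≡⟨ cong₂ _+_ (trans (∑-+ K (λ v → 𝟙 (isI (ℓ v))) (λ v → 4 * 𝟙 (isF (ℓ v))))
         (cong₂ _+_ (sym (count-∑ K (λ v → isI (ℓ v)))) (scaled 4 isF))) (scaled 5 isU) ⟩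
  potPos ℓ H ∎)
  where
  open ≡-Reasoning
  K = vert H
  split : ∀ l → weight (toKind l) ≡ 𝟙 (isI l) + 4 * 𝟙 (isF l) + 5 * 𝟙 (isU l)
  split I = refl
  split F = refl
  split U = refl
  scaled : ∀ c (q : Label → Bool) → ∑ K (λ v → c * 𝟙 (q (ℓ v))) ≡ c * count (λ v → K v ∧ q (ℓ v))
  scaled c q = trans (∑-* c K (λ v → 𝟙 (q (ℓ v)))) (cong (c *_) (sym (count-∑ K (λ v → q (ℓ v)))))

induced : (G : SimpleGraph n) → VSet n → Subgraph G
induced G K = record
  { vert     = K
  ; edge     = λ u v → K u ∧ (K v ∧ adj G u v)
  ; edge-sym = λ u v → trans (swap (K u) (K v) (adj G u v)) (cong (λ e → K v ∧ (K u ∧ e)) (adj-sym G u v))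
  ; edge-adj = λ u v p → ∧-trueʳ (K v) (∧-trueʳ (K u) p)
  ; edge-end = λ u v p → ∧-trueˡ (K u) p
  }
  where
  swap : ∀ a b e → a ∧ (b ∧ e) ≡ b ∧ (a ∧ e)
  swap a b e = trans (sym (Bool.∧-assoc a b e)) (trans (cong (_∧ e) (Bool.∧-comm a b)) (Bool.∧-assoc b a e))

𝟙-T : ∀ {b} → T b → 𝟙 b ≡ 1
𝟙-T {true} _ = refl

𝟙-¬T : ∀ {b} → ¬ T b → 𝟙 b ≡ 0
𝟙-¬T {true}  h = ⊥-elim (h tt)
𝟙-¬T {false} h = refl

one-direction : ∀ (u v : Fin n) → u ≢ v → 𝟙 (toℕ u <ᵇ toℕ v) + 𝟙 (toℕ v <ᵇ toℕ u) ≡ 1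
one-direction u v u≢v with <-cmp (toℕ u) (toℕ v)
... | tri< a _ b = cong₂ _+_ (𝟙-T (<⇒<ᵇ a)) (𝟙-¬T (b ∘ <ᵇ⇒< (toℕ v) (toℕ u)))
... | tri≈ _ e _ = ⊥-elim (u≢v (toℕ-injective e))
... | tri> a _ b = cong₂ _+_ (𝟙-¬T (a ∘ <ᵇ⇒< (toℕ u) (toℕ v))) (𝟙-T (<⇒<ᵇ b))

count≡sumFin : (q : VSet n) → count q ≡ sumFin (λ v → 𝟙 (q v))
count≡sumFin {zero}  q = refl
count≡sumFin {suc n} q = cong (𝟙 (q zero) +_) (count≡sumFin (q ∘ suc))

-- The sum over pairs with u < v is added to its transpose; the two orders together meet each
-- adjacent pair once, since adjacent vertices differ.
edgeCount-ends : (G : SimpleGraph n) (K : VSet n) → 2 * edgeCount (induced G K) ≡ ends G K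
edgeCount-ends {n} G K = begin
  2 * edgeCount (induced G K)
    ≡⟨ cong (2 *_) (sumFin-cong λ u → count≡sumFin (λ v → (toℕ u <ᵇ toℕ v) ∧ e u v)) ⟩
  2 * L
    ≡⟨ cong (L +_) (+-identityʳ L) ⟩
  L + L
    ≡⟨ cong (L +_) (trans (sumFin-swap f) (sumFin-cong λ u → sumFin-cong λ v →
         cong (λ x → 𝟙 ((toℕ v <ᵇ toℕ u) ∧ x)) (edge-sym (induced G K) v u))) ⟩
  L + sumFin (λ u → sumFin (g u))
    ≡⟨ sym (trans (sumFin-cong λ u → sumFin-+ (f u) (g u)) (sumFin-+ (λ u → sumFin (f u)) (λ u → sumFin (g u)))) ⟩
  sumFin (λ u → sumFin (λ v → f u v + g u v))
    ≡⟨ sumFin-cong (λ u → row u) ⟩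
  ends G K ∎
  where
  open ≡-Reasoning
  e : Fin n → Fin n → Bool
  e = edge (induced G K)
  f g : Fin n → Fin n → ℕ
  f u v = 𝟙 ((toℕ u <ᵇ toℕ v) ∧ e u v)
  g u v = 𝟙 ((toℕ v <ᵇ toℕ u) ∧ e u v)
  L : ℕ
  L = sumFin (λ u → sumFin (f u))
  merge : ∀ s t b → (b ≡ true → 𝟙 s + 𝟙 t ≡ 1) → 𝟙 (s ∧ b) + 𝟙 (t ∧ b) ≡ 𝟙 b
  merge s t true  h = trans (cong₂ (λ x y → 𝟙 x + 𝟙 y) (Bool.∧-identityʳ s) (Bool.∧-identityʳ t)) (h refl)
  merge s t false h = cong₂ (λ x y → 𝟙 x + 𝟙 y) (Bool.∧-zeroʳ s) (Bool.∧-zeroʳ t)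
  cell : ∀ u v → f u v + g u v ≡ 𝟙 (e u v)
  cell u v = merge (toℕ u <ᵇ toℕ v) (toℕ v <ᵇ toℕ u) (e u v) λ p →
    one-direction u v (adj-≢ G (edge-adj (induced G K) u v p))
  spread : ∀ a b x → 𝟙 (a ∧ (b ∧ x)) ≡ (if a then (if b then 𝟙 x else 0) else 0)
  spread true  true  x = refl
  spread true  false x = refl
  spread false b     x = refl
  row : ∀ u → sumFin (λ v → f u v + g u v) ≡ (if K u then deg G K u else 0)
  row u = trans (sumFin-cong λ v → trans (cell u v) (spread (K u) (K v) (adj G u v))) (pull (K u))
    where
    pull : ∀ a → sumFin (λ v → if a then (if K v then 𝟙 (adj G u v) else 0) else 0) ≡ (if a then deg G K u else 0)
    pull true  = refl
    pull false = sumFin-0 {n}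

-- Cycles

last-or-inject : ∀ {k} (i : Fin (suc k)) → i ≡ fromℕ k ⊎ ∃ λ j → i ≡ inject₁ j
last-or-inject i with view i
... | ‵fromℕ     = inj₁ refl
... | ‵inject₁ j = inj₂ (j , refl)

-- Predecessor and successor differ because a cycle has at least three vertices.
cycle-neighbours : ∀ {G : SimpleGraph n} (Z : Cycle G) i →
  ∃ λ j → ∃ λ k → j ≢ k × adj G (vtx Z i) (vtx Z j) ≡ true × adj G (vtx Z i) (vtx Z k) ≡ true
cycle-neighbours {G = G} Z zero =
  suc zero , fromℕ (2 + len Z) , (λ ()) , step Z zero , adj-swap G (close Z)
cycle-neighbours {G = G} Z (suc i) = inject₁ i , next (last-or-inject (suc i))
  where
  next : suc i ≡ fromℕ (2 + len Z) ⊎ (∃ λ j → suc i ≡ inject₁ j) →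
    ∃ λ k → inject₁ i ≢ k × adj G (vtx Z (suc i)) (vtx Z (inject₁ i)) ≡ true × adj G (vtx Z (suc i)) (vtx Z k) ≡ true
  next (inj₁ last) = zero , not-zero i last , adj-swap G (step Z i) ,
    subst (λ l → adj G (vtx Z l) (vtx Z zero) ≡ true) (sym last) (close Z)
    where
    not-zero : ∀ i → suc i ≡ fromℕ (2 + len Z) → inject₁ i ≢ zero
    -- `suc zero` is last only in a cyclic sequence of two vertices.
    not-zero zero    () _
    not-zero (suc i) _ ()
  next (inj₂ (j , e)) = suc j , apart , adj-swap G (step Z i) ,
    subst (λ l → adj G (vtx Z l) (vtx Z (suc j)) ≡ true) (sym e) (step Z j)
    where
    apart : inject₁ i ≢ suc j
    apart h = 1+n≰n (≤-trans (n≤1+n (suc (toℕ j))) (≤-reflexive (begin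
      suc (suc (toℕ j))        ≡⟨ cong suc (sym (cong toℕ h)) ⟩
      suc (toℕ (inject₁ i))    ≡⟨ cong suc (toℕ-inject₁ i) ⟩
      toℕ (suc i)              ≡⟨ cong toℕ e ⟩
      toℕ (inject₁ j)          ≡⟨ toℕ-inject₁ j ⟩
      toℕ j                    ∎)))
      where open ≡-Reasoning

-- On the vertex set of a cycle all degrees are at least 2, so it induces at least as many edges as
-- vertices.
acyclic⇒no-cycle : (G : SimpleGraph n) (S : VSet n) → Acyclic G S → InducedForest G S
acyclic⇒no-cycle {n} G S acyc (Z , inS) = 1+n≰n (≤-trans (n≤1+n (suc (ends G K)))
  (≤-trans (acyc K K⊆S (vtx Z zero , image zero)) crowded))
  where
  K : VSet n
  K v = does (any? (λ i → vtx Z i ≟ v))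
  image : ∀ i → vtx Z i ∈ K
  image i = dec-true (any? (λ j → vtx Z j ≟ vtx Z i)) (i , refl)
  preimage : ∀ v → v ∈ K → ∃ λ i → vtx Z i ≡ v
  preimage v p = does⁻ (any? (λ i → vtx Z i ≟ v)) p
  K⊆S : K ⊆ S
  K⊆S v p with preimage v p
  ... | i , refl = inS i
  degree : ∀ v → v ∈ K → 2 ≤ deg G K v
  degree v p with preimage v p
  ... | i , refl with cycle-neighbours Z i
  ...   | j , k , j≢k , a , b = 2≤deg G K (image j) (image k) (j≢k ∘ inj Z) a b
  crowded : 2 * card K ≤ ends G K
  crowded = ≤-trans (≤-reflexive (sym (∑-* 2 K (λ _ → 1)))) (∑-mono K degree)

-- Removing the vertices labelled `I` and restoring them

module Labelled {n : ℕ} (G : SimpleGraph n) (ℓ : Fin n → Label)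
  (positive-potential : ∀ (H : Subgraph G) → Nonempty H → PositivePotential ℓ H) where

  C₁ : Config n
  C₁ = record { verts = λ _ → true ; graph = G ; kind = toKind ∘ ℓ }

  C₁-sparse : Sparse C₁
  C₁-sparse K _ i = subst₂ (λ e w → suc e ≤ w)
    -- 4 |E| = 2 · (2 |E|), and `ends` is 2 |E|.
    (trans (*-assoc 2 2 (edgeCount (induced G K))) (cong (2 *_) (edgeCount-ends G K))) (potPos-∑ ℓ (induced G K))
    (positive-potential (induced G K) i)

  𝐈 : VSet n
  𝐈 v = isI (ℓ v)

  𝐈-kind : ∀ {v} → v ∈ 𝐈 → toKind (ℓ v) ≡ sealed₁
  𝐈-kind {v} p with ℓ v
  ... | I = refl

  κ₀ : Fin n → Kind
  κ₀ = relabel (positive ∘ deg G 𝐈) seal (toKind ∘ ℓ)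

  C₀ : Config n
  C₀ = restrict C₁ (λ v → not (𝐈 v)) κ₀

  -- Add to `K` its neighbours `J` in `𝐈`. Every edge between them costs 4, which covers the weight
  -- 1 of a member of `J` and the 3 lost by sealing, as neither the members of `J` nor the sealed
  -- vertices of `K` outnumber these edges.
  C₀-sparse : Sparse C₀
  C₀-sparse K K⊆ (v₀ , v₀∈) = linear
    (ends G K ∷ ends G J ∷ ∑ K (deg G J) ∷ mass C₁ K ∷ card J ∷ mass C₀ K ∷ ∑ K (λ v → 𝟙 (positive (deg G 𝐈 v))) ∷ [])
    ((1 , lit 1 ⊞ 2 ⊠ (x₀ ⊞ x₁ ⊞ 2 ⊠ x₂) ≲ x₃ ⊞ x₄) ∷ (1 , x₄ ≲ x₂) ∷ (1 , x₃ ≲ x₅ ⊞ 3 ⊠ x₆) ∷ (3 , x₆ ≲ x₂) ∷ [])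
    (lit 1 ⊞ 2 ⊠ x₀ ≲ x₅)
    ( subst₂ (λ e w → 1 + 2 * e ≤ w) (ends-∪ G K J disjoint)
        (trans (∑-∪ K J (λ v → weight (toKind (ℓ v))) disjoint)
          (cong (mass C₁ K +_) (∑-cong J λ v p → cong weight (𝐈-kind (∧-trueˡ (𝐈 v) p)))))
        (C₁-sparse (K ∪ J) (λ _ _ → refl) (v₀ , ∈∪ˡ K J v₀∈))
    , ≤-trans (∑-mono J λ v p → positive⁻ (∧-trueʳ (𝐈 v) p)) (≤-reflexive (cross-sym G K J))
    , relabel-cost (positive ∘ deg G 𝐈) (toKind ∘ ℓ) 3 seal-cost K
    , ∑-mono K touched , tt)
    where
    J : VSet n
    J v = 𝐈 v ∧ positive (deg G K v)
    disjoint : ∀ v → v ∈ K → v ∉ J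
    disjoint v p = ∉-intro J λ q → true≢false (∧-trueˡ (𝐈 v) q) (not-true⁻ (K⊆ v p))
    touched : ∀ v → v ∈ K → 𝟙 (positive (deg G 𝐈 v)) ≤ deg G J v
    touched v p = by-cases (1 ≤? deg G 𝐈 v)
      where
      by-cases : Dec (1 ≤ deg G 𝐈 v) → 𝟙 (positive (deg G 𝐈 v)) ≤ deg G J v
      by-cases (no h)  = ≤-trans (𝟙positive≤ (deg G 𝐈 v)) (≤-trans (≤-pred (≰⇒> h)) z≤n)
      by-cases (yes h) with ∑-positive 𝐈 (λ u → 𝟙 (adj G v u)) h
      ... | y , y∈ , e = ≤-trans (𝟙≤1 (positive (deg G 𝐈 v)))
        (1≤deg G J {v} {y} (∧-true y∈ (positive⁺ (1≤deg G K p (adj-swap G (1≤𝟙 e))))) (1≤𝟙 e))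

  abstract
    S : Solution C₀
    S = solve-config C₀ C₀-sparse

  part : VSet n
  part = 𝐈 ∪ chosen S

  pair-mass : ∀ {u v} → u ∈ 𝐈 → v ∈ 𝐈 → u ≢ v → mass C₁ (⁅ u ⁆ ⊕ v) ≡ 2
  pair-mass {u} {v} p q u≢v = trans (mass-⊕ C₁ ⁅ u ⁆ (∉⁅⁆ u (u≢v ∘ sym)))
    (cong₂ _+_ (trans (∑-⁅⁆ u (λ w → weight (toKind (ℓ w)))) (cong weight (𝐈-kind p))) (cong weight (𝐈-kind q)))

  -- An edge would give potential 1 + 1 - 4.
  𝐈-nonadjacent : ∀ u v → u ∈ 𝐈 → v ∈ 𝐈 → adj G u v ≡ true → ⊥
  𝐈-nonadjacent u v p q e = 1+n≰n {4} (linear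
    (ends G ⁅ u ⁆ ∷ deg G ⁅ u ⁆ v ∷ mass C₁ (⁅ u ⁆ ⊕ v) ∷ [])
    ((1 , lit 1 ⊞ 2 ⊠ (x₀ ⊞ 2 ⊠ x₁) ≲ x₂) ∷ (1 , x₂ ≲ lit 2) ∷ (4 , lit 1 ≲ x₁) ∷ []) (lit 5 ≲ lit 4)
    ( subst (λ s → 1 + 2 * s ≤ mass C₁ (⁅ u ⁆ ⊕ v)) (ends-⊕ G ⁅ u ⁆ (∉⁅⁆ u (adj-≢ G e ∘ sym)))
        (C₁-sparse (⁅ u ⁆ ⊕ v) (λ _ _ → refl) (v , x∈⊕ ⁅ u ⁆ v))
    , ≤-reflexive (pair-mass p q (adj-≢ G e)) , 1≤deg G ⁅ u ⁆ (∈⁅⁆ u) (adj-swap G e) , tt))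

  -- A common neighbour would give potential at most 1 + 1 + 5 - 8.
  𝐈-no-common-neighbour : ∀ u v w → u ∈ 𝐈 → v ∈ 𝐈 → u ≢ v → adj G w u ≡ true → adj G w v ≡ true → ⊥
  𝐈-no-common-neighbour u v w p q u≢v wu wv = 1+n≰n {7} (linear
    (ends G (⁅ u ⁆ ⊕ v) ∷ mass C₁ (⁅ u ⁆ ⊕ v) ∷ weight (toKind (ℓ w)) ∷ [])
    ((1 , lit 9 ⊞ 2 ⊠ x₀ ≲ x₁ ⊞ x₂) ∷ (1 , x₁ ≲ lit 2) ∷ (1 , x₂ ≲ lit 5) ∷ []) (lit 8 ≲ lit 7)
    ( path-potential C₁ (⁅ u ⁆ ⊕ v) 1 (∉⊕ ⁅ u ⁆ (∉⁅⁆ u (adj-≢ G wu)) (adj-≢ G wv))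
        (∈∪ˡ ⁅ u ⁆ ⁅ v ⁆ (∈⁅⁆ u)) (x∈⊕ ⁅ u ⁆ v) u≢v wu wv
        (C₁-sparse (⁅ u ⁆ ⊕ v ⊕ w) (λ _ _ → refl) (w , x∈⊕ (⁅ u ⁆ ⊕ v) w))
    , ≤-reflexive (pair-mass p q u≢v) , weight≤5 (toKind (ℓ w)) , tt))

  touched-sealed : ∀ {v y} → y ∈ 𝐈 → adj G v y ≡ true → Sealed (κ₀ v)
  touched-sealed {v} p e = subst Sealed (sym (relabel-∈ (positive ∘ deg G 𝐈) seal (toKind ∘ ℓ) {v}
    (positive⁺ (1≤deg G 𝐈 p e)))) (seal-sealed (toKind (ℓ v)))

  chosen-untouched : ∀ {v y} → v ∈ chosen S → y ∈ 𝐈 → adj G v y ≡ true → ⊥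
  chosen-untouched {v} p q e = sealed≢free (touched-sealed q e) (chosen-free S v p)

  nonadjacent : ∀ u v → u ∈ 𝐈 ⊎ u ∈ chosen S → v ∈ 𝐈 ⊎ v ∈ chosen S → adj G u v ≡ true → ⊥
  nonadjacent u v (inj₁ p) (inj₁ q) e = 𝐈-nonadjacent u v p q e
  nonadjacent u v (inj₁ p) (inj₂ q) e = chosen-untouched q p (adj-swap G e)
  nonadjacent u v (inj₂ p) (inj₁ q) e = chosen-untouched p q e
  nonadjacent u v (inj₂ p) (inj₂ q) e = independent S u v p q e

  -- For `w` in `𝐈` a single neighbour in `part` is already too much. Otherwise a neighbour in `𝐈`
  -- seals `w`, which excludes chosen neighbours.
  no-common-neighbour : ∀ u v w → u ≢ v → w ∈ 𝐈 ⊎ w ∉ 𝐈 → u ∈ 𝐈 ⊎ u ∈ chosen S → v ∈ 𝐈 ⊎ v ∈ chosen S →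
    adj G w u ≡ true → adj G w v ≡ true → ⊥
  no-common-neighbour u v w u≢v (inj₁ r) p _ wu wv = nonadjacent w u (inj₁ r) p wu
  no-common-neighbour u v w u≢v (inj₂ r) (inj₁ p) (inj₁ q) wu wv = 𝐈-no-common-neighbour u v w p q u≢v wu wv
  no-common-neighbour u v w u≢v (inj₂ r) (inj₁ p) (inj₂ q) wu wv =
    sealed S w v (not-true r) (touched-sealed p wu) q wv
  no-common-neighbour u v w u≢v (inj₂ r) (inj₂ p) (inj₁ q) wu wv =
    sealed S w u (not-true r) (touched-sealed q wv) p wu
  no-common-neighbour u v w u≢v (inj₂ r) (inj₂ p) (inj₂ q) wu wv =
    u≢v (unique S w u v (not-true r) p q wu wv)

  two-independent : TwoIndependent G part
  two-independent u v p q u≢v = ∉-intro (adj G u) (nonadjacent u v p′ q′) ,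
    λ { (w , uw , wv) → no-common-neighbour u v w u≢v (member? 𝐈 w) p′ q′ (adj-swap G uw) wv }
    where
    p′ = ∈∪⁻ 𝐈 (chosen S) {u} p
    q′ = ∈∪⁻ 𝐈 (chosen S) {v} q

  forest : InducedForest G (λ v → if part v then false else true)
  forest = acyclic⇒no-cycle G (λ v → if part v then false else true) λ K sub → acyclic S K λ v p →
    rest (𝐈 v) (chosen S v) (sub v p)
    where
    rest : ∀ a b → (if a ∨ b then false else true) ≡ true → not a ∧ not b ≡ true
    rest false false _ = refl

  I⇒part : ∀ v → ℓ v ≡ I → part v ≡ true
  I⇒part v e = ∈∪ˡ 𝐈 (chosen S) (cong isI e)

  F⇒¬part : ∀ v → ℓ v ≡ F → part v ≡ false
  F⇒¬part v e = ∉∪ 𝐈 (chosen S) (cong isI e) (∉-intro (chosen S) λ c → not-free (chosen-free S v c))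
    where
    not-free : κ₀ v ≡ free → ⊥
    not-free k with trans (sym (cong toKind e))
      (reflects-free (relabel-demotes (positive ∘ deg G 𝐈) (toKind ∘ ℓ) seal-demotes v) k)
    ... | ()

theorem4 : ∀ (n : ℕ) (G : SimpleGraph n) (ℓ : Fin n → Label) →
    (∀ (H : Subgraph G) → Nonempty H → PositivePotential ℓ H) →
    Σ (Fin n → Bool) λ part →
    IFPartition G part ×
    (∀ v → ℓ v ≡ I → part v ≡ true) ×
    (∀ v → ℓ v ≡ F → part v ≡ false)
theorem4 n G ℓ h = part , (two-independent , forest) , I⇒part , F⇒¬part
  where open Labelled G ℓ h
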